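{- For all integers $k\ge 1$ and $n\ge 3$, $GR_k(C_{2n+1})=n\cdot 2^k+1$.
   Context: A Gallai coloring of a complete graph is an edge-coloring with no rainbow triangle (a triangle whose three edges receive three distinct colors); a Gallai $k$-coloring is a Gallai coloring using $k$ colors. For a graph $H$ and integer $k\ge1$, the Gallai-Ramsey number $GR_k(H)$ is the least positive integer $N$ such that every Gallai $k$-coloring of the complete graph $K_N$ contains a monochromatic copy of $H$. $C_m$ denotes the cycle on $m$ vertices. -}

module Defs where

open import Data.Nat using (ℕ; zero; suc; _+_; _<_; _%_)
open import Data.Fin using (Fin; toℕ)
open import Data.Product using (Σ; _×_)
open import Function.Definitions using (Injective)
open import Relation.Binary.PropositionalEquality using (_≡_; _≢_)
open import Relation.Nullary using (¬_)

-- An edge-colouring of the complete graph K_N with (at most) k colours: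
-- a colour for every pair of vertices, required to be symmetric.
-- (The value on the diagonal c i i is irrelevant.)
record EdgeColouring (N k : ℕ) : Set where
  field
    colour : Fin N → Fin N → Fin k
    symm   : ∀ i j → colour i j ≡ colour j i
open EdgeColouring public

RainbowTriangle : ∀ {N k} → EdgeColouring N k → Fin N → Fin N → Fin N → Set
RainbowTriangle c x y z =
  x ≢ y × y ≢ z × x ≢ z ×
  colour c x y ≢ colour c y z × colour c y z ≢ colour c x z × colour c x y ≢ colour c x z

Gallai : ∀ {N k} → EdgeColouring N k → Set
Gallai {N} c = ∀ (x y z : Fin N) → ¬ RainbowTriangle c x y z

CycAdj : (m : ℕ) → Fin (suc m) → Fin (suc m) → Set
CycAdj m i j = toℕ j ≡ (suc (toℕ i)) % (suc m)

MonoCycle : ∀ {N k} → EdgeColouring N k → ℕ → Set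
MonoCycle {N} {k} c m =
  Σ (Fin (suc m) → Fin N) λ f →
    Injective _≡_ _≡_ f ×
    Σ (Fin k) λ a → ∀ i j → CycAdj m i j → colour c (f i) (f j) ≡ a

GArrowsCycle : ℕ → ℕ → ℕ → Set
GArrowsCycle k m N = ∀ (c : EdgeColouring N k) → Gallai c → MonoCycle c m

IsGRCycle : ℕ → ℕ → ℕ → Set
IsGRCycle k m R =
  0 < R × GArrowsCycle k m R × (∀ N → 0 < N → N < R → ¬ GArrowsCycle k m N)

{-# OPTIONS --safe #-}
-- For the upper bound, let W be a set of vertices coloured with j colours, and for each of these
-- colours i let xᵢ < n further vertices be joined to all of W in colour i; then, without a
-- monochromatic C₂ₙ₊₁, |W| + Σ xᵢ ≤ n 2ʲ. The extra vertices are small sets split off earlier, and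
-- the bound is proved by induction on j and |W|.
--
-- For j = 1 it says that a complete multipartite graph on 2n + 1 vertices with parts of size at most
-- n is Hamiltonian. For j = 2 it comes down to the Bondy–Erdős theorem R(C₂ₙ₊₁) ≤ 4n + 1: a 2-coloured
-- K₄ₙ₊₁ has a Hamiltonian cycle formed by a red and a blue path; the chords at distance 2n and 2n + 1
-- on the longer path close up to a long monochromatic cycle, which chords at distance 2 and 3 shorten
-- to length 2n + 2. If that cycle is red and there is no C₂ₙ₊₁, its even and odd vertices form
-- two blue cliques, which cannot be extended to 4n + 1 vertices.
--
-- For j ≥ 3 take a Gallai partition of W with colours red and blue. Suppose first that a part A has
-- more than n vertices, with red neighbours R and blue neighbours B. A red edge inside A (if |R| ≥ n)
-- or inside R (if |R| > n) would close a red C₂ₙ₊₁ with the complete bipartite graph on A and R, so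
-- large sides lose a colour, while small sides are added to the sets of extra vertices. Suppose now
-- that all parts have at most n vertices. Between an n-set and an (n + 1)-set there is then always a
-- red and a blue edge; hence depth-first search finds long monochromatic paths outside the
-- neighbourhood of a vertex v, and a segment of such a path closes up through v.
module Submission where

open import Defs
open import Data.Bool using (Bool; true; false; _∧_; not) renaming (T to IsTrue)
import Data.Bool.Properties as Bool
open import Data.Empty using (⊥; ⊥-elim)
open import Data.Fin using (Fin; toℕ; fromℕ<)
import Data.Fin as Fin
import Data.Fin.Properties as Fin
import Data.Integer as ℤ
open import Data.List using (List; []; _∷_; _++_; length; map; take; drop; reverse; allFin)
import Data.List.Properties as List
open import Data.List.Membership.Propositional using (_∈_; _∉_)
open import Data.List.Membership.Propositional.Properties
open import Data.List.Relation.Binary.Permutation.Propositional as Perm using (_↭_; prep; swap; ↭-refl; ↭-sym; ↭-trans)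
import Data.List.Relation.Binary.Permutation.Propositional.Properties as Perm
open import Data.List.Relation.Unary.All as All using (All; []; _∷_)
import Data.List.Relation.Unary.All.Properties as All
open import Data.List.Relation.Unary.AllPairs using ([]; _∷_)
open import Data.List.Relation.Unary.Any using (here; there)
open import Data.List.Relation.Unary.Linked using (Linked; []; [-]; _∷_)
open import Data.List.Relation.Unary.Unique.Propositional using (Unique)
import Data.List.Relation.Unary.Unique.Propositional.Properties as Unique
open import Data.Maybe using (Maybe; just; nothing)
import Data.Maybe.Properties as Maybe
open import Data.Nat using (ℕ; zero; suc; _+_; _*_; _∸_; _^_; _≤_; _<_; z≤n; s≤s; _%_; _≤?_; _<?_)
open import Data.Nat.DivMod using (m<n⇒m%n≡m; n%n≡0; m%n<n; [m+n]%n≡m%n; %-distribˡ-+; m%n%n≡m%n)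
open import Data.Nat.Properties
open import Data.Nat.ListAction using (sum)
open import Data.Nat.ListAction.Properties using (sum-↭)
open import Data.Nat.Tactic.RingSolver using (solve-∀)
open import Data.Product using (Σ; ∃; ∃₂; _×_; _,_; proj₁; proj₂)
open import Data.Sum using (_⊎_; inj₁; inj₂; [_,_]′)
import Data.Sum.Properties as Sum
open import Data.Unit using (tt)
open import Data.Vec using (Vec; []; _∷_; lookup)
import Data.Vec as Vec
import Data.Vec.Properties as Vec
open import Data.Vec.N-ary using (N-ary; _$ⁿ_)
open import Function using (_∘_; id; case_of_)
open import Relation.Binary.Definitions using (DecidableEquality)
open import Relation.Binary.PropositionalEquality using (_≡_; _≢_; refl; sym; trans; cong; cong₂; subst; subst₂)
open import Relation.Nullary using (¬_; Dec; yes; no; contradiction)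
open import Relation.Nullary.Decidable using (decidable-stable; _×-dec_; ¬?; _→-dec_; toSum)

-- Linear arithmetic over ℕ by Fourier–Motzkin elimination. The elimination only proposes
-- multipliers for the hypotheses; `refute` is what is verified.

-- The extra vertices make the induction close. If a large part has fewer than n red neighbours,
-- these are too few to exclude red edges inside it, and discarding them would lose up to n - 1
-- vertices with nothing gained. Kept as vertices joined in red, they pass from |W| to xᵢ and leave
-- the sum unchanged; the limit xᵢ < n marks the size from which such a set is strong enough to
-- remove its colour. Losing one colour halves the bound and losing two quarters it, so each step
-- draws on the two preceding values of j and the induction has two starting values. Between parts
-- only two colours occur, but inside the parts any colour may, so the 2-coloured theorem does not
-- apply to W when all parts are small. From j = 3 on a cruder argument suffices, because n 2ʲ
-- outgrows the joined sets: more than 5n vertices are left in W, and at least 7n + 2 if none is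
-- joined in red or blue. Two colours leave no such slack, and there the tight argument of Bondy and
-- Erdős is spent.

infix 6 _⊑_
infixl 7 _⊕_
infixr 8 _⊛_
infix 9 #_ 1+_
infix 3 _⊢_

data Lin (n : ℕ) : Set where
  var  : Fin n → Lin n
  #_   : ℕ → Lin n
  1+_  : Lin n → Lin n
  _⊕_  : Lin n → Lin n → Lin n
  _⊛_  : ℕ → Lin n → Lin n

data Ineq (n : ℕ) : Set where
  _⊑_ : Lin n → Lin n → Ineq n

data Sequent (n : ℕ) : Set where
  _⊢_ : List (Ineq n) → Ineq n → Sequent n

module _ {n : ℕ} where

  ⟦_⟧ : Lin n → Vec ℕ n → ℕ
  ⟦ var i ⟧ ρ = lookup ρ i
  ⟦ # k ⟧ ρ = k
  ⟦ 1+ e ⟧ ρ = suc (⟦ e ⟧ ρ)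
  ⟦ e ⊕ e′ ⟧ ρ = ⟦ e ⟧ ρ + ⟦ e′ ⟧ ρ
  ⟦ k ⊛ e ⟧ ρ = k * ⟦ e ⟧ ρ

  Holds : Vec ℕ n → Ineq n → Set
  Holds ρ (l ⊑ r) = ⟦ l ⟧ ρ ≤ ⟦ r ⟧ ρ

Coeffs : ℕ → Set
Coeffs n = ℕ × Vec ℕ n

dot : ∀ {n} → Vec ℕ n → Vec ℕ n → ℕ
dot [] [] = 0
dot (c ∷ cs) (x ∷ ρ) = c * x + dot cs ρ

value : ∀ {n} → Coeffs n → Vec ℕ n → ℕ
value (c , cs) ρ = c + dot cs ρ

unit : ∀ {n} → Fin n → Vec ℕ n
unit {suc n} Fin.zero = 1 ∷ Vec.replicate n 0
unit (Fin.suc i) = 0 ∷ unit i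

addC : ∀ {n} → Coeffs n → Coeffs n → Coeffs n
addC (c , cs) (d , ds) = c + d , Vec.zipWith _+_ cs ds

scaleC : ∀ {n} → ℕ → Coeffs n → Coeffs n
scaleC k (c , cs) = k * c , Vec.map (k *_) cs

coeffs : ∀ {n} → Lin n → Coeffs n
coeffs (var i) = 0 , unit i
coeffs {n} (# k) = k , Vec.replicate n 0
coeffs (1+ e) = suc (proj₁ (coeffs e)) , proj₂ (coeffs e)
coeffs (e ⊕ e′) = addC (coeffs e) (coeffs e′)
coeffs (k ⊛ e) = scaleC k (coeffs e)

dot-zero : ∀ {n} (ρ : Vec ℕ n) → dot (Vec.replicate n 0) ρ ≡ 0
dot-zero [] = refl
dot-zero (x ∷ ρ) = dot-zero ρ

dot-unit : ∀ {n} (i : Fin n) ρ → dot (unit i) ρ ≡ lookup ρ i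
dot-unit Fin.zero (x ∷ ρ) = trans (cong (x + 0 +_) (dot-zero ρ)) (trans (+-identityʳ _) (+-identityʳ x))
dot-unit (Fin.suc i) (x ∷ ρ) = dot-unit i ρ

dot-+ : ∀ {n} (cs ds ρ : Vec ℕ n) → dot (Vec.zipWith _+_ cs ds) ρ ≡ dot cs ρ + dot ds ρ
dot-+ [] [] [] = refl
dot-+ (c ∷ cs) (d ∷ ds) (x ∷ ρ) = trans (cong ((c + d) * x +_) (dot-+ cs ds ρ)) (rearrange c d x _ _)
  where
  rearrange : ∀ c d x u v → (c + d) * x + (u + v) ≡ (c * x + u) + (d * x + v)
  rearrange = solve-∀

dot-* : ∀ {n} k (cs ρ : Vec ℕ n) → dot (Vec.map (k *_) cs) ρ ≡ k * dot cs ρ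
dot-* k [] [] = sym (*-zeroʳ k)
dot-* k (c ∷ cs) (x ∷ ρ) = trans (cong (k * c * x +_) (dot-* k cs ρ)) (rearrange k c x _)
  where
  rearrange : ∀ k c x u → k * c * x + k * u ≡ k * (c * x + u)
  rearrange = solve-∀

value-addC : ∀ {n} (u v : Coeffs n) ρ → value (addC u v) ρ ≡ value u ρ + value v ρ
value-addC (c , cs) (d , ds) ρ = trans (cong (c + d +_) (dot-+ cs ds ρ)) (rearrange c d _ _)
  where
  rearrange : ∀ c d u v → c + d + (u + v) ≡ c + u + (d + v)
  rearrange = solve-∀

value-scaleC : ∀ {n} k (u : Coeffs n) ρ → value (scaleC k u) ρ ≡ k * value u ρ
value-scaleC k (c , cs) ρ = trans (cong (k * c +_) (dot-* k cs ρ)) (sym (*-distribˡ-+ k c _))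

value-coeffs : ∀ {n} (e : Lin n) ρ → value (coeffs e) ρ ≡ ⟦ e ⟧ ρ
value-coeffs (var i) ρ = dot-unit i ρ
value-coeffs (# k) ρ = trans (cong (k +_) (dot-zero ρ)) (+-identityʳ k)
value-coeffs (1+ e) ρ = cong suc (value-coeffs e ρ)
value-coeffs (e ⊕ e′) ρ =
  trans (value-addC (coeffs e) (coeffs e′) ρ) (cong₂ _+_ (value-coeffs e ρ) (value-coeffs e′ ρ))
value-coeffs (k ⊛ e) ρ = trans (value-scaleC k (coeffs e) ρ) (cong (k *_) (value-coeffs e ρ))

-- Multiplier lists grown from `unitList` may be shorter than the list of hypotheses, and
-- `findNegative` returns the empty list when it fails; missing multipliers count as zero.
combination : ∀ {n} → List ℕ → List (Ineq n) → Coeffs n × Coeffs n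
combination {n} [] _ = (0 , Vec.replicate n 0) , (0 , Vec.replicate n 0)
combination {n} (_ ∷ _) [] = (0 , Vec.replicate n 0) , (0 , Vec.replicate n 0)
combination (k ∷ ks) ((l ⊑ r) ∷ hs) =
  let L , R = combination ks hs in
  addC (scaleC k (coeffs l)) L , addC (scaleC k (coeffs r)) R

combination-sound : ∀ {n} ks (hs : List (Ineq n)) ρ → All (Holds ρ) hs →
  value (proj₁ (combination ks hs)) ρ ≤ value (proj₂ (combination ks hs)) ρ
combination-sound [] hs ρ ps = ≤-refl
combination-sound (k ∷ ks) [] ρ ps = ≤-refl
combination-sound (k ∷ ks) ((l ⊑ r) ∷ hs) ρ (p ∷ ps) =
  subst₂ _≤_ (sym (split l _)) (sym (split r _)) (+-mono-≤ (*-monoʳ-≤ k p) (combination-sound ks hs ρ ps))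
  where
  split : ∀ e u → value (addC (scaleC k (coeffs e)) u) ρ ≡ k * ⟦ e ⟧ ρ + value u ρ
  split e u = trans (value-addC (scaleC k (coeffs e)) u ρ)
    (cong (_+ value u ρ) (trans (value-scaleC k (coeffs e) ρ) (cong (k *_) (value-coeffs e ρ))))

leq : ∀ {n} → Vec ℕ n → Vec ℕ n → Bool
leq [] [] = true
leq (c ∷ cs) (d ∷ ds) = (c Data.Nat.≤ᵇ d) ∧ leq cs ds

leq-sound : ∀ {n} (cs ds ρ : Vec ℕ n) → IsTrue (leq cs ds) → dot cs ρ ≤ dot ds ρ
leq-sound [] [] [] _ = z≤n
leq-sound (c ∷ cs) (d ∷ ds) (x ∷ ρ) t with c Data.Nat.≤ᵇ d in eq
... | true = +-mono-≤ (*-monoˡ-≤ x (≤ᵇ⇒≤ c d (subst IsTrue (sym eq) tt))) (leq-sound cs ds ρ t)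

-- The variables are natural numbers, so L ≤ R is absurd once the constant of L is larger and no
-- coefficient of L is smaller.
refutes : ∀ {n} → Coeffs n × Coeffs n → Bool
refutes ((l , ls) , (r , rs)) = (suc r Data.Nat.≤ᵇ l) ∧ leq rs ls

refute : ∀ {n} (LR : Coeffs n × Coeffs n) ρ → IsTrue (refutes LR) → ¬ (value (proj₁ LR) ρ ≤ value (proj₂ LR) ρ)
refute ((l , ls) , (r , rs)) ρ t p with suc r Data.Nat.≤ᵇ l in eq
... | true = <⇒≱ (+-mono-<-≤ (≤ᵇ⇒≤ (suc r) l (subst IsTrue (sym eq) tt)) (leq-sound rs ls ρ t)) p

-- A row is a derived inequality 0 ≤ c + Σ cᵢ xᵢ together with the multipliers producing it.
Row : Set
Row = List ℕ × (ℤ.ℤ × List ℤ.ℤ)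

scaleRow : ℕ → Row → Row
scaleRow k (ms , (c , cs)) = map (k *_) ms , (ℤ.+ k ℤ.* c , map (ℤ.+ k ℤ.*_) cs)

zipAdd : ∀ {A : Set} → (A → A → A) → List A → List A → List A
zipAdd f [] ys = ys
zipAdd f (x ∷ xs) [] = x ∷ xs
zipAdd f (x ∷ xs) (y ∷ ys) = f x y ∷ zipAdd f xs ys

addRow : Row → Row → Row
addRow (ms , (c , cs)) (ns , (d , ds)) = zipAdd _+_ ms ns , (c ℤ.+ d , zipAdd ℤ._+_ cs ds)

splitRows : List Row → List Row × List (ℕ × Row) × List (ℕ × Row)
splitRows [] = [] , [] , []
splitRows ((ms , (c , [])) ∷ rs) = let zs , ps , qs = splitRows rs in (ms , (c , [])) ∷ zs , ps , qs
splitRows ((ms , (c , ℤ.+ zero ∷ cs)) ∷ rs) = let zs , ps , qs = splitRows rs in (ms , (c , cs)) ∷ zs , ps , qs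
splitRows ((ms , (c , ℤ.+ suc k ∷ cs)) ∷ rs) = let zs , ps , qs = splitRows rs in zs , (suc k , (ms , (c , cs))) ∷ ps , qs
-- Besides being paired with the positive rows, a negative coefficient is simply dropped: this is
-- the pairing with the tacit 0 ≤ x, which carries no multiplier.
splitRows ((ms , (c , ℤ.-[1+ k ] ∷ cs)) ∷ rs) =
  let zs , ps , qs = splitRows rs in (ms , (c , cs)) ∷ zs , ps , (suc k , (ms , (c , cs))) ∷ qs

pairRows : List (ℕ × Row) → List (ℕ × Row) → List Row
pairRows [] qs = []
pairRows ((k , p) ∷ ps) qs = map (λ { (l , q) → addRow (scaleRow l p) (scaleRow k q) }) qs ++ pairRows ps qs

eliminate : ℕ → List Row → List Row
eliminate zero rs = rs
eliminate (suc n) rs = let zs , ps , qs = splitRows rs in eliminate n (zs ++ pairRows ps qs)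

findNegative : List Row → List ℕ
findNegative [] = []
findNegative ((ms , (ℤ.-[1+ _ ] , _)) ∷ rs) = ms
findNegative (_ ∷ rs) = findNegative rs

unitList : ℕ → List ℕ
unitList zero = 1 ∷ []
unitList (suc i) = 0 ∷ unitList i

initialRows : ∀ {n} → ℕ → List (Ineq n) → List Row
initialRows i [] = []
initialRows i ((l ⊑ r) ∷ hs) =
  (unitList i , (ℤ.+ proj₁ (coeffs r) ℤ.- ℤ.+ proj₁ (coeffs l) ,
     Vec.toList (Vec.zipWith (λ a b → ℤ.+ a ℤ.- ℤ.+ b) (proj₂ (coeffs r)) (proj₂ (coeffs l)))))
  ∷ initialRows (suc i) hs

contradictory : ∀ {n} → List (Ineq n) → Bool
contradictory {n} hs = refutes (combination (findNegative (eliminate n (initialRows 0 hs))) hs)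

contradictory-sound : ∀ {n} (hs : List (Ineq n)) ρ → IsTrue (contradictory hs) → ¬ All (Holds ρ) hs
contradictory-sound {n} hs ρ t ps =
  refute (combination ks hs) ρ t (combination-sound ks hs ρ ps)
  where ks = findNegative (eliminate n (initialRows 0 hs))

entails : ∀ {n} → Sequent n → Bool
entails (hs ⊢ (l ⊑ r)) = contradictory ((1+ r ⊑ l) ∷ hs)

Entails : ∀ {n} → Sequent n → Vec ℕ n → Set
Entails (hs ⊢ g) ρ = All (Holds ρ) hs → Holds ρ g

entails-sound : ∀ {n} (s : Sequent n) ρ → IsTrue (entails s) → Entails s ρ
entails-sound (hs ⊢ (l ⊑ r)) ρ t ps = ≮⇒≥ λ r<l → contradictory-sound ((1+ r ⊑ l) ∷ hs) ρ t (r<l ∷ ps)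

-- The hidden argument reduces to the unit type when the elimination succeeds, so it is solved
-- during type checking. Non-linear terms such as n * 2 ^ j enter as entries of `ρ`.
linear : ∀ n (f : N-ary n (Lin n) (Sequent n)) →
  let s = f $ⁿ Vec.map var (Vec.allFin n) in {IsTrue (entails s)} → ∀ ρ → Entails s ρ
linear n f {t} ρ = entails-sound (f $ⁿ Vec.map var (Vec.allFin n)) ρ t

-- Duplicate-free lists

variable
  A : Set

unique-↭ : ∀ {xs ys : List A} → xs ↭ ys → Unique xs → Unique ys
unique-↭ Perm.refl u = u
unique-↭ (prep x p) (px ∷ u) = Perm.All-resp-↭ p px ∷ unique-↭ p u
unique-↭ (swap x y p) ((x≢y ∷ px) ∷ (py ∷ u)) =
  (x≢y ∘ sym ∷ Perm.All-resp-↭ p py) ∷ (Perm.All-resp-↭ p px ∷ unique-↭ p u)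
unique-↭ (Perm.trans p q) u = unique-↭ q (unique-↭ p u)

extract : ∀ {x : A} {xs} → x ∈ xs → ∃ λ ys → xs ↭ x ∷ ys
extract {x = x} x∈xs with ∈-∃++ x∈xs
... | as , bs , refl = as ++ bs , Perm.shift x as bs

∉-unique : ∀ {x : A} {xs} → Unique (x ∷ xs) → x ∉ xs
∉-unique (px ∷ _) x∈xs = All.lookup px x∈xs refl

unique-∷ : ∀ {x : A} {xs} → x ∉ xs → Unique xs → Unique (x ∷ xs)
unique-∷ x∉xs u = All.tabulate (λ { y∈xs refl → x∉xs y∈xs }) ∷ u

∉⇒≢ : ∀ {x y : A} {xs} → x ∉ xs → y ∈ xs → x ≢ y
∉⇒≢ x∉ y∈ refl = x∉ y∈

_⊆_ : List A → List A → Set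
xs ⊆ ys = ∀ {x} → x ∈ xs → x ∈ ys

⊆-length : ∀ {xs ys : List A} → Unique xs → xs ⊆ ys → length xs ≤ length ys
⊆-length {xs = []} _ _ = z≤n
⊆-length {xs = x ∷ xs} {ys} u@(_ ∷ u′) sub with extract (sub (here refl))
... | zs , p = ≤-trans (s≤s (⊆-length u′ sub′)) (≤-reflexive (sym (Perm.↭-length p)))
  where
  sub′ : xs ⊆ zs
  sub′ y∈xs with Perm.∈-resp-↭ p (sub (there y∈xs))
  ... | here refl = contradiction y∈xs (∉-unique u)
  ... | there y∈zs = y∈zs

unique-++ : ∀ {xs ys : List A} → Unique xs → Unique ys → (∀ {x} → x ∈ xs → x ∉ ys) → Unique (xs ++ ys)
unique-++ u v d = Unique.++⁺ u v (λ (a , b) → d a b)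

unique-++⁻ : ∀ xs {ys : List A} → Unique (xs ++ ys) → Unique xs × Unique ys × (∀ {x} → x ∈ xs → x ∉ ys)
unique-++⁻ [] u = [] , u , λ ()
unique-++⁻ (x ∷ xs) u@(px ∷ u′) with unique-++⁻ xs u′
... | uxs , uys , d = (All.++⁻ˡ xs px ∷ uxs) , uys , λ
  { (here refl) q → ∉-unique u (∈-++⁺ʳ xs q) ; (there p) → d p }

length-take : ∀ m (xs : List A) → m ≤ length xs → length (take m xs) ≡ m
length-take m xs m≤ = trans (List.length-take m xs) (m≤n⇒m⊓n≡m m≤)

∈-take : ∀ m {xs : List A} → take m xs ⊆ xs
∈-take (suc m) {x ∷ xs} (here p) = here p
∈-take (suc m) {x ∷ xs} (there p) = there (∈-take m p)

record Choice (m : ℕ) (xs : List A) : Set where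
  constructor choice
  field
    chosen : List A
    unique : Unique chosen
    size   : length chosen ≡ m
    inside : chosen ⊆ xs

choose : ∀ m {xs : List A} → Unique xs → m ≤ length xs → Choice m xs
choose m {xs} u m≤ = choice (take m xs) (Unique.take⁺ m u) (length-take m xs m≤) (∈-take m)

chooseOther : ∀ m {x : A} {xs} → Unique xs → x ∈ xs → m < length xs →
  Σ (Choice m xs) λ C → x ∉ Choice.chosen C
chooseOther m {x} {xs} u x∈ m< with extract x∈
... | ys , p with unique-↭ p u
... | u′@(_ ∷ uys) with choose m uys (≤-pred (≤-trans m< (≤-reflexive (Perm.↭-length p))))
... | choice zs uzs l sub =
  choice zs uzs l (Perm.∈-resp-↭ (↭-sym p) ∘ there ∘ sub) , ∉-unique u′ ∘ sub

-- Paths and cycles; odd cycles over a complete bipartite graph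

data Path {V : Set} (R : V → V → Set) : V → List V → V → Set where
  edge : ∀ {a b} → R a b → Path R a [] b
  _◅_  : ∀ {a x xs b} → R a x → Path R x xs b → Path R a (x ∷ xs) b

infixr 5 _◅_

record Cyc {V : Set} (R : V → V → Set) (m : ℕ) : Set where
  constructor cyc
  field
    {start}  : V
    {rest}   : List V
    size     : length (start ∷ rest) ≡ m
    distinct : Unique (start ∷ rest)
    closed   : Path R start rest start

alt : List A → List A → List A
alt (x ∷ xs) (y ∷ ys) = x ∷ y ∷ alt xs ys
alt _ _ = []

alt-↭ : ∀ (xs ys : List A) → length xs ≡ length ys → alt xs ys ↭ xs ++ ys
alt-↭ [] [] _ = ↭-refl
alt-↭ (x ∷ xs) (y ∷ ys) e = prep x (↭-trans (prep y (alt-↭ xs ys (suc-injective e))) (↭-sym (Perm.shift y xs ys)))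

module _ {V : Set} {R : V → V → Set} where

  infixr 5 _▷_
  _▷_ : ∀ {a xs b ys c} → Path R a xs b → Path R b ys c → Path R a (xs ++ b ∷ ys) c
  edge r ▷ q = r ◅ q
  (r ◅ p) ▷ q = r ◅ (p ▷ q)

  mapPath : ∀ {S : V → V → Set} → (∀ {u v} → R u v → S u v) → ∀ {a xs b} → Path R a xs b → Path S a xs b
  mapPath f (edge r) = edge (f r)
  mapPath f (r ◅ p) = f r ◅ mapPath f p

  module _ (R-sym : ∀ {u v} → R u v → R v u) where

    reversePath : ∀ {a xs b} → Path R a xs b → Path R b (reverse xs) a
    reversePath (edge r) = edge (R-sym r)
    reversePath {a} (_◅_ {x = x} {xs} r p) =
      subst (λ ys → Path R _ ys a) (sym (List.unfold-reverse x xs)) (reversePath p ▷ edge (R-sym r))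

    altPath : ∀ s t (S T : List V) → length S ≡ length T →
      (∀ {u v} → u ∈ s ∷ S → v ∈ t ∷ T → R u v) → Path R t (alt S T) s
    altPath s t [] [] _ com = edge (R-sym (com (here refl) (here refl)))
    altPath s t (s′ ∷ S) (t′ ∷ T) e com =
      R-sym (com (there (here refl)) (here refl)) ◅ com (there (here refl)) (there (here refl)) ◅
      altPath s t′ S T (suc-injective e) λ
        { (here p) v∈ → com (here p) (there v∈) ; (there u∈) v∈ → com (there (there u∈)) (there v∈) }

    -- An alternating path from `t` to `s` uses n vertices on each side; the outside vertex `y`
    -- closes it and makes the length odd. Setting `s` and `t` apart first leaves n - 1 vertices to
    -- be chosen on each side.
    apexCycle : ∀ {n} {S T : List V} → 1 ≤ n → Unique S → Unique T → (∀ {u} → u ∈ S → u ∉ T) →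
      n ≤ length S → n ≤ length T → (∀ {u v} → u ∈ S → v ∈ T → R u v) →
      ∀ {y s t} → y ∉ S → y ∉ T → s ∈ S → t ∈ T → R y s → R y t → Cyc R (suc (n + n))
    apexCycle {suc n} {S} {T} _ uS uT disj nS nT com {y} {s} {t} y∉S y∉T s∈ t∈ ys yt
      with chooseOther n uS s∈ nS | chooseOther n uT t∈ nT
    ... | choice S′ uS′ lS S′⊆ , s∉ | choice T′ uT′ lT T′⊆ , t∉ =
      cyc (cong suc (cong suc (trans (cong suc (trans (Perm.↭-length altST) (trans (List.length-++ S′) (cong₂ _+_ lS lT)))) (sym (+-suc n n)))))
        (unique-↭ order (unique-∷ (λ y∈ → case ∈-++⁻ (s ∷ S′) y∈ of λ
            { (inj₁ p) → y∉S (inS p) ; (inj₂ p) → y∉T (inT p) })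
          (unique-++ (unique-∷ s∉ uS′) (unique-∷ t∉ uT′) λ p q → disj (inS p) (inT q))))
        (R-sym ys ◅ yt ◅ altPath s t S′ T′ (trans lS (sym lT)) (λ p q → com (inS p) (inT q)))
      where
      inS : (s ∷ S′) ⊆ S
      inS (here refl) = s∈
      inS (there p) = S′⊆ p
      inT : (t ∷ T′) ⊆ T
      inT (here refl) = t∈
      inT (there p) = T′⊆ p
      altST : alt S′ T′ ↭ S′ ++ T′
      altST = alt-↭ S′ T′ (trans lS (sym lT))
      order : y ∷ s ∷ S′ ++ t ∷ T′ ↭ s ∷ y ∷ t ∷ alt S′ T′
      order = ↭-trans (swap y s (Perm.shift t S′ T′)) (prep s (prep y (prep t (↭-sym altST))))

    -- Here both ends of the alternating path lie in `T`: it takes n vertices of `T` and n - 1 of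
    -- `S`, and the edge `x y` closes it. So `S` may be one vertex short of n.
    bridgeCycle : ∀ {n} {S T : List V} → 2 ≤ n → Unique S → Unique T → (∀ {u} → u ∈ S → u ∉ T) →
      n ≤ suc (length S) → n ≤ length T → (∀ {u v} → u ∈ S → v ∈ T → R u v) →
      ∀ {x y s t} → x ≢ y → x ∉ S → y ∉ S → x ∉ T → y ∉ T → s ≢ t → s ∈ T → t ∈ T →
      R x y → R x s → R y t → Cyc R (suc (n + n))
    bridgeCycle {suc zero} (s≤s ())
    bridgeCycle {suc (suc n)} {S} {T} _ uS uT disj nS nT com {x} {y} {s} {t} x≢y x∉S y∉S x∉T y∉T s≢t s∈ t∈ xy xs yt
      with extract s∈
    ... | T₁ , pT with unique-↭ pT uT
    ... | uT₁@(_ ∷ uT₁′) with Perm.∈-resp-↭ pT t∈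
    ... | here refl = contradiction refl s≢t
    ... | there t∈₁ with chooseOther n uT₁′ t∈₁ (≤-pred (≤-trans nT (≤-reflexive (Perm.↭-length pT)))) | choose (suc n) uS (≤-pred nS)
    ... | choice T′ uT′ lT T′⊆ , t∉ | choice (a ∷ S′) uS′ lS S′⊆ =
      cyc (cong suc len) (unique-↭ order uniq)
        (xy ◅ yt ◅ (altPath a t S′ T′ lens (λ p q → com (S′⊆ p) (inT (there q))) ▷
          (com (S′⊆ (here refl)) s∈ ◅ edge (R-sym xs))))
      where
      inT : (s ∷ t ∷ T′) ⊆ T
      inT (here refl) = s∈
      inT (there (here refl)) = t∈
      inT (there (there q)) = Perm.∈-resp-↭ (↭-sym pT) (there (T′⊆ q))
      lens : length S′ ≡ length T′
      lens = trans (suc-injective lS) (sym lT)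
      order : (x ∷ y ∷ t ∷ T′ ++ s ∷ a ∷ S′) ↭ x ∷ y ∷ t ∷ alt S′ T′ ++ a ∷ s ∷ []
      order = prep x (prep y (prep t (↭-trans (Perm.++-comm T′ (s ∷ a ∷ S′))
        (↭-trans (swap s a (↭-sym (alt-↭ S′ T′ lens))) (Perm.++-comm (a ∷ s ∷ []) (alt S′ T′))))))
      uniq : Unique (x ∷ y ∷ t ∷ T′ ++ s ∷ a ∷ S′)
      uniq = unique-∷ (λ { (here p) → x≢y p ; (there p) → new x∉S x∉T p }) (unique-∷ (new y∉S y∉T)
        (unique-++ (unique-∷ t∉ uT′)
          (unique-∷ (λ p → disj (S′⊆ p) s∈) uS′)
          λ { (here refl) (here q) → s≢t (sym q)
            ; (here refl) (there q) → disj (S′⊆ q) t∈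
            ; (there p) (here refl) → ∉-unique uT₁ (T′⊆ p)
            ; (there p) (there q) → disj (S′⊆ q) (inT (there (there p))) }))
        where
        new : ∀ {z} → z ∉ S → z ∉ T → z ∉ t ∷ T′ ++ s ∷ a ∷ S′
        new z∉S z∉T p with ∈-++⁻ (t ∷ T′) p
        ... | inj₁ q = z∉T (inT (there q))
        ... | inj₂ (here refl) = z∉T s∈
        ... | inj₂ (there q) = z∉S (S′⊆ q)
      len : suc (suc (length (alt S′ T′ ++ a ∷ s ∷ []))) ≡ suc (suc n) + suc (suc n)
      len = trans (cong (λ z → suc (suc z)) (trans (List.length-++ (alt S′ T′))
              (cong (_+ 2) (trans (Perm.↭-length (alt-↭ S′ T′ lens)) (trans (List.length-++ S′) (cong₂ _+_ (suc-injective lS) lT))))))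
              (rearrange n)
        where
        rearrange : ∀ n → suc (suc (n + n + 2)) ≡ suc (suc n) + suc (suc n)
        rearrange = solve-∀

-- Lists of indices, and cycles along an indexed sequence

iota : ℕ → ℕ → List ℕ
iota a zero = []
iota a (suc m) = a ∷ iota (suc a) m

length-iota : ∀ a m → length (iota a m) ≡ m
length-iota a zero = refl
length-iota a (suc m) = cong suc (length-iota (suc a) m)

∈-iota⁻ : ∀ a m {i} → i ∈ iota a m → a ≤ i × i < a + m
∈-iota⁻ a (suc m) (here refl) = ≤-refl , m<m+n a (s≤s z≤n)
∈-iota⁻ a (suc m) (there p) with ∈-iota⁻ (suc a) m p
... | l , r = ≤-trans (n≤1+n a) l , ≤-trans r (≤-reflexive (sym (+-suc a m)))

∈-iota⁺ : ∀ a m {i} → a ≤ i → i < a + m → i ∈ iota a m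
∈-iota⁺ a zero l r = contradiction (≤-trans r (≤-reflexive (+-identityʳ a))) (≤⇒≯ l)
∈-iota⁺ a (suc m) l r with m≤n⇒m<n∨m≡n l
... | inj₂ refl = here refl
... | inj₁ a<i = there (∈-iota⁺ (suc a) m a<i (≤-trans r (≤-reflexive (+-suc a m))))

unique-iota : ∀ a m → Unique (iota a m)
unique-iota a zero = []
unique-iota a (suc m) = unique-∷ (λ p → <⇒≱ ≤-refl (proj₁ (∈-iota⁻ (suc a) m p))) (unique-iota (suc a) m)

iota-∷ʳ : ∀ a m → iota a (suc m) ≡ iota a m ++ (m + a) ∷ []
iota-∷ʳ a zero = refl
iota-∷ʳ a (suc m) = cong (a ∷_) (trans (iota-∷ʳ (suc a) m) (cong (λ z → iota (suc a) m ++ z ∷ []) (+-suc m a)))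

-- The indices b, a+1, b+1, …, a+m strictly between a and b+m in a path that alternates
-- between two blocks of consecutive indices.
zigzag : ℕ → ℕ → ℕ → List ℕ
zigzag a b zero = []
zigzag a b (suc m) = b ∷ suc a ∷ zigzag (suc a) (suc b) m

length-zigzag : ∀ a b m → length (zigzag a b m) ≡ m + m
length-zigzag a b zero = refl
length-zigzag a b (suc m) = cong suc (trans (cong suc (length-zigzag (suc a) (suc b) m)) (sym (+-suc m m)))

zigzag-↭ : ∀ a b m → zigzag a b m ↭ iota (suc a) m ++ iota b m
zigzag-↭ a b zero = ↭-refl
zigzag-↭ a b (suc m) = ↭-trans (swap b (suc a) (zigzag-↭ (suc a) (suc b) m))
  (prep (suc a) (↭-sym (Perm.shift b (iota (suc (suc a)) m) (iota (suc b) m))))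

unique-zigzag : ∀ a b m → suc (m + a) ≤ b → Unique (a ∷ zigzag a b m ++ (m + b) ∷ [])
unique-zigzag a b m l = unique-↭ (↭-sym order)
  (unique-++ (unique-iota a (suc m)) (unique-iota b (suc m)) λ p q →
    <⇒≱ (≤-trans (proj₂ (∈-iota⁻ a (suc m) p)) (≤-trans (≤-reflexive (+-comm a (suc m))) l)) (proj₁ (∈-iota⁻ b (suc m) q)))
  where
  order : a ∷ zigzag a b m ++ (m + b) ∷ [] ↭ iota a (suc m) ++ iota b (suc m)
  order = prep a (↭-trans (Perm.++⁺ʳ _ (zigzag-↭ a b m))
    (Perm.↭-reflexive (trans (List.++-assoc (iota (suc a) m) (iota b m) _) (cong (iota (suc a) m ++_) (sym (iota-∷ʳ b m))))))

∈-zigzag : ∀ a b m {i} → i ∈ a ∷ zigzag a b m ++ (m + b) ∷ [] → i ∈ iota a (suc m) ⊎ i ∈ iota b (suc m)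
∈-zigzag a b m (here refl) = inj₁ (here refl)
∈-zigzag a b m (there p) with ∈-++⁻ (zigzag a b m) p
... | inj₂ (here refl) = inj₂ (∈-iota⁺ b (suc m) (m≤n+m b m) (≤-reflexive (trans (cong suc (+-comm m b)) (sym (+-suc b m)))))
... | inj₁ q with ∈-++⁻ (iota (suc a) m) (Perm.∈-resp-↭ (zigzag-↭ a b m) q)
... | inj₁ r = inj₁ (there r)
... | inj₂ r = inj₂ (subst (_ ∈_) (sym (iota-∷ʳ b m)) (∈-++⁺ˡ r))

InjectiveBelow : (ℕ → A) → ℕ → Set
InjectiveBelow f L = ∀ {i j} → i < L → j < L → f i ≡ f j → i ≡ j

unique-map : ∀ {f : ℕ → A} {L} → InjectiveBelow f L → ∀ {is} → Unique is → (∀ {i} → i ∈ is → i < L) → Unique (map f is)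
unique-map inj [] _ = []
unique-map {f = f} inj {i ∷ is} u@(_ ∷ u′) below = unique-∷ fresh (unique-map inj u′ (below ∘ there))
  where
  fresh : f i ∉ map f is
  fresh p with ∈-map⁻ f p
  ... | j , j∈ , e = ∉-unique u (subst (_∈ is) (sym (inj (below (here refl)) (below (there j∈)) e)) j∈)

at : A → List A → ℕ → A
at d [] _ = d
at d (x ∷ xs) zero = x
at d (x ∷ xs) (suc i) = at d xs i

at-∈ : ∀ (d : A) xs {i} → i < length xs → at d xs i ∈ xs
at-∈ d (x ∷ xs) {zero} _ = here refl
at-∈ d (x ∷ xs) {suc i} (s≤s l) = there (at-∈ d xs l)

at-injective : ∀ (d : A) {xs} → Unique xs → InjectiveBelow (at d xs) (length xs)
at-injective d {x ∷ xs} u {zero} {zero} _ _ _ = refl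
at-injective d {x ∷ xs} u {zero} {suc j} _ (s≤s l) e = contradiction (subst (_∈ xs) (sym e) (at-∈ d xs l)) (∉-unique u)
at-injective d {x ∷ xs} u {suc i} {zero} (s≤s l) _ e = contradiction (subst (_∈ xs) e (at-∈ d xs l)) (∉-unique u)
at-injective d {x ∷ xs} (_ ∷ u) {suc i} {suc j} (s≤s l) (s≤s l′) e = cong suc (at-injective d u l l′ e)

at-linked : ∀ {R : A → A → Set} d {xs i} → Linked R xs → suc i < length xs → R (at d xs i) (at d xs (suc i))
at-linked d {i = zero} (r ∷ _) _ = r
at-linked d {i = suc i} (_ ∷ l) (s≤s b) = at-linked d l b
at-linked d {i = zero} [-] (s≤s ())
at-linked d {i = suc _} [-] (s≤s ())

path-at : ∀ {R : A → A → Set} d {a xs b i} → Path R a xs b → i ≤ length xs →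
  R (at d (a ∷ xs ++ b ∷ []) i) (at d (a ∷ xs ++ b ∷ []) (suc i))
path-at d {i = zero} (edge r) _ = r
path-at d {i = zero} (r ◅ _) _ = r
path-at d {i = suc i} (_ ◅ p) (s≤s l) = path-at d p l

segmentPath : ∀ {Q : ℕ → ℕ → Set} a m → (∀ i → a ≤ i → i ≤ m + a → Q i (suc i)) →
  Path Q a (iota (suc a) m) (m + suc a)
segmentPath a zero adj = edge (adj a ≤-refl ≤-refl)
segmentPath {Q} a (suc m) adj = adj a ≤-refl (m≤n+m a (suc m)) ◅
  subst (Path Q (suc a) (iota (suc (suc a)) m)) (+-suc m (suc a))
    (segmentPath (suc a) m λ i l r → adj i (<⇒≤ l) (≤-trans r (≤-reflexive (+-suc m a))))

zigzagPath : ∀ {Q : ℕ → ℕ → Set} a b m → (∀ i → i ≤ m → Q (i + a) (i + b)) →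
  (∀ i → i < m → Q (i + b) (suc i + a)) → Path Q a (zigzag a b m) (m + b)
zigzagPath a b zero up down = edge (up 0 z≤n)
zigzagPath {Q} a b (suc m) up down = up 0 z≤n ◅ down 0 (s≤s z≤n) ◅
  subst (Path Q (suc a) (zigzag (suc a) (suc b) m)) (+-suc m b)
    (zigzagPath (suc a) (suc b) m
      (λ i l → subst₂ Q (sym (+-suc i a)) (sym (+-suc i b)) (up (suc i) (s≤s l)))
      (λ i l → subst₂ Q (sym (+-suc i b)) (cong suc (sym (+-suc i a))) (down (suc i) (s≤s l))))

along : ∀ {V : Set} {R : V → V → Set} (f : A → V) {a xs b} →
  Path (λ i j → R (f i) (f j)) a xs b → Path R (f a) (map f xs) (f b)
along f (edge r) = edge r
along f (r ◅ p) = r ◅ along f p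

module _ {V : Set} {R : V → V → Set} where

  mapCycle : ∀ {S : V → V → Set} {m} → (∀ {u v} → R u v → S u v) → Cyc R m → Cyc S m
  mapCycle f (cyc l u p) = cyc l u (mapPath f p)

  -- Describing cycles by index lists turns distinctness of vertices into a question about numbers;
  -- `inj` transfers it back.
  indexCycle : ∀ (f : ℕ → V) {L m a is} → InjectiveBelow f L → (∀ {i} → i ∈ a ∷ is → i < L) →
    Unique (a ∷ is) → length (a ∷ is) ≡ m → Path (λ i j → R (f i) (f j)) a is a → Cyc R m
  indexCycle f {a = a} {is} inj below u l p =
    cyc (trans (List.length-map f (a ∷ is)) l) (unique-map inj u below) (along f p)

  chordCycle : ∀ (f : ℕ → V) m → InjectiveBelow f (suc (suc m)) →
    (∀ i → i ≤ m → R (f i) (f (suc i))) → R (f (suc m)) (f 0) → Cyc R (suc (suc m))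
  chordCycle f m inj adj r = indexCycle f inj
    (λ {i} p → proj₂ (∈-iota⁻ 0 (suc (suc m)) (subst (i ∈_) shape p)))
    (subst Unique (sym shape) (unique-iota 0 (suc (suc m))))
    (trans (cong length shape) (length-iota 0 (suc (suc m))))
    (segmentPath 0 m (λ i _ l → adj i (≤-trans l (≤-reflexive (+-identityʳ m)))) ▷
      edge (subst (λ j → R (f j) (f 0)) (+-comm 1 m) r))
    where
    shape : 0 ∷ iota 1 m ++ (m + 1) ∷ [] ≡ iota 0 (suc (suc m))
    shape = cong (0 ∷_) (sym (iota-∷ʳ 1 m))

-- Hamiltonian cycles in complete multipartite graphs

module _ {V L : Set} (_≟ℓ_ : DecidableEquality L) (ℓ : V → L) where

  data StartsWith (l : L) : List V → Set where
    starts : ∀ {y ys} → ℓ y ≡ l → StartsWith l (y ∷ ys)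

  -- A local form of "equal labels are consecutive", which insertion of a single element can
  -- maintain.
  data Grouped : List V → Set where
    []  : Grouped []
    _∷_ : ∀ {x xs} → (∀ {z} → z ∈ xs → ℓ z ≡ ℓ x → StartsWith (ℓ x) xs) → Grouped xs → Grouped (x ∷ xs)

  insert : V → List V → List V
  insert x [] = x ∷ []
  insert x (y ∷ ys) with ℓ x ≟ℓ ℓ y
  ... | yes _ = x ∷ y ∷ ys
  ... | no _ = y ∷ insert x ys

  insert-↭ : ∀ x ys → insert x ys ↭ x ∷ ys
  insert-↭ x [] = ↭-refl
  insert-↭ x (y ∷ ys) with ℓ x ≟ℓ ℓ y
  ... | yes _ = ↭-refl
  ... | no _ = ↭-trans (prep y (insert-↭ x ys)) (swap y x ↭-refl)

  insert-starts : ∀ {x l ys} → ℓ x ≢ l → StartsWith l ys → StartsWith l (insert x ys)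
  insert-starts {x} x≢l (starts {y} {ys} e) with ℓ x ≟ℓ ℓ y
  ... | yes q = contradiction (trans q e) x≢l
  ... | no _ = starts e

  insert-grouped : ∀ x {ys} → Grouped ys → Grouped (insert x ys)
  insert-grouped x [] = (λ ()) ∷ []
  insert-grouped x {y ∷ ys} (h ∷ g) with ℓ x ≟ℓ ℓ y
  ... | yes e = (λ _ _ → starts (sym e)) ∷ (h ∷ g)
  ... | no x≢y = h′ ∷ insert-grouped x g
    where
    h′ : ∀ {z} → z ∈ insert x ys → ℓ z ≡ ℓ y → StartsWith (ℓ y) (insert x ys)
    h′ z∈ e with Perm.∈-resp-↭ (insert-↭ x ys) z∈
    ... | here refl = contradiction e x≢y
    ... | there z∈ys = insert-starts x≢y (h z∈ys e)

  group : ∀ (xs : List V) → ∃ λ ys → Grouped ys × ys ↭ xs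
  group [] = [] , [] , ↭-refl
  group (x ∷ xs) with group xs
  ... | ys , g , p = insert x ys , insert-grouped x g , ↭-trans (insert-↭ x ys) (prep x p)

  grouped-run : ∀ d {xs} → Grouped xs → ∀ i k → i + k < length xs → ℓ (at d xs i) ≡ ℓ (at d xs (i + k)) →
    ∀ e → e ≤ k → ℓ (at d xs (i + e)) ≡ ℓ (at d xs i)
  grouped-run d {x ∷ xs} (h ∷ g) zero zero _ _ zero _ = refl
  grouped-run d {x ∷ xs} (h ∷ g) zero (suc k) _ _ zero _ = refl
  grouped-run d {x ∷ xs} (h ∷ g) zero (suc k) (s≤s b) q (suc e) (s≤s e≤k) with h (at-∈ d xs b) (sym q)
  ... | starts r = trans (grouped-run d g zero k b (trans r q) e e≤k) r
  grouped-run d {x ∷ xs} (h ∷ g) (suc i) k (s≤s b) q e e≤k = grouped-run d g i k b q e e≤k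

  -- In an order with classes consecutive, positions at distance n or n + 1 lie in different
  -- classes; the steps + (n + 1), − n run through all 2n + 1 positions.
  multipartiteCycle : ∀ {R : V → V → Set} {n} (U : List V) → 1 ≤ n → Unique U → length U ≡ suc (n + n) →
    (∀ zs → Unique zs → zs ⊆ U → (∀ {u v} → u ∈ zs → v ∈ zs → ℓ u ≡ ℓ v) → length zs ≤ n) →
    (∀ {u v} → u ∈ U → v ∈ U → ℓ u ≢ ℓ v → R u v) → Cyc R (suc (n + n))
  multipartiteCycle {R} {n@(suc m)} U@(d ∷ _) _ uU lenU small adj with group U
  ... | G , grouped , G↭U = indexCycle f inj below distinct size path
    where
    lenG : length G ≡ suc (n + n)
    lenG = trans (Perm.↭-length G↭U) lenU
    f : ℕ → V
    f = at d G
    inj : InjectiveBelow f (suc (n + n))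
    inj = subst (InjectiveBelow f) lenG (at-injective d (unique-↭ (↭-sym G↭U) uU))
    f∈ : ∀ {i} → i < suc (n + n) → f i ∈ U
    f∈ b = Perm.∈-resp-↭ G↭U (at-∈ d G (≤-trans b (≤-reflexive (sym lenG))))
    -- Equal labels at distance k ≥ n would spread over the n + 1 positions i, ..., i + n, against
    -- `small`.
    apart : ∀ i k → n ≤ k → i + k < suc (n + n) → ℓ (f i) ≢ ℓ (f (i + k))
    apart i k n≤k b q = <⇒≱ ≤-refl (≤-trans (≤-reflexive (sym (trans (List.length-map f (iota i (suc n))) (length-iota i (suc n)))))
      (small (map f (iota i (suc n))) (unique-map inj (unique-iota i (suc n)) inRange) sub same))
      where
      bound : ∀ {e} → e ≤ n → i + e < suc (n + n)
      bound {e} e≤n = linear 4 (λ i e k n → e ⊑ n ∷ n ⊑ k ∷ 1+ (i ⊕ k) ⊑ 1+ (n ⊕ n) ∷ [] ⊢ 1+ (i ⊕ e) ⊑ 1+ (n ⊕ n))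
        (i ∷ e ∷ k ∷ n ∷ []) (e≤n ∷ n≤k ∷ b ∷ [])
      offset : ∀ {j} → j ∈ iota i (suc n) → ∃ λ e → e ≤ n × i + e ≡ j
      offset {j} p with ∈-iota⁻ i (suc n) p
      ... | l , r = j ∸ i , ≤-pred (+-cancelˡ-< i _ _ (≤-trans (≤-reflexive (cong suc (m+[n∸m]≡n l))) r)) , m+[n∸m]≡n l
      inRange : ∀ {j} → j ∈ iota i (suc n) → j < suc (n + n)
      inRange p with offset p
      ... | e , e≤n , refl = bound e≤n
      sub : map f (iota i (suc n)) ⊆ U
      sub p with ∈-map⁻ f p
      ... | j , j∈ , refl = f∈ (inRange j∈)
      label : ∀ {u} → u ∈ map f (iota i (suc n)) → ℓ u ≡ ℓ (f i)
      label p with ∈-map⁻ f p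
      ... | j , j∈ , refl with offset j∈
      ... | e , e≤n , refl = grouped-run d grouped i k (≤-trans b (≤-reflexive (sym lenG))) q e (≤-trans e≤n n≤k)
      same : ∀ {u v} → u ∈ map f (iota i (suc n)) → v ∈ map f (iota i (suc n)) → ℓ u ≡ ℓ v
      same p p′ = trans (label p) (sym (label p′))
    far : ∀ i k → n ≤ k → i + k < suc (n + n) → R (f i) (f (i + k)) × R (f (i + k)) (f i)
    far i k n≤k b = adj (f∈ i<) (f∈ b) (apart i k n≤k b) , adj (f∈ b) (f∈ i<) (apart i k n≤k b ∘ sym)
      where
      i< : i < suc (n + n)
      i< = ≤-trans (s≤s (m≤m+n i k)) b
    -- With n = m + 1 this reads 0, n + 1, 1, n + 2, ..., n - 1, 2n, n.
    order : List ℕ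
    order = 0 ∷ zigzag 0 (suc n) m ++ (m + suc n) ∷ n ∷ []
    order↭ : n ∷ (0 ∷ zigzag 0 (suc n) m ++ (m + suc n) ∷ []) ↭ order
    order↭ = ↭-trans (Perm.++-comm (n ∷ []) _) (Perm.↭-reflexive (cong (0 ∷_) (List.++-assoc (zigzag 0 (suc n) m) ((m + suc n) ∷ []) (n ∷ []))))
    n≤m+0 : suc (m + 0) ≤ suc n
    n≤m+0 = linear 1 (λ m → [] ⊢ 1+ (m ⊕ # 0) ⊑ 1+ (1+ m)) (m ∷ []) []
    member : ∀ {i} → i ∈ order → i ≡ n ⊎ i < n ⊎ (suc n ≤ i × i < suc (n + n))
    member p with Perm.∈-resp-↭ (↭-sym order↭) p
    ... | here refl = inj₁ refl
    ... | there q with ∈-zigzag 0 (suc n) m q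
    ... | inj₁ r = inj₂ (inj₁ (proj₂ (∈-iota⁻ 0 n r)))
    ... | inj₂ r = inj₂ (inj₂ (∈-iota⁻ (suc n) n r))
    below : ∀ {i} → i ∈ order → i < suc (n + n)
    below p with member p
    ... | inj₁ refl = s≤s (m≤m+n n n)
    ... | inj₂ (inj₁ l) = ≤-trans l (m≤n⇒m≤1+n (m≤m+n n n))
    ... | inj₂ (inj₂ (_ , l)) = l
    distinct : Unique order
    distinct = unique-↭ order↭ (unique-∷ fresh (unique-zigzag 0 (suc n) m n≤m+0))
      where
      fresh : n ∉ 0 ∷ zigzag 0 (suc n) m ++ (m + suc n) ∷ []
      fresh p with ∈-zigzag 0 (suc n) m p
      ... | inj₁ r = <-irrefl refl (proj₂ (∈-iota⁻ 0 n r))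
      ... | inj₂ r = <⇒≱ ≤-refl (proj₁ (∈-iota⁻ (suc n) n r))
    size : length order ≡ suc (n + n)
    size = cong suc (trans (List.length-++ (zigzag 0 (suc n) m)) (trans (cong (_+ 2) (length-zigzag 0 (suc n) m)) (rearrange m)))
      where
      rearrange : ∀ m → m + m + 2 ≡ suc m + suc m
      rearrange = solve-∀
    path : Path (λ i j → R (f i) (f j)) 0 (zigzag 0 (suc n) m ++ (m + suc n) ∷ n ∷ []) 0
    path = zigzagPath 0 (suc n) m
        (λ i l → subst (λ j → R (f j) (f (i + suc n))) (sym (+-identityʳ i)) (proj₁ (far i (suc n) (n≤1+n n)
          (linear 2 (λ i m → i ⊑ m ∷ [] ⊢ 1+ (i ⊕ 1+ (1+ m)) ⊑ 1+ (1+ m ⊕ 1+ m)) (i ∷ m ∷ []) (l ∷ [])))))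
        (λ i l → subst₂ (λ j j′ → R (f j) (f j′)) (shift i n) (cong suc (sym (+-identityʳ i)))
          (proj₂ (far (suc i) n ≤-refl
            (linear 2 (λ i m → 1+ i ⊑ m ∷ [] ⊢ 1+ (1+ i ⊕ 1+ m) ⊑ 1+ (1+ m ⊕ 1+ m)) (i ∷ m ∷ []) (l ∷ [])))))
       ▷ (subst (λ j → R (f j) (f n)) (shift′ m) (proj₂ (far n n ≤-refl ≤-refl))
         ◅ edge (proj₂ (far 0 n ≤-refl (s≤s (m≤m+n n n)))))
      where
      shift : ∀ i n → suc i + n ≡ i + suc n
      shift = solve-∀
      shift′ : ∀ m → suc m + suc m ≡ m + suc (suc m)
      shift′ = solve-∀

-- Periodic sequences, chords and the shortening of cycles

InjectiveBelow-≤ : ∀ {f : ℕ → A} {L M} → M ≤ L → InjectiveBelow f L → InjectiveBelow f M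
InjectiveBelow-≤ M≤L inj i< j< = inj (≤-trans i< M≤L) (≤-trans j< M≤L)

-- A cycle of length L unrolled to a periodic sequence, so that rotating it is a shift.
record Loop {V : Set} (R : V → V → Set) (L : ℕ) : Set where
  field
    vertex   : ℕ → V
    adjacent : ∀ i → R (vertex i) (vertex (suc i))
    period   : ∀ i → vertex (i + L) ≡ vertex i
    window   : ∀ i → InjectiveBelow (λ j → vertex (i + j)) L

at-default : ∀ (d : A) xs i → at d (xs ++ d ∷ []) i ≡ at d xs i
at-default d [] zero = refl
at-default d [] (suc i) = refl
at-default d (x ∷ xs) zero = refl
at-default d (x ∷ xs) (suc i) = at-default d xs i

at-beyond : ∀ (d : A) xs → at d xs (length xs) ≡ d
at-beyond d [] = refl
at-beyond d (x ∷ xs) = at-beyond d xs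

module _ (k : ℕ) where

  private
    L = suc k

  reduce : ∀ s → s < L + L → (s < L × s % L ≡ s) ⊎ (∃ λ t → s ≡ t + L × t < L × s % L ≡ t)
  reduce s s< with s <? L
  ... | yes s<L = inj₁ (s<L , m<n⇒m%n≡m s<L)
  ... | no s≮L = inj₂ (s ∸ L , sym (m∸n+n≡m L≤s) , t< ,
      trans (cong (_% L) (sym (m∸n+n≡m L≤s))) (trans ([m+n]%n≡m%n (s ∸ L) L) (m<n⇒m%n≡m t<)))
    where
    L≤s : L ≤ s
    L≤s = ≮⇒≥ s≮L
    t< : s ∸ L < L
    t< = +-cancelʳ-< L (s ∸ L) L (≤-trans (≤-reflexive (cong suc (m∸n+n≡m L≤s))) s<)

  mod-+ : ∀ i j → (i + j) % L ≡ (i % L + j) % L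
  mod-+ i j = trans (%-distribˡ-+ i j L) (sym (trans (%-distribˡ-+ (i % L) j L) (cong (λ z → (z + j % L) % L) (m%n%n≡m%n i L))))

  shift-injective : ∀ i → InjectiveBelow (λ j → (i + j) % L) L
  shift-injective i {a} {b} a< b< e = go (i % L) (m%n<n i L) (trans (sym (mod-+ i a)) (trans e (mod-+ i b)))
    where
    go : ∀ r → r < L → (r + a) % L ≡ (r + b) % L → a ≡ b
    go r r< e′ with reduce (r + a) (+-mono-< r< a<) | reduce (r + b) (+-mono-< r< b<)
    ... | inj₁ (_ , p) | inj₁ (_ , q) = +-cancelˡ-≡ r a b (trans (sym p) (trans e′ q))
    ... | inj₂ (t , p , _ , p′) | inj₂ (u , q , _ , q′) =
      +-cancelˡ-≡ r a b (trans p (trans (cong (_+ L) (trans (sym p′) (trans e′ q′))) (sym q)))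
    ... | inj₁ (_ , p) | inj₂ (u , q , _ , q′) =
      contradiction (linear 5 (λ r a b L u → r ⊕ a ⊑ u ∷ u ⊕ L ⊑ r ⊕ b ∷ 1+ b ⊑ L ∷ [] ⊢ # 1 ⊑ # 0)
        (r ∷ a ∷ b ∷ L ∷ u ∷ []) (≤-reflexive (trans (sym p) (trans e′ q′)) ∷ ≤-reflexive (sym q) ∷ b< ∷ [])) λ ()
    ... | inj₂ (t , p , _ , p′) | inj₁ (_ , q) =
      contradiction (linear 5 (λ r a b L u → r ⊕ b ⊑ u ∷ u ⊕ L ⊑ r ⊕ a ∷ 1+ a ⊑ L ∷ [] ⊢ # 1 ⊑ # 0)
        (r ∷ a ∷ b ∷ L ∷ t ∷ []) (≤-reflexive (trans (sym q) (trans (sym e′) p′)) ∷ ≤-reflexive (sym p) ∷ a< ∷ [])) λ ()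

unroll : ∀ {V : Set} {R : V → V → Set} {L} → Cyc R L → Loop R L
unroll {V} {R} (cyc {start} {rest} refl distinct closed) = record
  { vertex = f
  ; adjacent = adj
  ; period = λ i → cong (at start xs) ([m+n]%n≡m%n i L)
  ; window = λ i {a} {b} a< b< e → shift-injective k i a< b<
      (at-injective start distinct (m%n<n (i + a) L) (m%n<n (i + b) L) e)
  }
  where
  k = length rest
  L = suc k
  xs = start ∷ rest
  f : ℕ → V
  f i = at start xs (i % L)
  -- Reading past the end of the list gives the default `start`, so the closing edge is handled like
  -- all others.
  wrap : ∀ s → s ≤ L → at start xs (s % L) ≡ at start xs s
  wrap s s≤ with m≤n⇒m<n∨m≡n s≤
  ... | inj₁ s< = cong (at start xs) (m<n⇒m%n≡m s<)
  ... | inj₂ refl = trans (cong (at start xs) (n%n≡0 L)) (sym (at-beyond start rest))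
  adj : ∀ i → R (f i) (f (suc i))
  adj i = subst (R (f i)) (sym (trans (cong (at start xs) next) (wrap (suc r) (m%n<n i L))))
    (subst₂ R (at-default start xs r) (at-default start xs (suc r)) (path-at start closed (≤-pred (m%n<n i L))))
    where
    r = i % L
    next : suc i % L ≡ suc r % L
    next = trans (cong (_% L) (+-comm 1 i)) (trans (mod-+ k i 1) (cong (_% L) (+-comm r 1)))

-- The chord replaces d edges by one, hence the length L - d + 1. Starting at `i + d` keeps the
-- indices of the remaining arc consecutive, and periodicity leads it back to `vertex i`.
shortcut : ∀ {V : Set} {R : V → V → Set} {L} (ℓ : Loop R L) → let open Loop ℓ in ∀ i d m → d + suc m ≡ L → 1 ≤ d →
  R (vertex i) (vertex (i + d)) → Cyc R (suc (suc m))
shortcut {R = R} ℓ i d m refl 1≤d r = chordCycle (λ j → vertex (i + d + j)) m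
  (InjectiveBelow-≤ (+-monoˡ-≤ (suc m) 1≤d) (window (i + d)))
  (λ j _ → subst (λ z → R (vertex (i + d + j)) (vertex z)) (sym (+-suc (i + d) j)) (adjacent (i + d + j)))
  (subst₂ R (sym (trans (cong vertex (+-assoc i d (suc m))) (period i))) (cong vertex (sym (+-identityʳ (i + d)))) r)
  where open Loop ℓ

-- `R-in` and `B-in` confine the edges to `U`, so every cycle found stays in `U`. The two relations
-- may overlap: `fill` adds red pairs without taking away blue ones.
record TwoColoured {V : Set} (U : List V) (R B : V → V → Set) : Set where
  field
    R-sym : ∀ {u v} → R u v → R v u
    B-sym : ∀ {u v} → B u v → B v u
    R-in  : ∀ {u v} → R u v → u ∈ U
    B-in  : ∀ {u v} → B u v → u ∈ U
    total : ∀ {u v} → u ∈ U → v ∈ U → u ≢ v → R u v ⊎ B u v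

swapColours : ∀ {V : Set} {U : List V} {R B} → TwoColoured U R B → TwoColoured U B R
swapColours c = record
  { R-sym = B-sym ; B-sym = R-sym ; R-in = B-in ; B-in = R-in
  ; total = λ u v ne → [ inj₂ , inj₁ ]′ (total u v ne) }
  where open TwoColoured c

double-injective : ∀ s t → 2 * s ≡ 2 * t → s ≡ t
double-injective s t = *-cancelˡ-≡ s t 2

even≢odd′ : ∀ s t → 2 * s ≢ suc (2 * t)
even≢odd′ zero t ()
even≢odd′ (suc s) zero e = contradiction (trans (sym (+-suc s (s + 0))) (suc-injective e)) λ ()
even≢odd′ (suc s) (suc t) e = even≢odd′ s t (suc-injective (suc-injective
  (trans (cong suc (sym (+-suc s (s + 0)))) (trans e (cong suc (cong suc (+-suc t (t + 0))))))))

module _ {V : Set} {R B : V → V → Set} where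

  notRed : ∀ {U L} (c : TwoColoured U R B) (ℓ : Loop R L) → let open Loop ℓ in ∀ i d → 0 < d → d < L →
    ¬ R (vertex i) (vertex (i + d)) → B (vertex i) (vertex (i + d))
  notRed c ℓ i d 0<d d<L ¬r with TwoColoured.total c (TwoColoured.R-in c (adjacent i)) (TwoColoured.R-in c (adjacent (i + d))) ne
    where
    open Loop ℓ
    ne : vertex i ≢ vertex (i + d)
    ne e = <⇒≢ 0<d (window i (≤-trans (s≤s z≤n) d<L) d<L (trans (cong vertex (+-identityʳ i)) e))
  ... | inj₁ r = contradiction r ¬r
  ... | inj₂ b = b

  -- If all chords of length 2 and 3 are blue then 0, 3, 5, …, 2n−1, 2n+2, 2n, …, 2 is blue.
  zigzagOdd : ∀ {n} (f : ℕ → V) → 3 ≤ n → InjectiveBelow f (suc (n + n) + 2) → (∀ {u v} → B u v → B v u) →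
    (∀ i → B (f i) (f (i + 2))) → (∀ i → B (f i) (f (i + 3))) → Cyc B (suc (n + n))
  zigzagOdd {suc (suc (suc m))} f (s≤s (s≤s (s≤s _))) inj B-sym two three = indexCycle f inj below uniq size path
    where
    n = suc (suc (suc m))
    Q : ℕ → ℕ → Set
    Q i j = B (f i) (f j)
    odds evens is : List ℕ
    odds = map (λ s → suc (2 * s)) (iota 2 m)
    evens = reverse (map (2 *_) (iota 1 n))
    is = 3 ∷ (odds ++ suc (2 * (m + 2)) ∷ 2 * (n + 1) ∷ evens)
    step₂ : ∀ i → Q i (suc (suc i))
    step₂ i = subst (Q i) (+-comm i 2) (two i)
    step₃ : ∀ i → Q i (suc (suc (suc i)))
    step₃ i = subst (Q i) (+-comm i 3) (three i)
    double-suc : ∀ s → suc (suc (2 * s)) ≡ 2 * suc s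
    double-suc = solve-∀
    corner : ∀ m → suc (suc (suc (suc (2 * (m + 2))))) ≡ 2 * (suc (suc (suc m)) + 1)
    corner = solve-∀
    path : Path Q 0 is 0
    path = step₃ 0 ◅
      (along (λ s → suc (2 * s)) (segmentPath 1 m λ s _ _ → subst (Q (suc (2 * s))) (cong suc (double-suc s)) (step₂ (suc (2 * s))))
      ▷ subst (Q _) (corner m) (step₃ (suc (2 * (m + 2))))
      ◅ reversePath B-sym (along (2 *_) (segmentPath 0 n λ s _ _ → subst (Q (2 * s)) (double-suc s) (step₂ (2 * s)))))
    odds′ evens′ : List ℕ
    odds′ = map (λ s → suc (2 * s)) (iota 1 (suc (suc m)))
    evens′ = map (2 *_) (iota 0 (suc (suc n)))
    shape : odds′ ++ evens′ ↭ 0 ∷ is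
    shape = ↭-trans (Perm.↭-reflexive (cong₂ _++_ e₁ e₂)) (↭-trans (Perm.shift 0 (3 ∷ odds ++ suc (2 * (m + 2)) ∷ []) (map (2 *_) (iota 1 n) ++ 2 * (n + 1) ∷ []))
      (prep 0 (prep 3 (↭-trans (Perm.↭-reflexive (List.++-assoc odds (suc (2 * (m + 2)) ∷ []) _))
        (Perm.++⁺ˡ odds (prep _ (↭-trans (Perm.++-comm (map (2 *_) (iota 1 n)) (2 * (n + 1) ∷ [])) (prep _ (↭-sym (Perm.↭-reverse (map (2 *_) (iota 1 n))))))))))))
      where
      e₁ : odds′ ≡ 3 ∷ odds ++ suc (2 * (m + 2)) ∷ []
      e₁ = cong (3 ∷_) (trans (cong (map (λ s → suc (2 * s))) (iota-∷ʳ 2 m)) (List.map-++ (λ s → suc (2 * s)) (iota 2 m) _))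
      e₂ : evens′ ≡ 0 ∷ map (2 *_) (iota 1 n) ++ 2 * (n + 1) ∷ []
      e₂ = cong (0 ∷_) (trans (cong (map (2 *_)) (iota-∷ʳ 1 n)) (List.map-++ (2 *_) (iota 1 n) _))
    uniq : Unique (0 ∷ is)
    uniq = unique-↭ shape (unique-++ (Unique.map⁺ (λ {s} {t} e → double-injective s t (suc-injective e)) (unique-iota 1 _))
      (Unique.map⁺ (λ {s} {t} → double-injective s t) (unique-iota 0 _)) disjoint)
      where
      disjoint : ∀ {i} → i ∈ odds′ → i ∉ evens′
      disjoint p q with ∈-map⁻ (λ s → suc (2 * s)) {xs = iota 1 (suc (suc m))} p | ∈-map⁻ (2 *_) {xs = iota 0 (suc (suc n))} q
      ... | s , _ , refl | t , _ , e = even≢odd′ t s (sym e)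
    below : ∀ {i} → i ∈ 0 ∷ is → i < suc (n + n) + 2
    below p with ∈-++⁻ odds′ (Perm.∈-resp-↭ (↭-sym shape) p)
    ... | inj₁ q with ∈-map⁻ (λ s → suc (2 * s)) {xs = iota 1 (suc (suc m))} q
    ... | s , s∈ , refl = linear 2 (λ s m → 1+ s ⊑ 1+ (1+ (1+ m)) ∷ [] ⊢ 1+ (1+ (2 ⊛ s)) ⊑ 1+ (1+ (1+ (1+ m)) ⊕ 1+ (1+ (1+ m))) ⊕ # 2)
      (s ∷ m ∷ []) (proj₂ (∈-iota⁻ 1 (suc (suc m)) s∈) ∷ [])
    below p | inj₂ q with ∈-map⁻ (2 *_) {xs = iota 0 (suc (suc n))} q
    ... | s , s∈ , refl = linear 2 (λ s n → 1+ s ⊑ 1+ (1+ n) ∷ [] ⊢ 1+ (2 ⊛ s) ⊑ 1+ (n ⊕ n) ⊕ # 2)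
      (s ∷ n ∷ []) (proj₂ (∈-iota⁻ 0 (suc (suc n)) s∈) ∷ [])
    size : length (0 ∷ is) ≡ suc (n + n)
    size = trans (sym (Perm.↭-length shape)) (trans (List.length-++ odds′)
      (trans (cong₂ _+_ (trans (List.length-map (λ s → suc (2 * s)) (iota 1 (suc (suc m)))) (length-iota 1 _)) (trans (List.length-map (2 *_) (iota 0 (suc (suc n)))) (length-iota 0 _))) (count m)))
      where
      count : ∀ m → suc (suc m) + suc (suc (suc (suc (suc m)))) ≡ suc (suc (suc (suc m)) + suc (suc (suc m)))
      count = solve-∀

  -- A chord of length 2 or 3 saves one or two vertices, so the induction starts from the two
  -- excluded lengths 2n + 1 and 2n + 2. For a longer red cycle all these chords are therefore blue,
  -- and `zigzagOdd` applies.
  descend : ∀ {U n} → TwoColoured U R B → 3 ≤ n →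
    ¬ Cyc R (suc (n + n)) → ¬ Cyc R (suc (suc (n + n))) → ¬ Cyc B (suc (n + n)) →
    ∀ e → ¬ Cyc R (e + suc (n + n))
  descend c 3≤n no₁ no₂ noB zero = no₁
  descend c 3≤n no₁ no₂ noB (suc zero) = no₂
  descend {U} {n@(suc n′)} c 3≤n no₁ no₂ noB (suc (suc e)) C =
    noB (zigzagOdd vertex 3≤n
      (InjectiveBelow-≤ (≤-trans (≤-reflexive (+-comm (suc (n + n)) 2)) (s≤s (s≤s (m≤n+m (suc (n + n)) e)))) (window 0))
      (TwoColoured.B-sym c)
      (λ i → notRed c ℓ i 2 (s≤s z≤n) 2<L λ r →
        descend c 3≤n no₁ no₂ noB (suc e) (subst (Cyc R) (cong suc (sym (+-suc e (n + n))))
          (shortcut ℓ i 2 (e + (n + n)) (cong (λ z → suc (suc z)) (sym (+-suc e (n + n)))) (s≤s z≤n) r)))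
      (λ i → notRed c ℓ i 3 (s≤s z≤n) 3<L λ r →
        descend c 3≤n no₁ no₂ noB e (subst (Cyc R) (two e n′)
          (shortcut ℓ i 3 (e + (n′ + n)) (three e n′) (s≤s z≤n) r))))
    where
    ℓ = unroll C
    open Loop ℓ
    2<L : 2 < suc (suc e) + suc (n + n)
    2<L = s≤s (s≤s (≤-trans (s≤s z≤n) (m≤n+m (suc (n + n)) e)))
    3<L : 3 < suc (suc e) + suc (n + n)
    3<L = linear 2 (λ e n → # 3 ⊑ n ∷ [] ⊢ # 4 ⊑ 1+ (1+ e) ⊕ 1+ (n ⊕ n)) (e ∷ n ∷ []) (3≤n ∷ [])
    three : ∀ e n′ → 3 + suc (e + (n′ + suc n′)) ≡ suc (suc e) + suc (suc n′ + suc n′)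
    three = solve-∀
    two : ∀ e n′ → suc (suc (e + (n′ + suc n′))) ≡ e + suc (suc n′ + suc n′)
    two = solve-∀

-- Hamiltonian cycles made of a red and a blue path

module _ {V : Set} where

  -- One edge is singled out as the place where the next vertex is inserted. On two vertices the
  -- "cycle" runs back along its only edge; `twoArcs` starts from this degenerate case.
  record Mono (R : V → V → Set) (us : List V) : Set where
    constructor mono
    field
      {a x}  : V
      {xs}   : List V
      first  : R a x
      closed : Path R x xs a
      cover  : a ∷ x ∷ xs ↭ us

  record Arcs (R B : V → V → Set) (us : List V) : Set where
    constructor arcs
    field
      {a b}   : V
      {ps qs} : List V
      red     : Path R a ps b
      blue    : Path B a qs b
      cover   : a ∷ b ∷ ps ++ qs ↭ us

  TwoArcs : (R B : V → V → Set) → List V → Set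
  TwoArcs R B us = Mono R us ⊎ Mono B us ⊎ Arcs R B us

  swapArcs : ∀ {R B us} → TwoArcs R B us → TwoArcs B R us
  swapArcs (inj₁ m) = inj₂ (inj₁ m)
  swapArcs (inj₂ (inj₁ m)) = inj₁ m
  swapArcs (inj₂ (inj₂ (arcs {ps = ps} {qs} p q c))) =
    inj₂ (inj₂ (arcs q p (↭-trans (prep _ (prep _ (Perm.++-comm qs ps))) c)))

  module _ {R B : V → V → Set} (R-sym : ∀ {u v} → R u v → R v u) (B-sym : ∀ {u v} → B u v → B v u) where

    -- With x the first interior vertex of the blue arc, w goes between a and x. If wx is blue the
    -- turning point moves from a to w, otherwise from a to x. A blue arc consisting of one edge can
    -- disappear, and then the cycle is red.
    insertArc : ∀ {us w a b ps qs} → (∀ {v} → v ∈ us → R w v ⊎ B w v) → R w a →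
      Path R a ps b → Path B a qs b → a ∷ b ∷ ps ++ qs ↭ us → TwoArcs R B (w ∷ us)
    insertArc {w = w} {a} {b} {ps} col wa p (edge ab) c with col (Perm.∈-resp-↭ c (there (here refl)))
    ... | inj₁ wb = inj₁ (mono (R-sym wb) (wa ◅ p) (↭-trans (swap b w ↭-refl) (prep w
      (↭-trans (swap b a (Perm.↭-reflexive (sym (List.++-identityʳ ps)))) c))))
    ... | inj₂ wb = inj₂ (inj₂ (arcs (wa ◅ p) (edge wb) (prep w (↭-trans (swap b a ↭-refl) c))))
    insertArc {w = w} {a} {b} {ps} col wa p (_◅_ {x = x} {qs} ax q) c
      with col (Perm.∈-resp-↭ c (there (there (∈-++⁺ʳ ps (here refl)))))
    ... | inj₂ wx = inj₂ (inj₂ (arcs (wa ◅ p) (wx ◅ q) (prep w (↭-trans (swap b a ↭-refl) c))))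
    ... | inj₁ wx = inj₂ (inj₂ (arcs (R-sym wx ◅ wa ◅ p) q
      (↭-trans (↭-sym (Perm.shift x (b ∷ w ∷ a ∷ ps) qs)) (↭-trans (swap b w ↭-refl)
        (prep w (↭-trans (swap b a ↭-refl) c))))))

    insertMono : ∀ {us w} → (∀ {v} → v ∈ us → R w v ⊎ B w v) → Mono R us → TwoArcs R B (w ∷ us)
    insertMono {w = w} col (mono {a} {x} {xs} ax p c)
      with col (Perm.∈-resp-↭ c (here refl)) | col (Perm.∈-resp-↭ c (there (here refl)))
    ... | inj₁ wa | inj₁ wx = inj₁ (mono (R-sym wa) (wx ◅ p) (↭-trans (swap a w ↭-refl) (prep w c)))
    ... | inj₁ wa | inj₂ wx = inj₂ (inj₂ (arcs (p ▷ edge (R-sym wa)) (edge (B-sym wx))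
      (↭-trans (swap x w (↭-trans (Perm.↭-reflexive (List.++-identityʳ _)) (Perm.++-comm xs (a ∷ []))))
        (prep w (↭-trans (swap x a ↭-refl) c)))))
    ... | inj₂ wa | inj₁ wx = inj₂ (inj₂ (arcs (wx ◅ p) (edge wa)
      (prep w (↭-trans (prep a (prep x (Perm.↭-reflexive (List.++-identityʳ xs)))) c))))
    ... | inj₂ wa | inj₂ wx = inj₂ (inj₂ (arcs p (B-sym wx ◅ edge wa)
      (↭-trans (prep x (prep a (Perm.++-comm xs (w ∷ [])))) (↭-trans (Perm.shift w (x ∷ a ∷ []) xs)
        (prep w (↭-trans (swap x a ↭-refl) c))))))

  insertVertex : ∀ {R B us w} → (∀ {u v} → R u v → R v u) → (∀ {u v} → B u v → B v u) →
    (∀ {v} → v ∈ us → R w v ⊎ B w v) → TwoArcs R B us → TwoArcs R B (w ∷ us)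
  insertVertex R-sym B-sym col (inj₁ m) = insertMono R-sym B-sym col m
  insertVertex R-sym B-sym col (inj₂ (inj₁ m)) =
    swapArcs (insertMono B-sym R-sym (λ v → [ inj₂ , inj₁ ]′ (col v)) m)
  insertVertex R-sym B-sym col (inj₂ (inj₂ (arcs {ps = ps} {qs} p q c)))
    with col (Perm.∈-resp-↭ c (here refl))
  ... | inj₁ wa = insertArc R-sym B-sym col wa p q c
  ... | inj₂ wa = swapArcs (insertArc B-sym R-sym (λ v → [ inj₂ , inj₁ ]′ (col v)) wa q p
    (↭-trans (prep _ (prep _ (Perm.++-comm qs ps))) c))

  twoArcs : ∀ {R B U} → TwoColoured U R B → ∀ xs → Unique xs → xs ⊆ U → 2 ≤ length xs → TwoArcs R B xs
  twoArcs c (x ∷ y ∷ []) u sub _ with TwoColoured.total c (sub (here refl)) (sub (there (here refl))) (λ e → ∉-unique u (here e))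
  ... | inj₁ r = inj₁ (mono r (edge (TwoColoured.R-sym c r)) ↭-refl)
  ... | inj₂ b = inj₂ (inj₁ (mono b (edge (TwoColoured.B-sym c b)) ↭-refl))
  twoArcs c (x ∷ xs@(_ ∷ _ ∷ _)) u@(_ ∷ u′) sub _ =
    insertVertex (TwoColoured.R-sym c) (TwoColoured.B-sym c)
      (λ v∈ → TwoColoured.total c (sub (here refl)) (sub (there v∈)) λ { refl → ∉-unique u v∈ })
      (twoArcs c xs u′ (sub ∘ there) (s≤s (s≤s z≤n)))
  twoArcs c (x ∷ []) u sub (s≤s ())

  farBlue : ∀ {R B U} → TwoColoured U R B → ∀ (f : ℕ → V) k → ¬ Cyc R (suc (suc k)) →
    ∀ i → InjectiveBelow (λ j → f (i + j)) (suc (suc k)) → (∀ j → j ≤ k → R (f (i + j)) (f (suc (i + j)))) →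
    B (f i) (f (suc (i + k)))
  farBlue {R} {B} c f k none i inj adj
    with TwoColoured.total c (TwoColoured.R-in c (adj 0 z≤n)) (TwoColoured.R-in c (TwoColoured.R-sym c (adj k ≤-refl))) ne
    where
    ne : f (i + 0) ≢ f (suc (i + k))
    ne e with inj {0} {suc k} (s≤s z≤n) ≤-refl (trans e (cong f (sym (+-suc i k))))
    ... | ()
  ... | inj₂ b = subst (λ j → B (f j) (f (suc (i + k)))) (+-identityʳ i) b
  ... | inj₁ r = contradiction (chordCycle (λ j → f (i + j)) k inj
      (λ j j≤ → subst (λ z → R (f (i + j)) (f z)) (sym (+-suc i j)) (adj j j≤))
      (TwoColoured.R-sym c (subst (λ z → R (f (i + 0)) (f z)) (sym (+-suc i k)) r))) none

at-last : ∀ (d : A) xs {b ys} → at d (xs ++ b ∷ ys) (length xs) ≡ b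
at-last d [] = refl
at-last d (x ∷ xs) = at-last d xs

-- On a red path p₀ p₁ … with no red cycle of length 2n+1 or 2n+2, the pairs at distance 2n and
-- 2n+1 are blue, so p₀, p₂ₙ₊₁, p₁, p₂ₙ₊₂, p₂, … is a blue path.
module LongCycle {V : Set} {R B : V → V → Set} {U : List V} (c : TwoColoured U R B) {n′ : ℕ} where
  private
    n K : ℕ
    n = suc n′
    K = suc (n + n)

  blueZigzag : ¬ Cyc R K → ¬ Cyc R (suc K) → ∀ (f : ℕ → V) e →
    (∀ i k → k ≤ K → i + k ≤ e + K → InjectiveBelow (λ j → f (i + j)) (suc k)) →
    (∀ i → i < e + K → R (f i) (f (suc i))) → Path B (f 0) (map f (zigzag 0 K e)) (f (e + K))
  blueZigzag no₁ no₂ f e window adj = along f (zigzagPath 0 K e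
    (λ i i≤ → subst₂ (λ x y → B (f x) (f y)) (sym (+-identityʳ i)) (sym (+-suc i (n + n)))
      (farBlue c f (n + n) no₂ i (window i K ≤-refl (+-monoˡ-≤ K i≤)) λ j j≤ → adj (i + j)
        (linear 4 (λ i j e n → i ⊑ e ∷ j ⊑ n ⊕ n ∷ [] ⊢ 1+ (i ⊕ j) ⊑ e ⊕ 1+ (n ⊕ n)) (i ∷ j ∷ e ∷ n ∷ []) (i≤ ∷ j≤ ∷ []))))
    (λ i i< → subst₂ (λ x y → B (f x) (f y)) (shift i n′) (cong suc (sym (+-identityʳ i)))
      (TwoColoured.B-sym c (farBlue c f (n′ + n) no₁ (suc i)
        (window (suc i) (n + n) (n≤1+n (n + n))
          (linear 3 (λ i e n → 1+ i ⊑ e ∷ [] ⊢ 1+ i ⊕ (n ⊕ n) ⊑ e ⊕ 1+ (n ⊕ n)) (i ∷ e ∷ n ∷ []) (i< ∷ [])))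
        λ j j≤ → adj (suc i + j)
          (linear 4 (λ i j e n → 1+ i ⊑ e ∷ j ⊑ n ⊕ 1+ n ∷ [] ⊢ 1+ (1+ i ⊕ j) ⊑ e ⊕ 1+ (1+ n ⊕ 1+ n)) (i ∷ j ∷ e ∷ n′ ∷ []) (i< ∷ j≤ ∷ []))))))
    where
    shift : ∀ i n′ → suc (suc i + (n′ + suc n′)) ≡ i + suc (suc n′ + suc n′)
    shift = solve-∀

  -- The blue walk 0, 2n + 1, 1, 2n + 2, ..., 4n, 2n visits every vertex once, and its next index 4n
  -- + 1 is 0 again modulo the length. So a red Hamiltonian cycle yields a blue one.
  fromMono : ∀ {us} → ¬ Cyc R K → ¬ Cyc R (suc K) → Unique us → length us ≡ n + n + K → Mono R us → Cyc B (n + n + K)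
  fromMono no₁ no₂ u len (mono {a} {x} {xs} ax p cover) = cyc
    (cong suc (trans (List.length-map f (zigzag 0 K (n + n))) (trans (length-zigzag 0 K (n + n)) (count n′))))
    (unique-map (window 0) {is = 0 ∷ zigzag 0 K (n + n)} zz-unique below)
    (subst (Path B (f 0) _) (period 0) (blueZigzag no₁ no₂ f (n + n) (λ i k k≤ _ → InjectiveBelow-≤ (≤-trans (s≤s k≤) big) (window i)) (λ i _ → adjacent i)))
    where
    L : ℕ
    L = n + n + K
    C : Cyc R L
    C = cyc (trans (Perm.↭-length cover) len) (unique-↭ (↭-sym cover) u) (ax ◅ p)
    ℓ = unroll C
    open Loop ℓ
    f = vertex
    big : suc K ≤ L
    big = s≤s (m≤n+m K (n′ + n))
    count : ∀ n′ → (suc n′ + suc n′) + (suc n′ + suc n′) ≡ n′ + suc n′ + suc (suc n′ + suc n′)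
    count = solve-∀
    zz∷ʳ : Unique (0 ∷ zigzag 0 K (n + n) ++ (n + n + K) ∷ [])
    zz∷ʳ = unique-zigzag 0 K (n + n) (≤-reflexive (cong suc (+-identityʳ (n + n))))
    zz-unique : Unique (0 ∷ zigzag 0 K (n + n))
    zz-unique = proj₁ (unique-++⁻ (0 ∷ zigzag 0 K (n + n)) zz∷ʳ)
    below : ∀ {i} → i ∈ 0 ∷ zigzag 0 K (n + n) → i < L
    below (here refl) = s≤s z≤n
    below (there p) with ∈-++⁻ (iota 1 (n + n)) (Perm.∈-resp-↭ (zigzag-↭ 0 K (n + n)) p)
    ... | inj₁ q = ≤-trans (proj₂ (∈-iota⁻ 1 (n + n) q)) (m≤n+m K (n + n))
    ... | inj₂ q = ≤-trans (proj₂ (∈-iota⁻ K (n + n) q)) (≤-reflexive (+-comm K (n + n)))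

  -- The blue zigzag joins the same turning points as the blue arc and meets it only there. It uses
  -- 2e + 2 vertices of the red path, and the blue arc has 2n - 1 - e interior vertices, which makes
  -- e + 2n + 1: a longer red arc gives a longer blue cycle.
  fromArcs : ∀ {us a b ps qs} → ¬ Cyc R K → ¬ Cyc R (suc K) → Unique us → length us ≡ n + n + K →
    Path R a ps b → Path B a qs b → a ∷ b ∷ ps ++ qs ↭ us → ∀ e → length ps ≡ e + (n + n) → Cyc B (e + K)
  fromArcs {us} {a} {b} {ps} {qs} no₁ no₂ u len p q cover e lps = cyc size distinct
    (subst (Path B a _) last (blueZigzag no₁ no₂ f e window adj) ▷ reversePath (TwoColoured.B-sym c) q)
    where
    P = a ∷ ps ++ b ∷ []
    f = at a P
    P↭ : P ++ qs ↭ us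
    P↭ = ↭-trans (Perm.↭-reflexive (cong (a ∷_) (List.++-assoc ps (b ∷ []) qs))) (↭-trans (prep a (Perm.shift b ps qs)) cover)
    uPqs : Unique (P ++ qs)
    uPqs = unique-↭ (↭-sym P↭) u
    uP : Unique P
    uP = proj₁ (unique-++⁻ P uPqs)
    uqs : Unique qs
    uqs = proj₁ (proj₂ (unique-++⁻ P uPqs))
    lP : length P ≡ suc (e + K)
    lP = cong suc (trans (List.length-++ ps) (trans (cong (_+ 1) lps) (trans (+-comm _ 1) (sym (+-suc e (n + n))))))
    inj : InjectiveBelow f (suc (e + K))
    inj = subst (InjectiveBelow f) lP (at-injective a uP)
    window : ∀ i k → k ≤ K → i + k ≤ e + K → InjectiveBelow (λ j → f (i + j)) (suc k)
    window i k _ b {x} {y} x< y< eq = +-cancelˡ-≡ i x y (inj (bound x<) (bound y<) eq)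
      where
      bound : ∀ {x} → x < suc k → i + x < suc (e + K)
      bound x< = s≤s (≤-trans (+-monoʳ-≤ i (≤-pred x<)) b)
    adj : ∀ i → i < e + K → R (f i) (f (suc i))
    adj i i< = path-at a p (≤-pred (≤-trans i< (≤-reflexive (trans (+-suc e (n + n)) (cong suc (sym lps))))))
    last : f (e + K) ≡ b
    last = trans (cong f (trans (+-suc e (n + n)) (cong suc (sym lps)))) (at-last a ps)
    lqs : length qs + suc (e + K) ≡ n + n + K
    lqs = trans (+-comm (length qs) _) (trans (cong (_+ length qs) (sym lP)) (trans (sym (List.length-++ P)) (trans (Perm.↭-length P↭) len)))
    mid = map f (zigzag 0 K e)
    zz = 0 ∷ zigzag 0 K e ++ (e + K) ∷ []
    path-zz : map f zz ≡ a ∷ mid ++ b ∷ []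
    path-zz = cong (a ∷_) (trans (List.map-++ f (zigzag 0 K e) _) (cong (λ z → mid ++ z ∷ []) last))
    short : suc (e + 0) ≤ K
    short = linear 3 (λ e n q → q ⊕ 1+ (e ⊕ 1+ (n ⊕ n)) ⊑ n ⊕ n ⊕ 1+ (n ⊕ n) ∷ [] ⊢ 1+ (e ⊕ # 0) ⊑ 1+ (n ⊕ n))
      (e ∷ n ∷ length qs ∷ []) (≤-reflexive lqs ∷ [])
    below : ∀ {i} → i ∈ zz → i < suc (e + K)
    below p with ∈-zigzag 0 K e p
    ... | inj₁ r = ≤-trans (proj₂ (∈-iota⁻ 0 (suc e) r)) (s≤s (m≤m+n e K))
    ... | inj₂ r = ≤-trans (proj₂ (∈-iota⁻ K (suc e) r)) (≤-reflexive (+-comm K (suc e)))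
    distinct : Unique (a ∷ mid ++ b ∷ reverse qs)
    distinct = subst Unique (trans (cong (_++ reverse qs) path-zz) (cong (a ∷_) (List.++-assoc mid (b ∷ []) (reverse qs))))
      (unique-++ (unique-map inj (unique-zigzag 0 K e short) below) (unique-↭ (↭-sym (Perm.↭-reverse qs)) uqs) apart)
      where
      apart : ∀ {x} → x ∈ map f zz → x ∉ reverse qs
      apart x∈ x∈qs with ∈-map⁻ f {xs = zz} x∈
      ... | i , i∈ , refl = proj₂ (proj₂ (unique-++⁻ P uPqs)) (at-∈ a P (≤-trans (below i∈) (≤-reflexive (sym lP))))
              (Perm.∈-resp-↭ (Perm.↭-reverse qs) x∈qs)
    size : length (a ∷ mid ++ b ∷ reverse qs) ≡ e + K
    size = trans (cong suc (trans (List.length-++ mid) (cong₂ (λ x y → x + suc y) (trans (List.length-map f (zigzag 0 K e)) (length-zigzag 0 K e)) (List.length-reverse qs))))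
      (≤-antisym (linear 3 (λ e n q → q ⊕ 1+ (e ⊕ 1+ (n ⊕ n)) ⊑ n ⊕ n ⊕ 1+ (n ⊕ n) ∷ [] ⊢ 1+ (e ⊕ e ⊕ 1+ q) ⊑ e ⊕ 1+ (n ⊕ n))
          (e ∷ n ∷ length qs ∷ []) (≤-reflexive lqs ∷ []))
        (linear 3 (λ e n q → n ⊕ n ⊕ 1+ (n ⊕ n) ⊑ q ⊕ 1+ (e ⊕ 1+ (n ⊕ n)) ∷ [] ⊢ e ⊕ 1+ (n ⊕ n) ⊑ 1+ (e ⊕ e ⊕ 1+ q))
          (e ∷ n ∷ length qs ∷ []) (≤-reflexive (sym lqs) ∷ [])))

module _ {V : Set} where

  longCycle : ∀ {R B : V → V → Set} {U n} → TwoColoured U R B → 3 ≤ n → Unique U → length U ≡ n + n + suc (n + n) →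
    ¬ Cyc R (suc (n + n)) → ¬ Cyc R (suc (suc (n + n))) → ¬ Cyc B (suc (n + n)) → ¬ Cyc B (suc (suc (n + n))) → ⊥
  longCycle {R} {B} {U} {n@(suc n′)} c 3≤n u len r₁ r₂ b₁ b₂ = cases (twoArcs c U u id 2≤)
    where
    2≤ : 2 ≤ length U
    2≤ = ≤-trans (s≤s (≤-trans (s≤s z≤n) (m≤n+m (suc (n + n)) (n′ + n)))) (≤-reflexive (sym len))
    longArc : ∀ {a b ps qs} → Path R a ps b → Path B a qs b → a ∷ b ∷ ps ++ qs ↭ U → n + n ≤ length ps → ⊥
    longArc {ps = ps} p q cover l = descend (swapColours c) 3≤n b₁ b₂ r₁ (length ps ∸ (n + n))
      (LongCycle.fromArcs c {n′ = n′} r₁ r₂ u len p q cover (length ps ∸ (n + n)) (sym (m∸n+n≡m l)))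
    longArc′ : ∀ {a b ps qs} → Path R a ps b → Path B a qs b → a ∷ b ∷ ps ++ qs ↭ U → n + n ≤ length qs → ⊥
    longArc′ {ps = ps} {qs} p q cover l = descend c 3≤n r₁ r₂ b₁ (length qs ∸ (n + n))
        (LongCycle.fromArcs (swapColours c) {n′ = n′} b₁ b₂ u len q p (↭-trans (prep _ (prep _ (Perm.++-comm qs ps))) cover)
          (length qs ∸ (n + n)) (sym (m∸n+n≡m l)))
    cases : TwoArcs R B U → ⊥
    cases (inj₁ m) = descend (swapColours c) 3≤n b₁ b₂ r₁ (n + n) (LongCycle.fromMono c {n′ = n′} r₁ r₂ u len m)
    cases (inj₂ (inj₁ m)) = descend c 3≤n r₁ r₂ b₁ (n + n) (LongCycle.fromMono (swapColours c) {n′ = n′} b₁ b₂ u len m)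
    -- The arcs have 4n - 1 interior vertices together, so one of them has at least 2n.
    cases (inj₂ (inj₂ (arcs {ps = ps} {qs} p q cover))) with n + n ≤? length ps
    ... | yes l = longArc p q cover l
    ... | no l = longArc′ p q cover (linear 3 (λ n p q → 1+ p ⊑ n ⊕ n ∷ n ⊕ n ⊕ 1+ (n ⊕ n) ⊑ 1+ (1+ (p ⊕ q)) ∷ [] ⊢ n ⊕ n ⊑ q)
        (n ∷ length ps ∷ length qs ∷ []) (≰⇒> l ∷ ≤-reflexive (sym total) ∷ []))
      where
      total : suc (suc (length ps + length qs)) ≡ n + n + suc (n + n)
      total = trans (cong (λ z → suc (suc z)) (sym (List.length-++ ps))) (trans (Perm.↭-length cover) len)

-- Chords of a red cycle of length 2n + 2

retarget : ∀ {V : Set} {R : V → V → Set} {a xs b b′} → (∀ {x} → R x b → R x b′) → Path R a xs b → Path R a xs b′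
retarget g (edge r) = edge (g r)
retarget g (r ◅ p) = r ◅ retarget g p

rotate : ∀ {V : Set} {R : V → V → Set} {L} → Loop R L → ℕ → Loop R L
rotate {R = R} {L} ℓ i = record
  { vertex = λ j → vertex (i + j)
  ; adjacent = λ j → subst (λ z → R (vertex (i + j)) (vertex z)) (sym (+-suc i j)) (adjacent (i + j))
  ; period = λ j → trans (cong vertex (sym (+-assoc i j L))) (period (i + j))
  ; window = λ j a< b< e → window (i + j) a< b< (trans (cong vertex (+-assoc i j _)) (trans e (cong vertex (sym (+-assoc i j _)))))
  }
  where open Loop ℓ

-- A chord (0, s+2) together with a chord crossing it at distance (1, 2) saves exactly one vertex.
module _ {V : Set} {R : V → V → Set} (R-sym : ∀ {u v} → R u v → R v u) where

  -- The cycle is 0, s + 2, s + 1, ..., 1, s + 4, s + 5, ..., L - 1; only s + 3 is left out.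
  crossForward : ∀ s r {L} (ℓ : Loop R L) → let open Loop ℓ in L ≡ r + suc (s + 4) →
    R (vertex 0) (vertex (s + 2)) → R (vertex 1) (vertex (s + 4)) → Cyc R (r + (s + 4))
  crossForward s r ℓ refl chord cross = indexCycle vertex (window 0) below uniq size
    (chord ◅ (reversePath R-sym (segmentPath 1 s (λ i _ _ → adjacent i)) ▷ cross ◅
      retarget (subst (R _) (period 0)) (segmentPath (s + 4) r (λ i _ _ → adjacent i))))
    where
    open Loop ℓ
    low is : List ℕ
    low = (s + 2) ∷ reverse (iota 2 s)
    is = 0 ∷ low ++ 1 ∷ (s + 4) ∷ iota (suc (s + 4)) r
    shape : iota 0 (suc (suc (suc s))) ++ iota (s + 4) (suc r) ↭ is
    shape = prep 0 (↭-trans (prep 1 (Perm.++⁺ʳ (iota (s + 4) (suc r))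
      (↭-trans (Perm.↭-reflexive (iota-∷ʳ 2 s)) (↭-trans (Perm.++-comm (iota 2 s) _) (prep (s + 2) (↭-sym (Perm.↭-reverse (iota 2 s))))))))
      (↭-sym (Perm.shift 1 low _)))
    uniq : Unique is
    uniq = unique-↭ shape (unique-++ (unique-iota 0 _) (unique-iota (s + 4) _) λ p q →
      <⇒≱ (≤-trans (proj₂ (∈-iota⁻ 0 (suc (suc (suc s))) p)) (≤-trans (n≤1+n _) (≤-reflexive (+-comm 4 s)))) (proj₁ (∈-iota⁻ (s + 4) _ q)))
    below : ∀ {i} → i ∈ is → i < r + suc (s + 4)
    below p with ∈-++⁻ (iota 0 (suc (suc (suc s)))) (Perm.∈-resp-↭ (↭-sym shape) p)
    ... | inj₁ q = ≤-trans (proj₂ (∈-iota⁻ 0 (suc (suc (suc s))) q))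
      (linear 2 (λ s r → [] ⊢ 1+ (1+ (1+ s)) ⊑ r ⊕ 1+ (s ⊕ # 4)) (s ∷ r ∷ []) [])
    ... | inj₂ q = ≤-trans (proj₂ (∈-iota⁻ (s + 4) (suc r) q))
      (linear 2 (λ s r → [] ⊢ s ⊕ # 4 ⊕ 1+ r ⊑ r ⊕ 1+ (s ⊕ # 4)) (s ∷ r ∷ []) [])
    size : length is ≡ r + (s + 4)
    size = trans (sym (Perm.↭-length shape)) (trans (List.length-++ (iota 0 (suc (suc (suc s)))))
      (trans (cong₂ _+_ (length-iota 0 (suc (suc (suc s)))) (length-iota (s + 4) (suc r))) (count s r)))
      where
      count : ∀ s r → suc (suc (suc s)) + suc r ≡ r + (s + 4)
      count = solve-∀

  -- The cycle is 0, s + 3, s + 4, ..., L - 1, s + 1, s, ..., 1; only s + 2 is left out.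
  crossBackward : ∀ s r {L} (ℓ : Loop R L) → let open Loop ℓ in L ≡ r + suc (suc s + 4) →
    R (vertex 0) (vertex (suc s + 2)) → R (vertex (suc r + suc (suc s + 2))) (vertex (s + 1)) → Cyc R (r + (suc s + 4))
  crossBackward s r ℓ refl chord cross = indexCycle vertex (window 0) below uniq size
    (chord ◅ (segmentPath (suc s + 2) (suc r) (λ i _ _ → adjacent i) ▷ cross ◅
      reversePath R-sym (segmentPath 0 s (λ i _ _ → adjacent i))))
    where
    open Loop ℓ
    J : ℕ
    J = suc s + 2
    is : List ℕ
    is = 0 ∷ J ∷ iota (suc J) (suc r) ++ (suc r + suc J) ∷ (s + 1) ∷ reverse (iota 1 s)
    shape : iota J (suc (suc (suc r))) ++ iota 0 (suc (suc s)) ↭ is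
    shape = ↭-trans (Perm.shift 0 (iota J (suc (suc (suc r)))) _) (prep 0 (↭-trans (Perm.↭-reflexive
      (trans (cong (_++ iota 1 (suc s)) (cong (J ∷_) (iota-∷ʳ (suc J) (suc r)))) (cong (J ∷_) (List.++-assoc (iota (suc J) (suc r)) _ _))))
      (prep J (Perm.++⁺ˡ (iota (suc J) (suc r)) (prep _ (↭-trans (Perm.↭-reflexive (iota-∷ʳ 1 s))
        (↭-trans (Perm.++-comm (iota 1 s) _) (prep (s + 1) (↭-sym (Perm.↭-reverse (iota 1 s)))))))))))
    uniq : Unique is
    uniq = unique-↭ shape (unique-++ (unique-iota J (suc (suc (suc r)))) (unique-iota 0 (suc (suc s))) λ p q →
      <⇒≱ (proj₂ (∈-iota⁻ 0 (suc (suc s)) q)) (≤-trans (linear 1 (λ s → [] ⊢ 1+ (1+ s) ⊑ 1+ s ⊕ # 2) (s ∷ []) []) (proj₁ (∈-iota⁻ J (suc (suc (suc r))) p))))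
    below : ∀ {i} → i ∈ is → i < r + suc (suc s + 4)
    below p with ∈-++⁻ (iota J (suc (suc (suc r)))) (Perm.∈-resp-↭ (↭-sym shape) p)
    ... | inj₁ q = ≤-trans (proj₂ (∈-iota⁻ J (suc (suc (suc r))) q))
      (linear 2 (λ s r → [] ⊢ 1+ s ⊕ # 2 ⊕ 1+ (1+ (1+ r)) ⊑ r ⊕ 1+ (1+ s ⊕ # 4)) (s ∷ r ∷ []) [])
    ... | inj₂ q = ≤-trans (proj₂ (∈-iota⁻ 0 (suc (suc s)) q))
      (linear 2 (λ s r → [] ⊢ 1+ (1+ s) ⊑ r ⊕ 1+ (1+ s ⊕ # 4)) (s ∷ r ∷ []) [])
    size : length is ≡ r + (suc s + 4)
    size = trans (sym (Perm.↭-length shape)) (trans (List.length-++ (iota J (suc (suc (suc r)))))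
      (trans (cong₂ _+_ (length-iota J (suc (suc (suc r)))) (length-iota 0 (suc (suc s)))) (count s r)))
      where
      count : ∀ s r → suc (suc (suc r)) + suc (suc s) ≡ r + (suc s + 4)
      count = solve-∀

module _ {V : Set} {B : V → V → Set} (B-sym : ∀ {u v} → B u v → B v u) (f : ℕ → V) where

  -- All vertices of the loop but 2p+4: 1, 2p+6, 2p+8, …, 2n, 0, 2, …, 2p+2, 2n+1, 2n−1, …, 3.
  evenOddCycle : ∀ p q → let n = suc (suc (suc (p + q))) in InjectiveBelow f (suc (suc (n + n))) →
    f (2 * suc n) ≡ f 0 → (∀ i → B (f i) (f (suc (suc i)))) →
    B (f 1) (f (2 * suc (suc (suc p)))) → B (f (suc (2 * n))) (f (2 * suc p)) → Cyc B (suc (n + n))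
  evenOddCycle p q inj period two forward backward = indexCycle f inj below uniq size path
    where
    n j : ℕ
    n = suc (suc (suc (p + q)))
    j = suc (suc (suc p))
    Q : ℕ → ℕ → Set
    Q x y = B (f x) (f y)
    odd : ℕ → ℕ
    odd s = suc (2 * s)
    upper lower odds is : List ℕ
    upper = map (2 *_) (iota (suc j) q)
    lower = map (2 *_) (iota 1 p)
    odds = reverse (map odd (iota 1 (suc (suc (p + q)))))
    is = 2 * j ∷ upper ++ 0 ∷ lower ++ 2 * suc p ∷ odd n ∷ odds
    double-suc : ∀ s → suc (suc (2 * s)) ≡ 2 * suc s
    double-suc = solve-∀
    evenStep : ∀ s → Q (2 * s) (2 * suc s)
    evenStep s = subst (Q (2 * s)) (double-suc s) (two (2 * s))
    oddStep : ∀ s → Q (odd s) (odd (suc s))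
    oddStep s = subst (Q (odd s)) (cong suc (double-suc s)) (two (odd s))
    corner₁ : ∀ p q → q + suc (suc (suc (suc p))) ≡ suc (suc (suc (suc (p + q))))
    corner₁ = solve-∀
    corner₂ : ∀ m → m + 1 ≡ suc m
    corner₂ m = +-comm m 1
    path : Path Q 1 is 1
    path = forward ◅
      (retarget (subst (B _) (trans (cong (λ z → f (2 * z)) (corner₁ p q)) period)) (along (2 *_) (segmentPath j q λ s _ _ → evenStep s))
      ▷ (subst (λ z → Path Q 0 lower (2 * z)) (corner₂ p) (along (2 *_) (segmentPath 0 p λ s _ _ → evenStep s))
      ▷ B-sym backward ◅
        reversePath B-sym (subst (λ z → Path Q 1 (map odd (iota 1 (suc (suc (p + q))))) (odd z)) (corner₂ (suc (suc (p + q))))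
          (along odd (segmentPath 0 (suc (suc (p + q))) λ s _ _ → oddStep s)))))
    evens′ odds′ : List ℕ
    evens′ = map (2 *_) (iota 0 (suc (suc p)) ++ iota j (suc q))
    odds′ = map odd (iota 0 (suc n))
    shape : evens′ ++ odds′ ↭ 1 ∷ is
    shape = ↭-trans (Perm.++-comm evens′ odds′) (prep 1 (↭-trans (Perm.++⁺ˡ (map odd (iota 1 n)) evens-shape)
      (↭-trans (Perm.++-comm (map odd (iota 1 n)) _) (prep (2 * j) (↭-trans (Perm.↭-reflexive (List.++-assoc upper _ _))
        (Perm.++⁺ˡ upper (prep 0 (↭-trans (Perm.↭-reflexive (List.++-assoc lower _ _)) (Perm.++⁺ˡ lower (prep _ odds-shape))))))))))
      where
      evens-shape : evens′ ↭ 2 * j ∷ upper ++ 0 ∷ lower ++ 2 * suc p ∷ []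
      evens-shape = ↭-trans (Perm.map⁺ (2 *_) (Perm.++-comm (iota 0 (suc (suc p))) (iota j (suc q))))
        (Perm.↭-reflexive (cong (2 * j ∷_) (trans (List.map-++ (2 *_) (iota (suc j) q) _)
          (cong (λ z → upper ++ 0 ∷ z) (trans (cong (map (2 *_)) (iota-∷ʳ 1 p)) (trans (List.map-++ (2 *_) (iota 1 p) _)
            (cong (λ z → lower ++ 2 * z ∷ []) (corner₂ p))))))))
      odds-shape : map odd (iota 1 n) ↭ odd n ∷ odds
      odds-shape = ↭-trans (Perm.↭-reflexive (trans (cong (map odd) (iota-∷ʳ 1 (suc (suc (p + q))))) (List.map-++ odd (iota 1 (suc (suc (p + q)))) _)))
        (↭-trans (Perm.++-comm (map odd (iota 1 (suc (suc (p + q))))) _)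
          (↭-trans (Perm.↭-reflexive (cong (λ z → odd z ∷ map odd (iota 1 (suc (suc (p + q))))) (corner₂ (suc (suc (p + q))))))
            (prep (odd n) (↭-sym (Perm.↭-reverse (map odd (iota 1 (suc (suc (p + q))))))))))
    range : ∀ {s} → s ∈ iota 0 (suc (suc p)) ++ iota j (suc q) → s ≤ n
    range s∈ with ∈-++⁻ (iota 0 (suc (suc p))) s∈
    ... | inj₁ r = linear 3 (λ s p q → 1+ s ⊑ 1+ (1+ p) ∷ [] ⊢ s ⊑ 1+ (1+ (1+ (p ⊕ q)))) (_ ∷ p ∷ q ∷ []) (proj₂ (∈-iota⁻ 0 (suc (suc p)) r) ∷ [])
    ... | inj₂ r = linear 3 (λ s p q → 1+ s ⊑ 1+ (1+ (1+ p)) ⊕ 1+ q ∷ [] ⊢ s ⊑ 1+ (1+ (1+ (p ⊕ q)))) (_ ∷ p ∷ q ∷ []) (proj₂ (∈-iota⁻ j (suc q) r) ∷ [])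
    below : ∀ {i} → i ∈ 1 ∷ is → i < suc (suc (n + n))
    below i∈ with ∈-++⁻ evens′ (Perm.∈-resp-↭ (↭-sym shape) i∈)
    ... | inj₁ r with ∈-map⁻ (2 *_) {xs = iota 0 (suc (suc p)) ++ iota j (suc q)} r
    ... | s , s∈ , refl = linear 2 (λ s n → s ⊑ n ∷ [] ⊢ 1+ (2 ⊛ s) ⊑ 1+ (1+ (n ⊕ n))) (s ∷ n ∷ []) (range s∈ ∷ [])
    below i∈ | inj₂ r with ∈-map⁻ odd {xs = iota 0 (suc n)} r
    ... | s , s∈ , refl = linear 2 (λ s n → 1+ s ⊑ 1+ n ∷ [] ⊢ 1+ (1+ (2 ⊛ s)) ⊑ 1+ (1+ (n ⊕ n))) (s ∷ n ∷ []) (proj₂ (∈-iota⁻ 0 (suc n) s∈) ∷ [])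
    uniq : Unique (1 ∷ is)
    uniq = unique-↭ shape (unique-++
      (Unique.map⁺ (λ {s} {t} → double-injective s t) (unique-++ (unique-iota 0 _) (unique-iota j _) λ a b →
        <⇒≱ (proj₂ (∈-iota⁻ 0 (suc (suc p)) a)) (≤-trans (n≤1+n _) (proj₁ (∈-iota⁻ j _ b)))))
      (Unique.map⁺ (λ {s} {t} e → double-injective s t (suc-injective e)) (unique-iota 0 _)) disjoint)
      where
      disjoint : ∀ {i} → i ∈ evens′ → i ∉ odds′
      disjoint a b with ∈-map⁻ (2 *_) {xs = iota 0 (suc (suc p)) ++ iota j (suc q)} a | ∈-map⁻ odd {xs = iota 0 (suc n)} b
      ... | s , _ , refl | t , _ , e = even≢odd′ s t e
    size : length (1 ∷ is) ≡ suc (n + n)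
    size = trans (sym (Perm.↭-length shape)) (trans (List.length-++ evens′) (trans (cong₂ _+_
      (trans (List.length-map (2 *_) (iota 0 (suc (suc p)) ++ iota j (suc q))) (trans (List.length-++ (iota 0 (suc (suc p)))) (cong₂ _+_ (length-iota 0 (suc (suc p))) (length-iota j (suc q)))))
      (trans (List.length-map odd (iota 0 (suc n))) (length-iota 0 (suc n)))) (count p q)))
      where
      count : ∀ p q → suc (suc p) + suc q + suc (suc (suc (suc (p + q)))) ≡ suc (suc (suc (suc (p + q))) + suc (suc (suc (p + q))))
      count = solve-∀

module _ {V : Set} {R B : V → V → Set} {U : List V} (c : TwoColoured U R B) where
  open TwoColoured c

  -- If the chord (0, 2p + 4) were red, the crossing chords (1, 2p + 6) and (2n + 1, 2p + 2) would
  -- be blue, since a red one shortens the loop by exactly one vertex to 2n + 1. These two blue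
  -- chords are the links that `evenOddCycle` needs between the even and the odd vertices.
  noLongChord : ∀ p q → let n = suc (suc (suc (p + q))) in ¬ Cyc R (suc (n + n)) → ¬ Cyc B (suc (n + n)) →
    (ℓ : Loop R (suc (suc (n + n)))) → let open Loop ℓ in (∀ i → B (vertex i) (vertex (suc (suc i)))) →
    ¬ R (vertex 0) (vertex (2 * suc (suc p)))
  noLongChord p q noR noB ℓ two chord = noB (evenOddCycle B-sym vertex p q (window 0)
    (trans (cong vertex (length₁ (p + q))) (period 0)) two forward backward)
    where
    open Loop ℓ
    n : ℕ
    n = suc (suc (suc (p + q)))
    length₁ : ∀ m → 2 * suc (suc (suc (suc m))) ≡ suc (suc (suc (suc (suc m)) + suc (suc (suc m))))
    length₁ = solve-∀
    forward : B (vertex 1) (vertex (2 * suc (suc (suc p))))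
    forward = notRed-≡ (e₁ p) (s≤s z≤n) (linear 2 (λ p q → [] ⊢ 1+ (1+ (2 ⊛ 1+ (1+ p))) ⊑ 1+ (1+ (1+ (1+ (1+ (p ⊕ q))) ⊕ 1+ (1+ (1+ (p ⊕ q)))))) (p ∷ q ∷ []) [])
      λ r → noR (subst (Cyc R) (e₄ p q) (crossForward R-sym (2 * suc p) (suc (2 * q)) ℓ (e₅ p q)
        (subst (λ z → R (vertex 0) (vertex z)) (e₂ p) chord) (subst (λ z → R (vertex 1) (vertex z)) (e₃ p) r)))
      where
      notRed-≡ : ∀ {d k} → k ≡ 1 + d → 0 < d → d < suc (suc (n + n)) → ¬ R (vertex 1) (vertex k) → B (vertex 1) (vertex k)
      notRed-≡ {d} refl l u = notRed c ℓ 1 d l u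
      e₁ : ∀ p → 2 * suc (suc (suc p)) ≡ 1 + suc (2 * suc (suc p))
      e₁ = solve-∀
      e₂ : ∀ p → 2 * suc (suc p) ≡ 2 * suc p + 2
      e₂ = solve-∀
      e₃ : ∀ p → 2 * suc (suc (suc p)) ≡ 2 * suc p + 4
      e₃ = solve-∀
      e₄ : ∀ p q → suc (2 * q) + (2 * suc p + 4) ≡ suc (suc (suc (suc (p + q))) + suc (suc (suc (p + q))))
      e₄ = solve-∀
      e₅ : ∀ p q → suc (suc (suc (suc (suc (p + q))) + suc (suc (suc (p + q))))) ≡ suc (2 * q) + suc (2 * suc p + 4)
      e₅ = solve-∀
    backward : B (vertex (suc (2 * n))) (vertex (2 * suc p))
    backward = B-sym (subst (λ z → B (vertex (2 * suc p)) (vertex z)) (sym (e₁ p q)) (notRed c ℓ (2 * suc p) (suc (2 * suc (suc q))) (s≤s z≤n)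
      (linear 2 (λ p q → [] ⊢ 1+ (1+ (2 ⊛ 1+ (1+ q))) ⊑ 1+ (1+ (1+ (1+ (1+ (p ⊕ q))) ⊕ 1+ (1+ (1+ (p ⊕ q)))))) (p ∷ q ∷ []) [])
      λ r → noR (subst (Cyc R) (e₄ p q) (crossBackward R-sym (suc (2 * p)) (suc (2 * q)) ℓ (e₅ p q)
        (subst (λ z → R (vertex 0) (vertex z)) (e₂ p) chord) (R-sym (subst₂ (λ x y → R (vertex x) (vertex y)) (e₃ p) (e₆ p q) r))))))
      where
      e₁ : ∀ p q → suc (2 * suc (suc (suc (p + q)))) ≡ 2 * suc p + suc (2 * suc (suc q))
      e₁ = solve-∀
      e₂ : ∀ p → 2 * suc (suc p) ≡ suc (suc (2 * p)) + 2
      e₂ = solve-∀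
      e₃ : ∀ p → 2 * suc p ≡ suc (2 * p) + 1
      e₃ = solve-∀
      e₄ : ∀ p q → suc (2 * q) + (suc (suc (2 * p)) + 4) ≡ suc (suc (suc (suc (p + q))) + suc (suc (suc (p + q))))
      e₄ = solve-∀
      e₅ : ∀ p q → suc (suc (suc (suc (suc (p + q))) + suc (suc (suc (p + q))))) ≡ suc (2 * q) + suc (suc (suc (2 * p)) + 4)
      e₅ = solve-∀
      e₆ : ∀ p q → 2 * suc p + suc (2 * suc (suc q)) ≡ suc (suc (2 * q)) + suc (suc (suc (2 * p)) + 2)
      e₆ = solve-∀

  evenChords : ∀ {n} → 1 ≤ n → ¬ Cyc R (suc (n + n)) → ¬ Cyc B (suc (n + n)) →
    (ℓ : Loop R (suc (suc (n + n)))) → let open Loop ℓ in ∀ i j → 1 ≤ j → j ≤ n → B (vertex i) (vertex (i + 2 * j))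
  evenChords {n@(suc n′)} _ noR noB ℓ i j 1≤j j≤n = byCases j 1≤j (m≤n⇒m<n∨m≡n j≤n)
    where
    open Loop ℓ
    two : ∀ i → B (vertex i) (vertex (i + 2))
    two i = notRed c ℓ i 2 (s≤s z≤n) (s≤s (s≤s (≤-trans (s≤s z≤n) (m≤n+m n n)))) λ r →
      noR (shortcut ℓ i 2 (n′ + n) refl (s≤s z≤n) r)
    byCases : ∀ j → 1 ≤ j → j < n ⊎ j ≡ n → B (vertex i) (vertex (i + 2 * j))
    -- On a loop of length 2n + 2, distance 2n is distance 2 the other way round.
    byCases j _ (inj₂ refl) = B-sym (subst (B (vertex (i + 2 * n))) (trans (cong vertex (e i n)) (period i)) (two (i + 2 * n)))
      where
      e : ∀ i n → i + 2 * n + 2 ≡ i + suc (suc (n + n))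
      e = solve-∀
    byCases (suc zero) _ _ = two i
    byCases (suc (suc p)) _ (inj₁ j<n) with m≤n⇒∃[o]m+o≡n j<n
    ... | q , refl = notRed c ℓ i (2 * suc (suc p)) (s≤s z≤n)
      (linear 2 (λ p q → [] ⊢ 1+ (2 ⊛ 1+ (1+ p)) ⊑ 1+ (1+ (1+ (1+ (1+ (p ⊕ q))) ⊕ 1+ (1+ (1+ (p ⊕ q)))))) (p ∷ q ∷ []) [])
      λ r → noLongChord p q noR noB (rotate ℓ i)
        (λ k → subst (λ z → B (vertex (i + k)) (vertex z)) (e i k) (two (i + k)))
        (subst (λ z → R (vertex z) (vertex (i + 2 * suc (suc p)))) (sym (+-identityʳ i)) r)
      where
      e : ∀ i k → i + k + 2 ≡ i + suc (suc k)
      e = solve-∀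

-- Two blue cliques, and the two-coloured theorem

Clique : ∀ {V : Set} → (V → V → Set) → List V → Set
Clique B xs = ∀ {u v} → u ∈ xs → v ∈ xs → u ≢ v → B u v

cliquePath : ∀ {V : Set} {B : V → V → Set} {a xs b} → Unique (a ∷ xs ++ b ∷ []) → Clique B (a ∷ xs ++ b ∷ []) → Path B a xs b
cliquePath {xs = []} u cl = edge (cl (here refl) (there (here refl)) λ e → ∉-unique u (here e))
cliquePath {xs = x ∷ xs} u@(_ ∷ u′) cl = cl (here refl) (there (here refl)) (λ e → ∉-unique u (here e)) ◅
  cliquePath u′ λ p q → cl (there p) (there q)

remove : ∀ {x : A} {xs} → x ∈ xs → Unique xs → ∃ λ ys → suc (length ys) ≡ length xs × Unique ys × x ∉ ys × ys ⊆ xs ×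
  (∀ {z} → z ∈ xs → z ≢ x → z ∈ ys)
remove x∈ u with extract x∈
... | ys , p with unique-↭ p u
... | u′@(_ ∷ uys) = ys , sym (Perm.↭-length p) , uys , ∉-unique u′ , Perm.∈-resp-↭ (↭-sym p) ∘ there , λ z∈ z≢x →
  case Perm.∈-resp-↭ p z∈ of λ { (here e) → contradiction e z≢x ; (there q) → q }

module _ {V : Set} {B : V → V → Set} (B-sym : ∀ {u v} → B u v → B v u) where

  -- All n + 1 vertices of `E` are traversed from e₁ to e₂, then n vertices of `O` from o₂ to o₁;
  -- within a clique any order of the vertices is a path.
  twoCliquesCycle : ∀ {n} {E O : List V} → 2 ≤ n → Unique E → Unique O → (∀ {u} → u ∈ E → u ∉ O) →
    length E ≡ suc n → n ≤ length O → Clique B E → Clique B O →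
    ∀ {e₁ e₂ o₁ o₂} → e₁ ∈ E → e₂ ∈ E → o₁ ∈ O → o₂ ∈ O → e₁ ≢ e₂ → o₁ ≢ o₂ → B e₁ o₁ → B e₂ o₂ → Cyc B (suc (n + n))
  twoCliquesCycle {suc zero} (s≤s ())
  twoCliquesCycle {n@(suc (suc m))} {E} {O} _ uE uO disj lE lO clE clO {e₁} {e₂} {o₁} {o₂} e₁∈ e₂∈ o₁∈ o₂∈ e≢ o≢ b₁ b₂
    with remove e₁∈ uE | remove o₁∈ uO
  ... | E₁ , lE₁ , uE₁ , e₁∉ , E₁⊆ , keepE | O₁ , lO₁ , uO₁ , o₁∉ , O₁⊆ , keepO
    with remove (keepE e₂∈ (e≢ ∘ sym)) uE₁ | chooseOther m uO₁ (keepO o₂∈ (o≢ ∘ sym)) (≤-pred (≤-trans lO (≤-reflexive (sym lO₁))))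
  ... | E₂ , lE₂ , uE₂ , e₂∉ , E₂⊆ , _ | choice O₂ uO₂ lO₂ O₂⊆ , o₂∉ = cyc size
    (subst Unique reassoc (unique-++ uEs uOs λ p q → disj (inE p) (inO q)))
    (cliquePath uEs (λ p q → clE (inE p) (inE q)) ▷ b₂ ◅
      (cliquePath uOs (λ p q → clO (inO p) (inO q)) ▷ edge (B-sym b₁)))
    where
    Es Os : List V
    Es = e₁ ∷ E₂ ++ e₂ ∷ []
    Os = o₂ ∷ O₂ ++ o₁ ∷ []
    reassoc : Es ++ Os ≡ e₁ ∷ E₂ ++ e₂ ∷ o₂ ∷ O₂ ++ o₁ ∷ []
    reassoc = cong (e₁ ∷_) (List.++-assoc E₂ (e₂ ∷ []) Os)
    snoc : ∀ (x y : V) xs → x ∷ y ∷ xs ↭ x ∷ xs ++ y ∷ []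
    snoc x y xs = prep x (Perm.++-comm (y ∷ []) xs)
    inE : Es ⊆ E
    inE p with Perm.∈-resp-↭ (↭-sym (snoc e₁ e₂ E₂)) p
    ... | here refl = e₁∈
    ... | there (here refl) = e₂∈
    ... | there (there q) = E₁⊆ (E₂⊆ q)
    inO : Os ⊆ O
    inO p with Perm.∈-resp-↭ (↭-sym (snoc o₂ o₁ O₂)) p
    ... | here refl = o₂∈
    ... | there (here refl) = o₁∈
    ... | there (there q) = O₁⊆ (O₂⊆ q)
    uEs : Unique Es
    uEs = unique-↭ (snoc e₁ e₂ E₂) (unique-∷ (λ { (here e) → e≢ e ; (there q) → e₁∉ (E₂⊆ q) }) (unique-∷ e₂∉ uE₂))
    uOs : Unique Os
    uOs = unique-↭ (snoc o₂ o₁ O₂) (unique-∷ (λ { (here e) → o≢ (sym e) ; (there q) → o₂∉ q }) (unique-∷ (o₁∉ ∘ O₂⊆) uO₂))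
    size : length (e₁ ∷ E₂ ++ e₂ ∷ o₂ ∷ O₂ ++ o₁ ∷ []) ≡ suc (n + n)
    size = trans (cong suc (trans (List.length-++ E₂) (cong₂ (λ x y → x + suc (suc y))
      (suc-injective (suc-injective (trans (cong suc lE₂) (trans lE₁ lE)))) (trans (List.length-++ O₂) (cong (_+ 1) lO₂))))) (count m)
      where
      count : ∀ m → suc (suc m + suc (suc (m + 1))) ≡ suc (suc (suc m) + suc (suc m))
      count = solve-∀

separate : ∀ {P Q : A → Set} (xs : List A) → (∀ {x} → x ∈ xs → P x ⊎ Q x) →
  ∃₂ λ ps qs → ps ++ qs ↭ xs × (∀ {x} → x ∈ ps → P x) × (∀ {x} → x ∈ qs → Q x)
separate [] _ = [] , [] , ↭-refl , (λ ()) , λ ()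
separate (x ∷ xs) f with separate xs (f ∘ there) | f (here refl)
... | ps , qs , c , p , q | inj₁ px = x ∷ ps , qs , prep x c , (λ { (here refl) → px ; (there y) → p y }) , q
... | ps , qs , c , p , q | inj₂ qx = ps , x ∷ qs , ↭-trans (Perm.shift x ps qs) (prep x c) , p , λ { (here refl) → qx ; (there y) → q y }

every : ∀ {P Q : A → Set} (xs : List A) → (∀ {x} → x ∈ xs → P x ⊎ Q x) →
  (∀ {x} → x ∈ xs → P x) ⊎ (∃ λ x → x ∈ xs × Q x)
every [] _ = inj₁ λ ()
every (x ∷ xs) f with f (here refl) | every xs (f ∘ there)
... | inj₂ q | _ = inj₂ (x , here refl , q)
... | inj₁ p | inj₂ (y , y∈ , q) = inj₂ (y , there y∈ , q)
... | inj₁ p | inj₁ ps = inj₁ λ { (here refl) → p ; (there y) → ps y }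

separate-unique : ∀ {xs ps qs : List A} → Unique xs → ps ++ qs ↭ xs →
  Unique ps × Unique qs × (∀ {x} → x ∈ ps → x ∉ qs) × ps ⊆ xs × qs ⊆ xs × length ps + length qs ≡ length xs
separate-unique {ps = ps} {qs} u c with unique-++⁻ ps (unique-↭ (↭-sym c) u)
... | ups , uqs , d = ups , uqs , d , Perm.∈-resp-↭ c ∘ ∈-++⁺ˡ , Perm.∈-resp-↭ c ∘ ∈-++⁺ʳ ps ,
  trans (sym (List.length-++ ps)) (Perm.↭-length c)

nonempty : ∀ {xs : List A} → 0 < length xs → ∃ λ x → x ∈ xs
nonempty {xs = x ∷ _} _ = x , here refl

another : ∀ {xs : List A} → Unique xs → 2 ≤ length xs → ∀ {x} → x ∈ xs → ∃ λ y → y ∈ xs × y ≢ x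
another u 2≤ x∈ with remove x∈ u
... | ys , l , _ , x∉ , ys⊆ , _ with nonempty {xs = ys} (≤-pred (≤-trans 2≤ (≤-reflexive (sym l))))
... | y , y∈ = y , ys⊆ y∈ , λ { refl → x∉ y∈ }

module _ {V : Set} (_≟_ : DecidableEquality V) where
  open import Data.List.Membership.DecPropositional _≟_ using (_∈?_)

  module _ {R B : V → V → Set} {U : List V} {n : ℕ} (c : TwoColoured U R B) (2≤n : 2 ≤ n) (uU : Unique U)
    (lU : length U ≡ n + n + suc (n + n)) (noR : ¬ Cyc R (suc (n + n))) (noB : ¬ Cyc B (suc (n + n))) where
    open TwoColoured c

    private
      1≤n : 1 ≤ n
      1≤n = ≤-trans (s≤s z≤n) 2≤n

    -- The vertices outside E ∪ O that are not entirely blue to O number at least n + 1, are blue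
    -- to E and red to each other; all their red neighbours in O coincide.
    redPairOfCliques : ∀ {E O} → Unique E → Unique O → (∀ {u} → u ∈ E → u ∉ O) → E ⊆ U → O ⊆ U →
      length E ≡ n → length O ≡ suc n → Clique B E → Clique B O → (∀ {u v} → u ∈ E → v ∈ O → R u v) → ⊥
    redPairOfCliques {E} {O} uE uO disj E⊆ O⊆ lE lO clE clO com = conclude
      (separate rest λ {y} y∈ → every O λ o∈ → [ inj₂ , inj₁ ]′ (total (rest⊆ y∈) (O⊆ o∈) λ { refl → rest∉O y∈ o∈ }))
      where
      splitting = separate U λ {x} _ → toSum (x ∈? (E ++ O))
      EO rest : List V
      EO = proj₁ splitting
      rest = proj₁ (proj₂ splitting)
      cover : EO ++ rest ↭ U
      cover = proj₁ (proj₂ (proj₂ splitting))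
      parts = separate-unique uU cover
      rest⊆ : rest ⊆ U
      rest⊆ = proj₁ (proj₂ (proj₂ (proj₂ (proj₂ parts))))
      rest∉ : ∀ {y} → y ∈ rest → y ∉ E ++ O
      rest∉ = proj₂ (proj₂ (proj₂ (proj₂ splitting)))
      rest∉E : ∀ {y} → y ∈ rest → y ∉ E
      rest∉E y∈ = rest∉ y∈ ∘ ∈-++⁺ˡ
      rest∉O : ∀ {y} → y ∈ rest → y ∉ O
      rest∉O y∈ = rest∉ y∈ ∘ ∈-++⁺ʳ E
      lEO : length EO ≤ suc (n + n)
      lEO = ≤-trans (⊆-length (proj₁ parts) (proj₁ (proj₂ (proj₂ (proj₂ splitting)))))
        (≤-reflexive (trans (List.length-++ E) (trans (cong₂ _+_ lE lO) (+-suc n n))))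
      lrest : n + n ≤ length rest
      lrest = linear 3 (λ a r n → a ⊑ 1+ (n ⊕ n) ∷ n ⊕ n ⊕ 1+ (n ⊕ n) ⊑ a ⊕ r ∷ [] ⊢ n ⊕ n ⊑ r)
        (length EO ∷ length rest ∷ n ∷ []) (lEO ∷ ≤-reflexive (trans (sym lU) (sym (proj₂ (proj₂ (proj₂ (proj₂ (proj₂ parts))))))) ∷ [])
      n≤O : n ≤ length O
      n≤O = ≤-trans (n≤1+n n) (≤-reflexive (sym lO))
      someO : ∃ λ o → o ∈ O
      someO = nonempty (≤-trans (s≤s z≤n) (≤-reflexive (sym lO)))
      someE : ∃ λ e → e ∈ E
      someE = nonempty (≤-trans 1≤n (≤-reflexive (sym lE)))
      conclude : (∃₂ λ P F → P ++ F ↭ rest × (∀ {y} → y ∈ P → ∀ {o} → o ∈ O → B y o) ×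
        (∀ {y} → y ∈ F → ∃ λ o → o ∈ O × R y o)) → ⊥
      conclude (P , F , PF , blueP , redF) with separate-unique (proj₁ (proj₂ parts)) PF
      ... | uP , uF , _ , P⊆ , F⊆ , lPF = final (nonempty {xs = F} (≤-trans (s≤s z≤n) n<F))
        where
        P<n : length P < n
        -- Otherwise P and `O` minus one vertex span a blue complete bipartite graph, and the vertex
        -- taken out of the blue clique `O` is an apex over it.
        P<n = ≰⇒> λ n≤P → case remove (proj₂ someO) uO of λ
          { (O′ , lO′ , uO′ , o∉ , O′⊆ , _) →
            let n≤O′ = ≤-reflexive (sym (suc-injective (trans lO′ lO)))
                o′ , o′∈ = nonempty {xs = O′} (≤-trans 1≤n n≤O′)
                p , p∈ = nonempty {xs = P} (≤-trans 1≤n n≤P)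
            in noB (apexCycle B-sym 1≤n uO′ uP (λ q p → rest∉O (P⊆ p) (O′⊆ q)) n≤O′ n≤P
                 (λ q p → B-sym (blueP p (O′⊆ q))) o∉ (λ p → rest∉O (P⊆ p) (proj₂ someO)) o′∈ p∈
                 (clO (proj₂ someO) (O′⊆ o′∈) (∉⇒≢ o∉ o′∈)) (B-sym (blueP p∈ (proj₂ someO)))) }
        n<F : suc n ≤ length F
        n<F = linear 4 (λ p f r n → 1+ p ⊑ n ∷ r ⊑ p ⊕ f ∷ n ⊕ n ⊑ r ∷ [] ⊢ 1+ n ⊑ f)
          (length P ∷ length F ∷ length rest ∷ n ∷ []) (P<n ∷ ≤-reflexive (sym lPF) ∷ lrest ∷ [])
        FE : ∀ {f e} → f ∈ F → e ∈ E → B f e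
        FE {f} {e} f∈ e∈ with total (rest⊆ (F⊆ f∈)) (E⊆ e∈) (λ { refl → rest∉E (F⊆ f∈) e∈ })
        ... | inj₂ b = b
        ... | inj₁ r with redF f∈
        ... | o , o∈ , r′ = contradiction (apexCycle R-sym 1≤n uE uO disj (≤-reflexive (sym lE)) n≤O com
          (rest∉E (F⊆ f∈)) (rest∉O (F⊆ f∈)) e∈ o∈ r r′) noR
        FF : ∀ {f f′} → f ∈ F → f′ ∈ F → f ≢ f′ → R f f′
        FF {f} {f′} f∈ f′∈ ne with total (rest⊆ (F⊆ f∈)) (rest⊆ (F⊆ f′∈)) ne
        ... | inj₁ r = r
        ... | inj₂ b with remove f∈ uF
        ... | F′ , lF′ , uF′ , f∉ , F′⊆ , keep = contradiction (apexCycle B-sym 1≤n uF′ uE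
          (λ p q → rest∉E (F⊆ (F′⊆ p)) q) (≤-pred (≤-trans n<F (≤-reflexive (sym lF′)))) (≤-reflexive (sym lE))
          (λ p q → FE (F′⊆ p) q) f∉ (rest∉E (F⊆ f∈)) (keep f′∈ (ne ∘ sym)) (proj₂ someE) b (FE f∈ (proj₂ someE))) noB
        sameRed : ∀ {f f′ o o′} → f ∈ F → f′ ∈ F → f ≢ f′ → o ∈ O → o′ ∈ O → R f o → R f′ o′ → o ≢ o′ → ⊥
        sameRed f∈ f′∈ ne o∈ o′∈ r r′ o≢ = noR (bridgeCycle R-sym 2≤n uE uO disj (≤-trans (≤-reflexive (sym lE)) (n≤1+n _)) n≤O com
          ne (rest∉E (F⊆ f∈)) (rest∉E (F⊆ f′∈)) (rest∉O (F⊆ f∈)) (rest∉O (F⊆ f′∈)) o≢ o∈ o′∈ (FF f∈ f′∈ ne) r r′)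
        -- A second vertex of F has a red neighbour in `O` that differs from `o` or from `o′`, so
        -- `sameRed` applies.
        oneRed : ∀ {f o o′} → f ∈ F → o ∈ O → o′ ∈ O → R f o → R f o′ → o ≢ o′ → ⊥
        oneRed {f} {o} {o′} f∈ o∈ o′∈ r r′ o≢ = second (another uF (≤-trans (s≤s 1≤n) n<F) f∈)
          where
          third : ∀ {f₂} → f₂ ∈ F → f₂ ≢ f → (∃ λ o → o ∈ O × R f₂ o) → ⊥
          third f₂∈ ne (o₂ , o₂∈ , r₂) = fourth (o₂ ≟ o)
            where
            fourth : Dec (o₂ ≡ o) → ⊥
            fourth (no o₂≢) = sameRed f₂∈ f∈ ne o₂∈ o∈ r₂ r o₂≢
            fourth (yes e) = sameRed f₂∈ f∈ ne o₂∈ o′∈ r₂ r′ λ e′ → o≢ (trans (sym e) e′)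
          second : (∃ λ f₂ → f₂ ∈ F × f₂ ≢ f) → ⊥
          second (f₂ , f₂∈ , ne) = third f₂∈ ne (redF f₂∈)
        -- Once the common red neighbour o* is taken out, F is blue to the rest of `O` and to `E`.
        -- One vertex of the blue clique `E` serves as the apex over this complete bipartite graph.
        final : (∃ λ f → f ∈ F) → ⊥
        final (f , f∈) with redF f∈
        ... | o* , o*∈ , r* with remove o*∈ uO | remove (proj₂ someE) uE
        ... | O′ , lO′ , uO′ , o*∉ , O′⊆ , _ | E′ , lE′ , uE′ , e∉ , E′⊆ , _ = noB (apexCycle B-sym 1≤n
          (unique-++ uE′ uO′ λ p q → disj (E′⊆ p) (O′⊆ q)) uF
          (λ p q → [ (λ a → rest∉E (F⊆ q) (E′⊆ a)) , (λ a → rest∉O (F⊆ q) (O′⊆ a)) ]′ (∈-++⁻ E′ p))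
          (≤-trans (≤-reflexive (sym (suc-injective (trans lO′ lO)))) (≤-trans (m≤n+m (length O′) (length E′)) (≤-reflexive (sym (List.length-++ E′)))))
          (≤-trans (n≤1+n n) n<F)
          (λ p q → [ (λ a → B-sym (FE q (E′⊆ a))) , (λ a → B-sym (FO q a)) ]′ (∈-++⁻ E′ p))
          (λ p → [ e∉ , (λ a → disj (proj₂ someE) (O′⊆ a)) ]′ (∈-++⁻ E′ p))
          (λ q → rest∉E (F⊆ q) (proj₂ someE)) (∈-++⁺ˡ (proj₂ e′)) f∈
          (clE (proj₂ someE) (E′⊆ (proj₂ e′)) (∉⇒≢ e∉ (proj₂ e′))) (B-sym (FE f∈ (proj₂ someE))))
          where
          e′ : ∃ λ e → e ∈ E′
          e′ = nonempty (≤-pred (≤-trans 2≤n (≤-reflexive (trans (sym lE) (sym lE′)))))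
          FO : ∀ {g o} → g ∈ F → o ∈ O′ → B g o
          FO {g} {o} g∈ o∈ with total (rest⊆ (F⊆ g∈)) (O⊆ (O′⊆ o∈)) (λ { refl → rest∉O (F⊆ g∈) (O′⊆ o∈) })
          ... | inj₂ b = b
          ... | inj₁ r = ⊥-elim (clash (g ≟ f) r)
            where
            clash : Dec (g ≡ f) → R g o → ⊥
            clash (no ne) r = sameRed g∈ f∈ ne (O′⊆ o∈) o*∈ r r* (∉⇒≢ o*∉ o∈ ∘ sym)
            clash (yes refl) r = oneRed f∈ (O′⊆ o∈) o*∈ r r* (∉⇒≢ o*∉ o∈ ∘ sym)

    -- Two disjoint blue edges between the cliques would close a blue cycle, so all blue edges there
    -- share one vertex. Deleting it leaves cliques of sizes n and n + 1 with only red edges between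
    -- them.
    noTwoCliques : ∀ {E O} → Unique E → Unique O → (∀ {u} → u ∈ E → u ∉ O) → E ⊆ U → O ⊆ U →
      length E ≡ suc n → length O ≡ suc n → Clique B E → Clique B O → ⊥
    noTwoCliques {E} {O} uE uO disj E⊆ O⊆ lE lO clE clO = noCentre
      (proj₂ (nonempty {xs = E} (≤-trans (s≤s z≤n) (≤-reflexive (sym lE)))))
      λ e∈ _ o∈ → [ id , (λ b → ⊥-elim (edgeCase e∈ o∈ b)) ]′ (colour₂ e∈ o∈)
      where
      colour₂ : ∀ {e o} → e ∈ E → o ∈ O → R e o ⊎ B e o
      colour₂ e∈ o∈ = total (E⊆ e∈) (O⊆ o∈) λ { refl → disj e∈ o∈ }
      disjointEdges : ∀ {e₁ e₂ o₁ o₂} → e₁ ∈ E → e₂ ∈ E → o₁ ∈ O → o₂ ∈ O → e₁ ≢ e₂ → o₁ ≢ o₂ → B e₁ o₁ → B e₂ o₂ → ⊥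
      disjointEdges a b c′ d p q r s = noB (twoCliquesCycle B-sym 2≤n uE uO disj lE (≤-trans (n≤1+n n) (≤-reflexive (sym lO))) clE clO a b c′ d p q r s)
      noCentre : ∀ {e₀} → e₀ ∈ E → ¬ (∀ {e} → e ∈ E → e ≢ e₀ → ∀ {o} → o ∈ O → R e o)
      noCentre e₀∈ red with remove e₀∈ uE
      ... | E′ , lE′ , uE′ , e₀∉ , E′⊆ , _ = redPairOfCliques uE′ uO (disj ∘ E′⊆) (E⊆ ∘ E′⊆) O⊆ (suc-injective (trans lE′ lE)) lO
        (λ p q → clE (E′⊆ p) (E′⊆ q)) clO λ p q → red (E′⊆ p) (λ { refl → e₀∉ p }) q
      noCentre′ : ∀ {o₀} → o₀ ∈ O → ¬ (∀ {o} → o ∈ O → o ≢ o₀ → ∀ {e} → e ∈ E → R e o)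
      noCentre′ o₀∈ red with remove o₀∈ uO
      ... | O′ , lO′ , uO′ , o₀∉ , O′⊆ , _ = redPairOfCliques uO′ uE (λ q p → disj p (O′⊆ q)) (O⊆ ∘ O′⊆) E⊆ (suc-injective (trans lO′ lO)) lE
        (λ p q → clO (O′⊆ p) (O′⊆ q)) clE λ q p → R-sym (red (O′⊆ q) (λ { refl → o₀∉ q }) p)
      edgeCase : ∀ {e₀ o₀} → e₀ ∈ E → o₀ ∈ O → B e₀ o₀ → ⊥
      edgeCase {e₀} {o₀} e₀∈ o₀∈ b₀ = noCentre e₀∈ λ {e} e∈ e≢ {o} o∈ → [ id , (λ b → ⊥-elim (secondEdge e∈ e≢ o∈ b)) ]′ (colour₂ e∈ o∈)
        where
        secondEdge : ∀ {e o} → e ∈ E → e ≢ e₀ → o ∈ O → B e o → ⊥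
        secondEdge {e} {o} e∈ e≢ o∈ b with o ≟ o₀
        ... | no o≢ = disjointEdges e∈ e₀∈ o∈ o₀∈ e≢ o≢ b b₀
        ... | yes refl = noCentre′ o∈ λ {o′} o′∈ o′≢ {e′} e′∈ → [ id , (λ b′ → ⊥-elim (third o′∈ o′≢ e′∈ b′)) ]′ (colour₂ e′∈ o′∈)
          where
          third : ∀ {o′ e′} → o′ ∈ O → o′ ≢ o → e′ ∈ E → B e′ o′ → ⊥
          third {o′} {e′} o′∈ o′≢ e′∈ b′ with e′ ≟ e₀
          ... | no e′≢ = disjointEdges e′∈ e₀∈ o′∈ o₀∈ e′≢ o′≢ b′ b₀
          ... | yes refl = disjointEdges e′∈ e∈ o′∈ o∈ (e≢ ∘ sym) o′≢ b′ b

    noEvenCycle : ¬ Cyc R (suc (suc (n + n)))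
    noEvenCycle C = noTwoCliques (uniqueClass 0 (s≤s z≤n)) (uniqueClass 1 ≤-refl) apart (inU 0) (inU 1) (size 0) (size 1) (clique 0) (clique 1)
      where
      ℓ = unroll C
      open Loop ℓ
      class : ℕ → List V
      class d = map (λ s → vertex (d + 2 * s)) (iota 0 (suc n))
      below : ∀ d {s} → d < 2 → s ∈ iota 0 (suc n) → d + 2 * s < suc (suc (n + n))
      below d {s} d<2 s∈ = linear 3 (λ d s n → 1+ d ⊑ # 2 ∷ 1+ s ⊑ 1+ n ∷ [] ⊢ 1+ (d ⊕ 2 ⊛ s) ⊑ 1+ (1+ (n ⊕ n)))
        (d ∷ s ∷ n ∷ []) (d<2 ∷ proj₂ (∈-iota⁻ 0 (suc n) s∈) ∷ [])
      uniqueClass : ∀ d → d < 2 → Unique (class d)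
      uniqueClass d d<2 = subst Unique (sym (List.map-∘ (iota 0 (suc n))))
        (unique-map (window 0) (Unique.map⁺ (λ {s} {t} e → double-injective s t (+-cancelˡ-≡ d _ _ e)) (unique-iota 0 (suc n)))
          λ p → case ∈-map⁻ (λ s → d + 2 * s) {xs = iota 0 (suc n)} p of λ { (s , s∈ , refl) → below d d<2 s∈ })
      apart : ∀ {u} → u ∈ class 0 → u ∉ class 1
      apart p q with ∈-map⁻ (λ s → vertex (0 + 2 * s)) {xs = iota 0 (suc n)} p | ∈-map⁻ (λ s → vertex (1 + 2 * s)) {xs = iota 0 (suc n)} q
      ... | s , s∈ , refl | t , t∈ , e = even≢odd′ s t (window 0 (below 0 (s≤s z≤n) s∈) (below 1 ≤-refl t∈) e)
      inU : ∀ d → class d ⊆ U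
      inU d p with ∈-map⁻ (λ s → vertex (d + 2 * s)) {xs = iota 0 (suc n)} p
      ... | s , _ , refl = R-in (adjacent (d + 2 * s))
      size : ∀ d → length (class d) ≡ suc n
      size d = trans (List.length-map (λ s → vertex (d + 2 * s)) (iota 0 (suc n))) (length-iota 0 (suc n))
      clique : ∀ d → Clique B (class d)
      clique d p q ne with ∈-map⁻ (λ s → vertex (d + 2 * s)) {xs = iota 0 (suc n)} p | ∈-map⁻ (λ s → vertex (d + 2 * s)) {xs = iota 0 (suc n)} q
      ... | s , s∈ , refl | t , t∈ , refl with ≤-total s t
      ... | inj₁ s≤t = forward s t s≤t (≤-pred (proj₂ (∈-iota⁻ 0 (suc n) t∈))) λ { refl → ne refl }
        where
        forward : ∀ s t → s ≤ t → t ≤ n → s ≢ t → B (vertex (d + 2 * s)) (vertex (d + 2 * t))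
        forward s t s≤t t≤n s≢t with m≤n⇒∃[o]m+o≡n s≤t
        ... | o , refl = subst (λ z → B (vertex (d + 2 * s)) (vertex z)) (e d s o)
          (evenChords c 1≤n noR noB ℓ (d + 2 * s) o (n≢0⇒n>0 λ { refl → s≢t (sym (+-identityʳ s)) }) (≤-trans (m≤n+m o s) t≤n))
          where
          e : ∀ d s o → d + 2 * s + 2 * o ≡ d + 2 * (s + o)
          e = solve-∀
      ... | inj₂ t≤s with m≤n⇒∃[o]m+o≡n t≤s
      ... | o , refl = B-sym (subst (λ z → B (vertex (d + 2 * t)) (vertex z)) (e d t o)
          (evenChords c 1≤n noR noB ℓ (d + 2 * t) o (n≢0⇒n>0 λ { refl → ne (cong (λ z → vertex (d + 2 * z)) (+-identityʳ t)) })
            (≤-trans (m≤n+m o t) (≤-pred (proj₂ (∈-iota⁻ 0 (suc n) s∈))))))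
          where
          e : ∀ d s o → d + 2 * s + 2 * o ≡ d + 2 * (s + o)
          e = solve-∀

  bondyErdős : ∀ {R B : V → V → Set} {U n} → TwoColoured U R B → 3 ≤ n → Unique U → length U ≡ n + n + suc (n + n) →
    ¬ Cyc R (suc (n + n)) → ¬ Cyc B (suc (n + n)) → ⊥
  bondyErdős c 3≤n uU lU noR noB = longCycle c 3≤n uU lU noR (noEvenCycle c 2≤n uU lU noR noB)
    noB (noEvenCycle (swapColours c) 2≤n uU lU noB noR)
    where 2≤n = ≤-trans (s≤s (s≤s z≤n)) 3≤n

-- Cycles through vertices joined to a path or to a multipartite graph

module _ {V : Set} {R : V → V → Set} where

  linked-take : ∀ m {xs} → Linked R xs → Linked R (take m xs)
  linked-take zero _ = []
  linked-take (suc m) [] = []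
  linked-take (suc m) [-] = subst (Linked R) (sym (cong (_ ∷_) (List.take-[] m))) [-]
  linked-take (suc zero) (r ∷ l) = [-]
  linked-take (suc (suc m)) (r ∷ l) = r ∷ linked-take (suc m) l

  path-linked : ∀ {a xs b} → Path R a xs b → Linked R (a ∷ xs ++ b ∷ [])
  path-linked (edge r) = r ∷ [-]
  path-linked (r ◅ p) = r ∷ path-linked p

  path-linked′ : ∀ {a xs b} → Path R a xs b → Linked R (a ∷ xs)
  path-linked′ (edge r) = [-]
  path-linked′ (r ◅ p) = r ∷ path-linked′ p

  linked-path : ∀ {u us z} → Linked R (u ∷ us) → (∀ {v} → v ∈ u ∷ us → R v z) → Path R u us z
  linked-path [-] end = edge (end (here refl))
  linked-path (r ∷ l) end = r ◅ linked-path l (end ∘ there)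

  weave : List V → List V → List V
  weave (x ∷ xs) (u ∷ us) = u ∷ x ∷ weave xs us
  weave _ us = us

  weave-↭ : ∀ xs us → length xs ≤ length us → weave xs us ↭ xs ++ us
  weave-↭ [] us _ = ↭-refl
  weave-↭ (x ∷ xs) (u ∷ us) (s≤s l) = ↭-trans (swap u x (weave-↭ xs us l)) (prep x (↭-sym (Perm.shift u xs us)))

  weavePath : (∀ {u v} → R u v → R v u) → ∀ {z} x xs us → length xs < length us → Linked R us →
    (∀ {y u} → y ∈ x ∷ xs → u ∈ us → R y u) → (∀ {u} → u ∈ us → R u z) → Path R x (weave xs us) z
  weavePath R-sym x [] (u ∷ us) _ l com end = com (here refl) (here refl) ◅ linked-path l end
  weavePath R-sym x (y ∷ xs) (u ∷ us@(_ ∷ _)) (s≤s lt) (_ ∷ l) com end =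
    com (here refl) (here refl) ◅ R-sym (com (there (here refl)) (here refl)) ◅
    weavePath R-sym y xs us lt l (λ p q → com (there p) (there q)) (end ∘ there)
  weavePath R-sym x (y ∷ xs) (u ∷ []) (s≤s ()) l com end

  -- Each vertex of `X` after the first is slipped between two path vertices, and the rest of the
  -- path is followed along its own edges, so parity is no obstacle; the first vertex of `X` closes
  -- the cycle. The path is cut to 2n + 1 - |X| vertices.
  weaveCycle : (∀ {u v} → R u v → R v u) → ∀ {n X us} → Unique X → Unique us → (∀ {x} → x ∈ X → x ∉ us) →
    1 ≤ length X → length X < n → suc (n + n) ≤ length X + length us → Linked R us →
    (∀ {x u} → x ∈ X → u ∈ us → R x u) → Cyc R (suc (n + n))
  weaveCycle R-sym {n} {x ∷ xs} {us} uX u disj _ X<n big l com = cyc size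
    (unique-↭ (↭-sym (prep x order)) (unique-++ uX (Unique.take⁺ m u) λ p q → disj p (∈-take m q)))
    (weavePath R-sym x xs us′ (≤-trans m> (≤-reflexive (sym lus′))) (linked-take m l) (λ p q → com p (∈-take m q))
      λ q → R-sym (com (here refl) (∈-take m q)))
    where
    m : ℕ
    m = n + n ∸ length xs
    us′ : List V
    us′ = take m us
    m+ : m + length xs ≡ n + n
    m+ = m∸n+n≡m (≤-trans (≤-trans (n≤1+n _) (<⇒≤ X<n)) (m≤m+n n n))
    lus′ : length us′ ≡ m
    lus′ = length-take m us (linear 4 (λ m x n u → m ⊕ x ⊑ n ⊕ n ∷ 1+ (n ⊕ n) ⊑ 1+ x ⊕ u ∷ [] ⊢ m ⊑ u)
      (m ∷ length xs ∷ n ∷ length us ∷ []) (≤-reflexive m+ ∷ big ∷ []))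
    m> : length xs < m
    m> = linear 3 (λ m x n → n ⊕ n ⊑ m ⊕ x ∷ 1+ (1+ x) ⊑ n ∷ [] ⊢ 1+ x ⊑ m) (m ∷ length xs ∷ n ∷ []) (≤-reflexive (sym m+) ∷ X<n ∷ [])
    order : weave xs us′ ↭ xs ++ us′
    order = weave-↭ xs us′ (<⇒≤ (≤-trans m> (≤-reflexive (sym lus′))))
    size : suc (length (weave xs us′)) ≡ suc (n + n)
    size = cong suc (trans (Perm.↭-length order) (trans (List.length-++ xs) (trans (cong (length xs +_) lus′) (trans (+-comm _ m) m+))))

module _ {V L : Set} (_≟_ : DecidableEquality V) (_≟ℓ_ : DecidableEquality L) (ℓ : V → L) where
  open import Data.List.Membership.DecPropositional _≟_ using (_∈?_)

  private
    -- Makes the join of `O` and `Y` one multipartite graph: the classes in `O` are kept, and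
    -- everything else becomes a single part.
    block : List V → V → Maybe L
    block O v with v ∈? O
    ... | yes _ = just (ℓ v)
    ... | no _ = nothing

    block-∈ : ∀ {O v} → v ∈ O → block O v ≡ just (ℓ v)
    block-∈ {O} {v} v∈ with v ∈? O
    ... | yes _ = refl
    ... | no v∉ = contradiction v∈ v∉

    block-∉ : ∀ {O v} → v ∉ O → block O v ≡ nothing
    block-∉ {O} {v} v∉ with v ∈? O
    ... | yes v∈ = contradiction v∈ v∉
    ... | no _ = refl

  joinCycle : ∀ {R : V → V → Set} {n} {O Y : List V} → (∀ {u v} → R u v → R v u) → 1 ≤ n → Unique O → Unique Y →
    (∀ {y} → y ∈ Y → y ∉ O) → n < length O → suc (n + n) ≤ length O + length Y →
    (∀ zs → Unique zs → zs ⊆ O → (∀ {u v} → u ∈ zs → v ∈ zs → ℓ u ≡ ℓ v) → length zs ≤ n) →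
    (∀ {u v} → u ∈ O → v ∈ O → ℓ u ≢ ℓ v → R u v) → (∀ {u y} → u ∈ O → y ∈ Y → R u y) → Cyc R (suc (n + n))
  joinCycle {R} {n} {O} {Y} R-sym 1≤n uO uY disj n<O big small adj com =
    multipartiteCycle (Maybe.≡-dec _≟ℓ_) (block O) U 1≤n (Unique.take⁺ (suc (n + n)) uOY)
      (length-take (suc (n + n)) (O ++ Y′) enough) smallU adjU
    where
    Y′ U : List V
    -- As a single part, `Y` may contribute at most n vertices. If it has more, n < |O| still
    -- provides 2n + 1 in all.
    Y′ = take n Y
    U = take (suc (n + n)) (O ++ Y′)
    uOY : Unique (O ++ Y′)
    uOY = unique-++ uO (Unique.take⁺ n uY) λ p q → disj (∈-take n q) p
    enough : suc (n + n) ≤ length (O ++ Y′)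
    enough = ≤-trans bound (≤-reflexive (sym (List.length-++ O)))
      where
      bound : suc (n + n) ≤ length O + length Y′
      bound with ≤-total n (length Y)
      ... | inj₁ n≤Y = linear 3 (λ n o y → 1+ n ⊑ o ∷ n ⊑ y ∷ [] ⊢ 1+ (n ⊕ n) ⊑ o ⊕ y) (n ∷ length O ∷ length Y′ ∷ [])
        (n<O ∷ ≤-reflexive (sym (length-take n Y n≤Y)) ∷ [])
      ... | inj₂ Y≤n = ≤-trans big (≤-reflexive (cong (length O +_) (sym (trans (List.length-take n Y) (m≥n⇒m⊓n≡n Y≤n)))))
    lY′ : length Y′ ≤ n
    lY′ = ≤-trans (≤-reflexive (List.length-take n Y)) (m⊓n≤m n (length Y))
    side : ∀ {u} → u ∈ U → u ∈ O ⊎ u ∈ Y′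
    side u∈ = ∈-++⁻ O (∈-take (suc (n + n)) u∈)
    smallU : ∀ zs → Unique zs → zs ⊆ U → (∀ {u v} → u ∈ zs → v ∈ zs → block O u ≡ block O v) → length zs ≤ n
    smallU [] _ _ _ = z≤n
    smallU zs@(z ∷ _) uzs sub same with z ∈? O
    ... | yes z∈ = small zs uzs inO λ p q → Maybe.just-injective (trans (sym (block-∈ (inO p))) (trans (same p q) (block-∈ (inO q))))
      where
      inO : zs ⊆ O
      inO {u} p with u ∈? O
      ... | yes u∈ = u∈
      ... | no u∉ = contradiction (trans (sym (block-∉ u∉)) (trans (same p (here refl)) (block-∈ z∈))) λ ()
    ... | no z∉ = ≤-trans (⊆-length uzs inY) lY′
      where
      inY : zs ⊆ Y′
      inY {u} p with side (sub p)
      ... | inj₂ q = q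
      ... | inj₁ q = contradiction (trans (sym (block-∈ q)) (trans (same p (here refl)) (block-∉ z∉))) λ ()
    adjU : ∀ {u v} → u ∈ U → v ∈ U → block O u ≢ block O v → R u v
    adjU {u} {v} u∈ v∈ ne with side u∈ | side v∈
    ... | inj₁ p | inj₁ q = adj p q λ e → ne (trans (block-∈ p) (trans (cong just e) (sym (block-∈ q))))
    ... | inj₁ p | inj₂ q = com p (∈-take n q)
    ... | inj₂ p | inj₁ q = R-sym (com q (∈-take n p))
    ... | inj₂ p | inj₂ q = contradiction (trans (block-∉ (disj (∈-take n p))) (sym (block-∉ (disj (∈-take n q))))) ne

-- The bound for one and for two colours

module _ {k N : ℕ} (c : EdgeColouring N k) where

  Edge : Fin k → Fin N → Fin N → Set
  Edge a u v = colour c u v ≡ a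

  Edge-sym : ∀ {a u v} → Edge a u v → Edge a v u
  Edge-sym {u = u} {v} e = trans (symm c v u) e

  record Config (n : ℕ) (K : List (Fin k)) (W : List (Fin N)) (X : Fin k → List (Fin N)) : Set where
    field
      uniqueW : Unique W
      palette : ∀ {u v} → u ∈ W → v ∈ W → u ≢ v → colour c u v ∈ K
      uniqueX : ∀ i → Unique (X i)
      smallX  : ∀ i → length (X i) < n
      awayX   : ∀ {i x} → x ∈ X i → x ∉ W
      joined  : ∀ {i x w} → x ∈ X i → w ∈ W → Edge i x w

  weight : (Fin k → List (Fin N)) → List (Fin k) → ℕ
  weight X K = sum (map (λ i → length (X i)) K)

  Bound : ℕ → ℕ → Set
  Bound n j = ∀ K → Unique K → length K ≡ j → ∀ W X → Config n K W X → length W + weight X K ≤ n * 2 ^ j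

  module _ {n : ℕ} (3≤n : 3 ≤ n) (none : ∀ a → ¬ Cyc (Edge a) (suc (n + n))) where
    open import Data.List.Membership.DecPropositional (Fin._≟_ {N}) using (_∈?_)

    private
      1≤n : 1 ≤ n
      1≤n = ≤-trans (s≤s z≤n) 3≤n

    bound-one : Bound n 1
    bound-one (r ∷ []) uK _ W X C = ≮⇒≥ λ big → none r (joinCycle Fin._≟_ Fin._≟_ id Edge-sym 1≤n uniqueW (uniqueX r)
        awayX (large big) (enough big) single adj (λ u∈ y∈ → Edge-sym (joined y∈ u∈)))
      where
      open Config C
      enough : n * 2 < length W + (length (X r) + 0) → suc (n + n) ≤ length W + length (X r)
      enough big = linear 3 (λ n w x → 1+ (2 ⊛ n) ⊑ w ⊕ (x ⊕ # 0) ∷ [] ⊢ 1+ (n ⊕ n) ⊑ w ⊕ x)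
        (n ∷ length W ∷ length (X r) ∷ []) (≤-trans (≤-reflexive (cong suc (*-comm 2 n))) big ∷ [])
      large : n * 2 < length W + (length (X r) + 0) → n < length W
      large big = linear 3 (λ n w x → 1+ (n ⊕ n) ⊑ w ⊕ x ∷ 1+ x ⊑ n ∷ [] ⊢ 1+ n ⊑ w) (n ∷ length W ∷ length (X r) ∷ [])
        (enough big ∷ smallX r ∷ [])
      single : ∀ zs → Unique zs → zs ⊆ W → (∀ {u v} → u ∈ zs → v ∈ zs → id u ≡ id v) → length zs ≤ n
      single [] _ _ _ = z≤n
      single (z ∷ []) _ _ _ = 1≤n
      single (z ∷ z′ ∷ _) u _ same = contradiction (here (same (here refl) (there (here refl)))) (∉-unique u)
      adj : ∀ {u v} → u ∈ W → v ∈ W → u ≢ v → Edge r u v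
      adj u∈ v∈ ne with palette u∈ v∈ ne
      ... | here e = e

    -- With one of the two joined sets empty, the inside of the other is filled with the colour
    -- in which it has no outside neighbours; no cycle of the required length can use the filling.
    fill : ∀ {K W X} r b → Config n K W X → (∀ {i} → i ∈ K → i ≡ r ⊎ i ≡ b) → r ≢ b →
      n + n + suc (n + n) ≤ length W + length (X b) → ⊥
    fill {K} {W} {X} r b C only r≢b big = bondyErdős Fin._≟_ coloured 3≤n uU lU noR (λ C → none b (mapCycle (proj₂ ∘ proj₂) C))
      where
      open Config C
      L : ℕ
      L = n + n + suc (n + n)
      U : List (Fin N)
      U = take L (W ++ X b)
      R B : Fin N → Fin N → Set
      R u v = u ∈ U × v ∈ U × (Edge r u v ⊎ (u ∈ X b × v ∈ X b))
      B u v = u ∈ U × v ∈ U × Edge b u v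
      uU : Unique U
      uU = Unique.take⁺ L (unique-++ uniqueW (uniqueX b) λ p q → awayX q p)
      lU : length U ≡ L
      lU = length-take L (W ++ X b) (≤-trans big (≤-reflexive (sym (List.length-++ W))))
      side : ∀ {u} → u ∈ U → u ∈ W ⊎ u ∈ X b
      side u∈ = ∈-++⁻ W (∈-take L u∈)
      coloured : TwoColoured U R B
      coloured = record
        { R-sym = λ (u , v , e) → v , u , [ inj₁ ∘ Edge-sym , (λ (x , y) → inj₂ (y , x)) ]′ e
        ; B-sym = λ (u , v , e) → v , u , Edge-sym e
        ; R-in = proj₁
        ; B-in = proj₁
        ; total = total
        }
        where
        total : ∀ {u v} → u ∈ U → v ∈ U → u ≢ v → R u v ⊎ B u v
        total u∈ v∈ ne with side u∈ | side v∈
        ... | inj₂ p | inj₂ q = inj₁ (u∈ , v∈ , inj₂ (p , q))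
        ... | inj₂ p | inj₁ q = inj₂ (u∈ , v∈ , joined p q)
        ... | inj₁ p | inj₂ q = inj₂ (u∈ , v∈ , Edge-sym (joined q p))
        ... | inj₁ p | inj₁ q with only (palette p q ne)
        ... | inj₁ e = inj₁ (u∈ , v∈ , inj₁ e)
        ... | inj₂ e = inj₂ (u∈ , v∈ , e)
      -- Edges from `X b` to `W` have colour b ≠ r, so a red cycle meeting `X b` lies inside it, and
      -- fewer than n vertices cannot hold it.
      stay : ∀ {u v} → R u v → u ∈ X b → v ∈ X b
      stay (_ , _ , inj₂ (_ , q)) _ = q
      stay (_ , v∈ , inj₁ e) p with side v∈
      ... | inj₁ q = contradiction (trans (sym e) (joined p q)) r≢b
      ... | inj₂ q = q
      inside : ∀ {a xs z} → Path R a xs z → a ∈ X b → xs ⊆ X b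
      inside (e ◅ p) a∈ (here refl) = stay e a∈
      inside (e ◅ p) a∈ (there q) = inside p (stay e a∈) q
      outside : ∀ {a xs z} → Path R a xs z → a ∉ X b → Path (Edge r) a xs z
      outside (edge (_ , _ , inj₁ e)) a∉ = edge e
      outside (edge (_ , _ , inj₂ (p , _))) a∉ = contradiction p a∉
      outside ((u∈ , v∈ , inj₁ e) ◅ p) a∉ = e ◅ outside p λ x∈ → a∉ (stay (v∈ , u∈ , inj₁ (Edge-sym e)) x∈)
      outside ((_ , _ , inj₂ (q , _)) ◅ p) a∉ = contradiction q a∉
      noR : ¬ Cyc R (suc (n + n))
      noR (cyc {a} {xs} l u p) with a ∈? X b
      ... | no a∉ = none r (cyc l u (outside p a∉))
      ... | yes a∈ = <⇒≱ (smallX b) (≤-trans (≤-trans (m≤n+m n (suc n)) (≤-reflexive (sym l)))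
        (⊆-length u λ { (here refl) → a∈ ; (there q) → inside p a∈ q }))

    -- If one joined set is empty, the other is absorbed by `fill`. If both are nonempty, a red and
    -- a blue path sharing their ends cover W; with `X r` and `X b` they count at least 4n + 3
    -- vertices, the two ends twice, so one path woven with its joined set reaches 2n + 1. If the
    -- covering cycle is monochromatic, it suffices with the set of its own colour.
    bound-two : Bound n 2
    bound-two (r ∷ b ∷ []) ((r≢b ∷ []) ∷ _) _ W X C = ≮⇒≥ λ big → split (enough big) (length (X r) ≤? 0) (length (X b) ≤? 0)
      where
      open Config C
      x y w : ℕ
      x = length (X r)
      y = length (X b)
      w = length W
      enough : n * 4 < w + (x + (y + 0)) → n + n + suc (n + n) ≤ w + x + y
      enough big = linear 4 (λ n w x y → 1+ (4 ⊛ n) ⊑ w ⊕ (x ⊕ (y ⊕ # 0)) ∷ [] ⊢ n ⊕ n ⊕ 1+ (n ⊕ n) ⊑ w ⊕ x ⊕ y)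
        (n ∷ w ∷ x ∷ y ∷ []) (≤-trans (≤-reflexive (cong suc (*-comm 4 n))) big ∷ [])
      only : ∀ {i} → i ∈ r ∷ b ∷ [] → i ≡ r ⊎ i ≡ b
      only (here e) = inj₁ e
      only (there (here e)) = inj₂ e
      flip : ∀ {i} → i ≡ r ⊎ i ≡ b → i ≡ b ⊎ i ≡ r
      flip = [ inj₂ , inj₁ ]′
      R : Fin k → Fin N → Fin N → Set
      R a u v = u ∈ W × v ∈ W × Edge a u v
      coloured : TwoColoured W (R r) (R b)
      coloured = record
        { R-sym = λ (u , v , e) → v , u , Edge-sym e ; B-sym = λ (u , v , e) → v , u , Edge-sym e
        ; R-in = proj₁ ; B-in = proj₁
        ; total = λ u v ne → [ (λ e → inj₁ (u , v , e)) , (λ e → inj₂ (u , v , e)) ]′ (only (palette u v ne)) }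
      finish : ∀ a us → Unique us → us ⊆ W → Linked (R a) us → 1 ≤ length (X a) → suc (n + n) ≤ length (X a) + length us → ⊥
      finish a us u sub l 1≤ big = none a (weaveCycle Edge-sym (uniqueX a) u (λ p q → awayX p (sub q)) 1≤ (smallX a) big
        (edges l) (λ p q → joined p (sub q)))
        where
        edges : ∀ {us} → Linked (R a) us → Linked (Edge a) us
        edges [] = []
        edges [-] = [-]
        edges ((_ , _ , e) ∷ l) = e ∷ edges l
      arcCase : n + n + suc (n + n) ≤ w + x + y → 1 ≤ x → 1 ≤ y → TwoArcs (R r) (R b) W → ⊥
      arcCase big 1≤x 1≤y (inj₁ (mono {a} {z} {zs} e p cover)) = finish r (a ∷ z ∷ zs) (unique-↭ (↭-sym cover) uniqueW) (Perm.∈-resp-↭ cover)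
        (e ∷ path-linked′ p) 1≤x (linear 5 (λ n w x y l → n ⊕ n ⊕ 1+ (n ⊕ n) ⊑ w ⊕ x ⊕ y ∷ 1+ y ⊑ n ∷ w ⊑ l ∷ [] ⊢ 1+ (n ⊕ n) ⊑ x ⊕ l)
          (n ∷ w ∷ x ∷ y ∷ suc (suc (length zs)) ∷ []) (big ∷ smallX b ∷ ≤-reflexive (sym (Perm.↭-length cover)) ∷ []))
      arcCase big 1≤x 1≤y (inj₂ (inj₁ (mono {a} {z} {zs} e p cover))) = finish b (a ∷ z ∷ zs) (unique-↭ (↭-sym cover) uniqueW) (Perm.∈-resp-↭ cover)
        (e ∷ path-linked′ p) 1≤y (linear 5 (λ n w x y l → n ⊕ n ⊕ 1+ (n ⊕ n) ⊑ w ⊕ x ⊕ y ∷ 1+ x ⊑ n ∷ w ⊑ l ∷ [] ⊢ 1+ (n ⊕ n) ⊑ y ⊕ l)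
          (n ∷ w ∷ x ∷ y ∷ suc (suc (length zs)) ∷ []) (big ∷ smallX r ∷ ≤-reflexive (sym (Perm.↭-length cover)) ∷ []))
      arcCase big 1≤x 1≤y (inj₂ (inj₂ (arcs {a} {z} {ps} {qs} p q cover))) = byLength (suc (n + n) ≤? x + suc (suc (length ps)))
        where
        arc↭ : ∀ ps qs → (a ∷ ps ++ z ∷ []) ++ qs ↭ a ∷ z ∷ ps ++ qs
        arc↭ ps qs = ↭-trans (Perm.↭-reflexive (cong (a ∷_) (List.++-assoc ps (z ∷ []) qs))) (prep a (Perm.shift z ps qs))
        total : suc (suc (length ps + length qs)) ≡ w
        total = trans (cong (λ l → suc (suc l)) (sym (List.length-++ ps))) (Perm.↭-length cover)
        size : ∀ ps → suc (suc (length ps)) ≡ length (a ∷ ps ++ z ∷ [])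
        size ps = cong suc (trans (+-comm 1 _) (sym (List.length-++ ps)))
        use : ∀ i ps qs → Path (R i) a ps z → a ∷ z ∷ ps ++ qs ↭ W → 1 ≤ length (X i) → suc (n + n) ≤ length (X i) + suc (suc (length ps)) → ⊥
        use i ps qs p cover 1≤ l = finish i (a ∷ ps ++ z ∷ []) (proj₁ (unique-++⁻ (a ∷ ps ++ z ∷ []) (unique-↭ (↭-sym order) uniqueW)))
          (Perm.∈-resp-↭ order ∘ ∈-++⁺ˡ) (path-linked p) 1≤ (≤-trans l (≤-reflexive (cong (length (X i) +_) (size ps))))
          where
          order : (a ∷ ps ++ z ∷ []) ++ qs ↭ W
          order = ↭-trans (arc↭ ps qs) cover
        byLength : Dec (suc (n + n) ≤ x + suc (suc (length ps))) → ⊥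
        byLength (yes l) = use r ps qs p cover 1≤x l
        byLength (no l) = use b qs ps q (↭-trans (prep a (prep z (Perm.++-comm qs ps))) cover) 1≤y
          (linear 6 (λ n w x y p q → n ⊕ n ⊕ 1+ (n ⊕ n) ⊑ w ⊕ x ⊕ y ∷ 1+ (x ⊕ 1+ (1+ p)) ⊑ 1+ (n ⊕ n) ∷ w ⊑ 1+ (1+ (p ⊕ q)) ∷ [] ⊢ 1+ (n ⊕ n) ⊑ y ⊕ 1+ (1+ q))
            (n ∷ w ∷ x ∷ y ∷ length ps ∷ length qs ∷ []) (big ∷ ≰⇒> l ∷ ≤-reflexive (sym total) ∷ []))
      split : n + n + suc (n + n) ≤ w + x + y → Dec (x ≤ 0) → Dec (y ≤ 0) → ⊥
      split big (yes x≤0) _ = fill r b C only r≢b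
        (linear 4 (λ n w x y → n ⊕ n ⊕ 1+ (n ⊕ n) ⊑ w ⊕ x ⊕ y ∷ x ⊑ # 0 ∷ [] ⊢ n ⊕ n ⊕ 1+ (n ⊕ n) ⊑ w ⊕ y) (n ∷ w ∷ x ∷ y ∷ []) (big ∷ x≤0 ∷ []))
      split big (no _) (yes y≤0) = fill b r C (flip ∘ only) (r≢b ∘ sym)
        (linear 4 (λ n w x y → n ⊕ n ⊕ 1+ (n ⊕ n) ⊑ w ⊕ x ⊕ y ∷ y ⊑ # 0 ∷ [] ⊢ n ⊕ n ⊕ 1+ (n ⊕ n) ⊑ w ⊕ x) (n ∷ w ∷ x ∷ y ∷ []) (big ∷ y≤0 ∷ []))
      split big (no x≰0) (no y≰0) = arcCase big (≰⇒> x≰0) (≰⇒> y≰0) (twoArcs coloured W uniqueW id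
        (linear 4 (λ n w x y → n ⊕ n ⊕ 1+ (n ⊕ n) ⊑ w ⊕ x ⊕ y ∷ 1+ x ⊑ n ∷ 1+ y ⊑ n ∷ # 3 ⊑ n ∷ [] ⊢ # 2 ⊑ w)
          (n ∷ w ∷ x ∷ y ∷ []) (big ∷ smallX r ∷ smallX b ∷ 3≤n ∷ [])))

-- Depth-first search

search : ∀ {P : A → Set} (P? : ∀ x → Dec (P x)) xs → (∃ λ x → x ∈ xs × P x) ⊎ (∀ {x} → x ∈ xs → ¬ P x)
search P? xs with every {P = λ x → ¬ _} xs (λ {x} _ → case P? x of λ { (yes p) → inj₂ p ; (no p) → inj₁ p })
... | inj₁ f = inj₂ f
... | inj₂ e = inj₁ e

module _ {V : Set} {R : V → V → Set} (R? : ∀ u v → Dec (R u v)) where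

  LongPath : List V → ℕ → Set
  LongPath W p = ∃ λ us → Linked R us × Unique us × us ⊆ W × length us ≡ p

  Hole : List V → ℕ → ℕ → Set
  Hole W s t = ∃₂ λ S T → Unique S × Unique T × (∀ {x} → x ∈ S → x ∉ T) × S ⊆ W × T ⊆ W ×
    length S ≡ s × t ≤ length T × (∀ {x y} → x ∈ S → y ∈ T → ¬ R y x)

  -- Depth-first search keeps a stack U, which is a path, between the finished vertices S and the
  -- unvisited ones T; there is never an edge between S and T.
  depthFirst : ∀ {W} s t p → Unique W → 1 ≤ t → 1 ≤ p → s + t + p ≤ suc (length W) → LongPath W p ⊎ Hole W s t
  -- The fuel bounds 2|T| + |U|: every vertex moves at most from T to U and from U to S, and each
  -- move costs one.
  depthFirst {W} s t p uW 1≤t 1≤p big = run (length W + length W) [] [] W ↭-refl [] (λ ()) z≤n z≤n (≤-reflexive (+-identityʳ _))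
    where
    run : ∀ fuel S U T → S ++ U ++ T ↭ W → Linked R U → (∀ {x y} → x ∈ S → y ∈ T → ¬ R y x) →
      length S ≤ s → length U ≤ p → length T + length T + length U ≤ fuel → LongPath W p ⊎ Hole W s t
    run fuel S U T cover l apart S≤ U≤ fuel≤ = go (m≤n⇒m<n∨m≡n U≤) (m≤n⇒m<n∨m≡n S≤)
      where
      uAll = unique-++⁻ S (unique-↭ (↭-sym cover) uW)
      uUT = unique-++⁻ U (proj₁ (proj₂ uAll))
      total : length S + (length U + length T) ≡ length W
      total = trans (cong (length S +_) (sym (List.length-++ U))) (trans (sym (List.length-++ S)) (Perm.↭-length cover))
      step : ∀ fuel U T → S ++ U ++ T ↭ W → Linked R U → (∀ {x y} → x ∈ S → y ∈ T → ¬ R y x) →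
        length U < p → length S < s → length T + length T + length U ≤ fuel →
        s + t + p ≤ suc (length S + (length U + length T)) → LongPath W p ⊎ Hole W s t
      step _ [] [] cover l apart U< S< _ tot = contradiction
        (linear 5 (λ s t p a w → # 1 ⊑ t ∷ # 1 ⊑ p ∷ 1+ a ⊑ s ∷ s ⊕ t ⊕ p ⊑ 1+ (a ⊕ # 0) ∷ [] ⊢ # 1 ⊑ # 0)
          (s ∷ t ∷ p ∷ length S ∷ 0 ∷ []) (1≤t ∷ 1≤p ∷ S< ∷ tot ∷ [])) λ ()
      step (suc fuel) [] (y ∷ T) cover l apart U< S< f≤ _ = run fuel S (y ∷ []) T cover [-] (λ p q → apart p (there q)) S≤ U<
        (linear 2 (λ t f → 1+ t ⊕ 1+ t ⊕ # 0 ⊑ 1+ f ∷ [] ⊢ t ⊕ t ⊕ # 1 ⊑ f) (length T ∷ fuel ∷ []) (f≤ ∷ []))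
      step (suc fuel) (u ∷ U) T cover l apart U< S< f≤ _ = next (search (λ y → R? y u) T)
        where
        next : (∃ λ y → y ∈ T × R y u) ⊎ (∀ {y} → y ∈ T → ¬ R y u) → LongPath W p ⊎ Hole W s t
        next (inj₂ none) = run fuel (u ∷ S) U T (↭-trans (↭-sym (Perm.shift u S (U ++ T))) cover) (tail l)
          (λ { (here refl) q → none q ; (there p) q → apart p q }) S< (<⇒≤ (≤-trans (n≤1+n _) U<))
          (linear 3 (λ t u f → t ⊕ t ⊕ 1+ u ⊑ 1+ f ∷ [] ⊢ t ⊕ t ⊕ u ⊑ f) (length T ∷ length U ∷ fuel ∷ []) (f≤ ∷ []))
          where
          tail : ∀ {x xs} → Linked R (x ∷ xs) → Linked R xs
          tail [-] = []
          tail (_ ∷ l) = l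
        next (inj₁ (y , y∈ , r)) = push (extract y∈)
          where
          push : (∃ λ T′ → T ↭ y ∷ T′) → LongPath W p ⊎ Hole W s t
          push (T′ , c) = run fuel S (y ∷ u ∷ U) T′
            (↭-trans (Perm.++⁺ˡ S (↭-trans (↭-sym (Perm.shift y (u ∷ U) T′)) (Perm.++⁺ˡ (u ∷ U) (↭-sym c)))) cover)
            (r ∷ l) (λ p q → apart p (Perm.∈-resp-↭ (↭-sym c) (there q))) S≤ U<
            (linear 4 (λ t t′ u f → t ⊕ t ⊕ 1+ u ⊑ 1+ f ∷ 1+ t′ ⊑ t ∷ [] ⊢ t′ ⊕ t′ ⊕ 1+ (1+ u) ⊑ f)
              (length T ∷ length T′ ∷ length U ∷ fuel ∷ []) (f≤ ∷ ≤-reflexive (sym (Perm.↭-length c)) ∷ []))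
      step zero [] (_ ∷ _) _ _ _ _ _ () _
      step zero (_ ∷ U) T _ _ _ _ _ f≤ _ = contradiction
        (linear 2 (λ t u → t ⊕ t ⊕ 1+ u ⊑ # 0 ∷ [] ⊢ # 1 ⊑ # 0) (length T ∷ length U ∷ []) (f≤ ∷ [])) λ ()
      go : length U < p ⊎ length U ≡ p → length S < s ⊎ length S ≡ s → LongPath W p ⊎ Hole W s t
      go (inj₂ e) _ = inj₁ (U , l , proj₁ uUT , Perm.∈-resp-↭ cover ∘ ∈-++⁺ʳ S ∘ ∈-++⁺ˡ , e)
      -- When S is full the stack has at most p - 1 vertices, so at least t vertices are still
      -- unvisited.
      go (inj₁ U<) (inj₂ e) = inj₂ (S , T , proj₁ uAll , proj₁ (proj₂ uUT) , (λ p q → proj₂ (proj₂ uAll) p (∈-++⁺ʳ U q)) ,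
        Perm.∈-resp-↭ cover ∘ ∈-++⁺ˡ , Perm.∈-resp-↭ cover ∘ ∈-++⁺ʳ S ∘ ∈-++⁺ʳ U , e ,
        linear 6 (λ s t p a u w → s ⊕ t ⊕ p ⊑ 1+ (a ⊕ (u ⊕ w)) ∷ 1+ u ⊑ p ∷ a ⊑ s ∷ [] ⊢ t ⊑ w)
          (s ∷ t ∷ p ∷ length S ∷ length U ∷ length T ∷ [])
          (≤-trans big (≤-reflexive (cong suc (sym total))) ∷ U< ∷ S≤ ∷ []) , apart)
      go (inj₁ U<) (inj₁ S<) = step fuel U T cover l apart U< S< fuel≤ (≤-trans big (≤-reflexive (cong suc (sym total))))

-- Gallai partitions all of whose parts have at most n vertices

record Blocks {k N : ℕ} (c : EdgeColouring N k) (r b : Fin k) (W : List (Fin N)) (ℓ : Fin N → Fin N) : Set where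
  field
    cross : ∀ {u v} → u ∈ W → v ∈ W → ℓ u ≢ ℓ v → Edge c r u v ⊎ Edge c b u v
    twins : ∀ {u u′ v} → u ∈ W → u′ ∈ W → v ∈ W → ℓ u ≡ ℓ u′ → ℓ u ≢ ℓ v → colour c u v ≡ colour c u′ v

swapBlocks : ∀ {k N} {c : EdgeColouring N k} {r b W ℓ} → Blocks c r b W ℓ → Blocks c b r W ℓ
swapBlocks bl = record { cross = λ u v ne → [ inj₂ , inj₁ ]′ (cross u v ne) ; twins = twins }
  where open Blocks bl

SmallClasses : ∀ {V : Set} → ℕ → List V → (V → V) → Set
SmallClasses n W ℓ = ∀ zs → Unique zs → zs ⊆ W → (∀ {u v} → u ∈ zs → v ∈ zs → ℓ u ≡ ℓ v) → length zs ≤ n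

module _ {k N n : ℕ} (c : EdgeColouring N k) (3≤n : 3 ≤ n) (none : ∀ a → ¬ Cyc (Edge c a) (suc (n + n)))
  {W : List (Fin N)} (uW : Unique W) {ℓ : Fin N → Fin N} (small : SmallClasses n W ℓ) where
  open import Data.List.Membership.DecPropositional (Fin._≟_ {N}) using (_∈?_)

  private
    1≤n : 1 ≤ n
    1≤n = ≤-trans (s≤s z≤n) 3≤n

    sym′ : ∀ {a u v} → Edge c a u v → Edge c a v u
    sym′ = Edge-sym c

  -- Vertices outside E ∪ O are red to all of E or to all of O, and each of the two sides so
  -- obtained has at most 2n vertices (3n if |E| = n).
  noBiclique : ∀ {r b} → Blocks c r b W ℓ → n + n + n + n + n < length W → ∀ {E O} → Unique E → Unique O →
    E ⊆ W → O ⊆ W → (∀ {w e} → w ∈ W → e ∈ E → ℓ w ≡ ℓ e → w ∈ E) → (∀ {w o} → w ∈ W → o ∈ O → ℓ w ≡ ℓ o → w ∈ O) →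
    (∀ {u} → u ∈ E → u ∉ O) → n ≤ length E → n < length O → (∀ {e o} → e ∈ E → o ∈ O → Edge c b e o) → ⊥
  noBiclique {r} {b} bl big {E} {O} uE uO E⊆ O⊆ closedE closedO disj n≤E n<O com =
    conclude (separate rest λ y∈ → every E λ e∈ → cross (rest⊆ y∈) (E⊆ e∈) (λ e → rest∉E y∈ (closedE (rest⊆ y∈) e∈ e)))
    where
    open Blocks bl
    splitting = separate W λ {x} _ → toSum (x ∈? (E ++ O))
    EO rest : List (Fin N)
    EO = proj₁ splitting
    rest = proj₁ (proj₂ splitting)
    parts = separate-unique uW (proj₁ (proj₂ (proj₂ splitting)))
    rest⊆ : rest ⊆ W
    rest⊆ = proj₁ (proj₂ (proj₂ (proj₂ (proj₂ parts))))
    rest∉ : ∀ {y} → y ∈ rest → y ∉ E ++ O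
    rest∉ = proj₂ (proj₂ (proj₂ (proj₂ splitting)))
    rest∉E : ∀ {y} → y ∈ rest → y ∉ E
    rest∉E y∈ = rest∉ y∈ ∘ ∈-++⁺ˡ
    rest∉O : ∀ {y} → y ∈ rest → y ∉ O
    rest∉O y∈ = rest∉ y∈ ∘ ∈-++⁺ʳ E
    lEO : length EO ≤ length E + length O
    lEO = ≤-trans (⊆-length (proj₁ parts) (proj₁ (proj₂ (proj₂ (proj₂ splitting))))) (≤-reflexive (List.length-++ E))
    lrest : length EO + length rest ≡ length W
    lrest = proj₂ (proj₂ (proj₂ (proj₂ (proj₂ parts))))
    -- A blue edge between two classes of `S` would make one of its ends an apex over the rest of
    -- `S` and `T`; that rest must have n vertices, hence n < |S|.
    redSide : ∀ {S T} → Unique S → Unique T → S ⊆ W → (∀ {u} → u ∈ S → u ∉ T) → n < length S → n ≤ length T →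
      (∀ {s t} → s ∈ S → t ∈ T → Edge c b s t) → ∀ {u v} → u ∈ S → v ∈ S → ℓ u ≢ ℓ v → Edge c r u v
    redSide {S} {T} uS uT S⊆ disj n<S n≤T com {u} {v} u∈ v∈ ne = byCross (cross (S⊆ u∈) (S⊆ v∈) ne)
      where
      byCross : Edge c r u v ⊎ Edge c b u v → Edge c r u v
      byCross (inj₁ e) = e
      byCross (inj₂ e) = ⊥-elim (apex (remove u∈ uS) (nonempty (≤-trans 1≤n n≤T)))
        where
        apex : _ → (∃ λ t → t ∈ T) → ⊥
        apex (S′ , lS′ , uS′ , u∉ , S′⊆ , keep) (t , t∈) = none b (apexCycle sym′ 1≤n uS′ uT (disj ∘ S′⊆)
          (≤-pred (≤-trans n<S (≤-reflexive (sym lS′)))) n≤T (λ p q → com (S′⊆ p) q) u∉ (disj u∈)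
          (keep v∈ λ { refl → ne refl }) t∈ e (com u∈ t∈))
    -- `S` is now red complete multipartite with parts of at most n vertices, and adding vertices
    -- joined to it in red keeps it so.
    sideBound : ∀ {S T} → Unique S → Unique T → S ⊆ W → (∀ {u} → u ∈ S → u ∉ T) → n < length S → n ≤ length T →
      (∀ {s t} → s ∈ S → t ∈ T → Edge c b s t) → ∀ {Y} → Unique Y → (∀ {y} → y ∈ Y → y ∉ S) →
      (∀ {y s} → y ∈ Y → s ∈ S → Edge c r y s) → length S + length Y ≤ n + n
    sideBound uS uT S⊆ disj n<S n≤T com uY disjY red = ≮⇒≥ λ long → none r (joinCycle Fin._≟_ Fin._≟_ ℓ sym′ 1≤n uS uY disjY n<S long
      (λ zs u sub → small zs u (S⊆ ∘ sub)) (redSide uS uT S⊆ disj n<S n≤T com) (λ s y → sym′ (red y s)))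
    conclude : (∃₂ λ P Q → P ++ Q ↭ rest × (∀ {y} → y ∈ P → ∀ {e} → e ∈ E → Edge c r y e) ×
      (∀ {y} → y ∈ Q → ∃ λ e → e ∈ E × Edge c b y e)) → ⊥
    conclude (P , Q , PQ , redP , blueQ) = count (separate-unique (proj₁ (proj₂ parts)) PQ)
      where
      count : Unique P × Unique Q × (∀ {x} → x ∈ P → x ∉ Q) × P ⊆ rest × Q ⊆ rest × length P + length Q ≡ length rest → ⊥
      count (uP , uQ , _ , P⊆ , Q⊆ , lPQ) = byE (suc n ≤? length E)
        where
        redQ : ∀ {y o} → y ∈ Q → o ∈ O → Edge c r y o
        redQ {y} {o} y∈ o∈ = byCross (cross (rest⊆ (Q⊆ y∈)) (O⊆ o∈) (λ e → rest∉O (Q⊆ y∈) (closedO (rest⊆ (Q⊆ y∈)) o∈ e))) (blueQ y∈)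
          where
          byCross : Edge c r y o ⊎ Edge c b y o → (∃ λ e → e ∈ E × Edge c b y e) → Edge c r y o
          byCross (inj₁ e) _ = e
          byCross (inj₂ e) (e′ , e′∈ , be) = ⊥-elim (none b (apexCycle sym′ 1≤n uE uO disj n≤E (<⇒≤ n<O) com
            (rest∉E (Q⊆ y∈)) (rest∉O (Q⊆ y∈)) e′∈ o∈ be e))
        OQ : length O + length Q ≤ n + n
        OQ = sideBound uO uE O⊆ (λ p q → disj q p) n<O n≤E (λ p q → sym′ (com q p)) uQ (λ p → rest∉O (Q⊆ p)) redQ
        byE : Dec (n < length E) → ⊥
        byE (yes n<E) = <⇒≱ big (linear 7 (λ n e o p q a w → e ⊕ p ⊑ n ⊕ n ∷ o ⊕ q ⊑ n ⊕ n ∷ a ⊑ e ⊕ o ∷ w ⊑ a ⊕ (p ⊕ q) ∷ [] ⊢ w ⊑ n ⊕ n ⊕ n ⊕ n ⊕ n)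
          (n ∷ length E ∷ length O ∷ length P ∷ length Q ∷ length EO ∷ length W ∷ [])
          (EP ∷ OQ ∷ lEO ∷ ≤-reflexive (trans (sym lrest) (cong (length EO +_) (sym lPQ))) ∷ []))
          where
          EP : length E + length P ≤ n + n
          EP = sideBound uE uO E⊆ disj n<E (<⇒≤ n<O) com uP (λ p → rest∉E (P⊆ p)) (λ p q → redP p q)
        -- With |E| = n an inner blue edge of E leaves only n - 1 vertices for the apex cycle, so E
        -- may fail to be red between its classes. Instead P, being red to E, is blue between its
        -- own classes as soon as |P| > n, and a blue multipartite graph has at most 2n vertices.
        byE (no n≮E) = <⇒≱ big (linear 7 (λ n e o p q a w → e ⊑ n ∷ p ⊑ n ⊕ n ∷ o ⊕ q ⊑ n ⊕ n ∷ a ⊑ e ⊕ o ∷ w ⊑ a ⊕ (p ⊕ q) ∷ [] ⊢ w ⊑ n ⊕ n ⊕ n ⊕ n ⊕ n)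
          (n ∷ length E ∷ length O ∷ length P ∷ length Q ∷ length EO ∷ length W ∷ [])
          (≮⇒≥ n≮E ∷ P≤ ∷ OQ ∷ lEO ∷ ≤-reflexive (trans (sym lrest) (cong (length EO +_) (sym lPQ))) ∷ []))
          where
          P≤ : length P ≤ n + n
          P≤ = ≮⇒≥ λ long → none b (joinCycle Fin._≟_ Fin._≟_ ℓ sym′ 1≤n uP [] (λ ()) (≤-trans (s≤s (m≤m+n n n)) long)
            (≤-trans long (m≤m+n _ _)) (λ zs u sub → small zs u (rest⊆ ∘ P⊆ ∘ sub)) (blueP (≤-trans (s≤s (m≤m+n n n)) long)) λ _ ())
            where
            blueP : n < length P → ∀ {u v} → u ∈ P → v ∈ P → ℓ u ≢ ℓ v → Edge c b u v
            blueP n<P {u} {v} u∈ v∈ ne = byCross (cross (rest⊆ (P⊆ u∈)) (rest⊆ (P⊆ v∈)) ne)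
              where
              byCross : Edge c r u v ⊎ Edge c b u v → Edge c b u v
              byCross (inj₂ e) = e
              byCross (inj₁ e) = ⊥-elim (apex (remove u∈ uP) (nonempty (≤-trans 1≤n n≤E)))
                where
                apex : _ → (∃ λ e → e ∈ E) → ⊥
                apex (P′ , lP′ , uP′ , u∉ , P′⊆ , keep) (e₁ , e₁∈) = none r (apexCycle sym′ 1≤n uP′ uE (λ p → rest∉E (P⊆ (P′⊆ p)))
                  (≤-pred (≤-trans n<P (≤-reflexive (sym lP′)))) n≤E (λ p q → redP (P′⊆ p) q) u∉ (rest∉E (P⊆ u∈))
                  (keep v∈ λ { refl → ne refl }) e₁∈ e (redP u∈ e₁∈))

module _ {k N n : ℕ} (c : EdgeColouring N k) (3≤n : 3 ≤ n) (none : ∀ a → ¬ Cyc (Edge c a) (suc (n + n)))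
  {W : List (Fin N)} (uW : Unique W) {ℓ : Fin N → Fin N} (small : SmallClasses n W ℓ) where
  open import Data.List.Membership.DecPropositional (Fin._≟_ {N}) using (_∈?_)

  private
    1≤n : 1 ≤ n
    1≤n = ≤-trans (s≤s z≤n) 3≤n

    sym′ : ∀ {a u v} → Edge c a u v → Edge c a v u
    sym′ = Edge-sym c

  -- If a class meets both S and T, then S ∪ T is blue complete multipartite: its parts are the
  -- classes meeting both sides and the remainders of S and of T.
  crossingClass : ∀ {r b} → Blocks c r b W ℓ → ∀ {S T} → Unique S → Unique T → S ⊆ W → T ⊆ W →
    (∀ {u} → u ∈ S → u ∉ T) → length S ≡ n → length T ≡ suc n → (∀ {s t} → s ∈ S → t ∈ T → ¬ Edge c r t s) →
    ∀ {s t} → s ∈ S → t ∈ T → ℓ s ≢ ℓ t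
  crossingClass {r} {b} bl {S} {T} uS uT S⊆ T⊆ disj lS lT noRed {s₀} {t₀} s₀∈ t₀∈ e₀ =
    none b (multipartiteCycle (Sum.≡-dec Fin._≟_ Bool._≟_) block (S ++ T) 1≤n (unique-++ uS uT disj)
      (trans (List.length-++ S) (trans (cong₂ _+_ lS lT) (+-suc n n))) smallBlock adj)
    where
    open Blocks bl
    Meets : Fin N → List (Fin N) → Set
    Meets u xs = ℓ u ∈ map ℓ xs
    Crossing : Fin N → Set
    Crossing u = Meets u S × Meets u T
    crossing? : ∀ u → Dec (Crossing u)
    crossing? u = (ℓ u ∈? map ℓ S) ×-dec (ℓ u ∈? map ℓ T)
    inS? : Fin N → Bool
    inS? u with u ∈? S
    ... | yes _ = true
    ... | no _ = false
    inS?-true : ∀ {u} → inS? u ≡ true → u ∈ S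
    inS?-true {u} e with u ∈? S
    inS?-true {u} e | yes p = p
    inS?-true {u} () | no _
    inS?-false : ∀ {u} → inS? u ≡ false → u ∉ S
    inS?-false {u} e with u ∈? S
    inS?-false {u} () | yes _
    inS?-false {u} e | no p = p
    block : Fin N → Fin N ⊎ Bool
    block u with crossing? u
    ... | yes _ = inj₁ (ℓ u)
    ... | no _ = inj₂ (inS? u)
    block-yes : ∀ {u} → Crossing u → block u ≡ inj₁ (ℓ u)
    block-yes {u} p with crossing? u
    ... | yes _ = refl
    ... | no ¬p = contradiction p ¬p
    block-no : ∀ {u} → ¬ Crossing u → block u ≡ inj₂ (inS? u)
    block-no {u} ¬p with crossing? u
    ... | yes p = contradiction p ¬p
    ... | no _ = refl
    block-inj₁ : ∀ {u l} → block u ≡ inj₁ l → Crossing u × ℓ u ≡ l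
    block-inj₁ {u} e with crossing? u
    ... | yes p = p , Sum.inj₁-injective e
    block-inj₂ : ∀ {u x} → block u ≡ inj₂ x → ¬ Crossing u × inS? u ≡ x
    block-inj₂ {u} e with crossing? u
    ... | no p = p , Sum.inj₂-injective e
    sub : (S ++ T) ⊆ W
    sub p = [ S⊆ , T⊆ ]′ (∈-++⁻ S p)
    smallBlock : ∀ zs → Unique zs → zs ⊆ (S ++ T) → (∀ {u v} → u ∈ zs → v ∈ zs → block u ≡ block v) → length zs ≤ n
    smallBlock [] _ _ _ = z≤n
    smallBlock zs@(z ∷ _) uzs zs⊆ same = byBlock (block z) refl
      where
      byBlock : ∀ l → block z ≡ l → length zs ≤ n
      byBlock (inj₁ l) e = small zs uzs (sub ∘ zs⊆) λ p q → trans (lab p) (sym (lab q))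
        where
        lab : ∀ {u} → u ∈ zs → ℓ u ≡ l
        lab p = proj₂ (block-inj₁ (trans (same p (here refl)) e))
      byBlock (inj₂ true) e = ≤-trans (⊆-length uzs λ p → inS?-true (proj₂ (block-inj₂ (trans (same p (here refl)) e)))) (≤-reflexive lS)
      -- T has n + 1 vertices, but t₀ lies in a crossing class, so the remainder of T has at most n.
      byBlock (inj₂ false) e = withoutT (remove t₀∈ uT)
        where
        withoutT : _ → length zs ≤ n
        withoutT (T′ , lT′ , _ , _ , _ , keep) = ≤-trans (⊆-length uzs inT′) (≤-reflexive (suc-injective (trans lT′ lT)))
          where
          inT′ : zs ⊆ T′
          inT′ {u} p with block-inj₂ (trans (same p (here refl)) e) | ∈-++⁻ S (zs⊆ p)
          ... | _ , f | inj₁ q = contradiction q (inS?-false f)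
          ... | ¬cr , _ | inj₂ q = keep q λ { refl → ¬cr (subst (_∈ map ℓ S) e₀ (∈-map⁺ ℓ s₀∈) , ∈-map⁺ ℓ t₀∈) }
    blue : ∀ {s t} → s ∈ S → t ∈ T → ℓ s ≢ ℓ t → Edge c b s t
    blue s∈ t∈ ne with cross (S⊆ s∈) (T⊆ t∈) ne
    ... | inj₁ e = contradiction (sym′ e) (noRed s∈ t∈)
    ... | inj₂ e = e
    adjLabels : ∀ {u v} → u ∈ S → v ∈ T → block u ≢ block v → ℓ u ≢ ℓ v
    adjLabels u∈ v∈ ne e = ne (trans (block-yes cu) (trans (cong inj₁ e) (sym (block-yes cv))))
      where
      cu = ∈-map⁺ ℓ u∈ , subst (_∈ map ℓ T) (sym e) (∈-map⁺ ℓ v∈)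
      cv = subst (_∈ map ℓ S) e (∈-map⁺ ℓ u∈) , ∈-map⁺ ℓ v∈
    labels : ∀ {u v} → Crossing u → block u ≢ block v → ℓ u ≢ ℓ v
    labels (p , q) ne e = ne (trans (block-yes (p , q)) (trans (cong inj₁ e)
      (sym (block-yes (subst (_∈ map ℓ S) e p , subst (_∈ map ℓ T) e q)))))
    -- A crossing u in S has a twin t in T, and the blue edge between v and t is copied to u.
    viaT : ∀ {u v} → u ∈ S → v ∈ S → Crossing u → block u ≢ block v → Edge c b u v
    viaT u∈ v∈ cr ne with ∈-map⁻ ℓ (proj₂ cr)
    ... | t , t∈ , e = trans (twins (S⊆ u∈) (T⊆ t∈) (S⊆ v∈) e (labels cr ne)) (sym′ (blue v∈ t∈ λ e′ → labels cr ne (trans e (sym e′))))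
    viaS : ∀ {u v} → u ∈ T → v ∈ T → Crossing u → block u ≢ block v → Edge c b u v
    viaS u∈ v∈ cr ne with ∈-map⁻ ℓ (proj₁ cr)
    ... | s , s∈ , e = trans (twins (T⊆ u∈) (S⊆ s∈) (T⊆ v∈) e (labels cr ne)) (blue s∈ v∈ λ e′ → labels cr ne (trans e e′))
    inS?-∈ : ∀ {u} → u ∈ S → inS? u ≡ true
    inS?-∈ {u} p with u ∈? S
    ... | yes _ = refl
    ... | no ¬p = contradiction p ¬p
    inS?-∉ : ∀ {u} → u ∉ S → inS? u ≡ false
    inS?-∉ {u} ¬p with u ∈? S
    ... | yes p = contradiction p ¬p
    ... | no _ = refl
    adj : ∀ {u v} → u ∈ S ++ T → v ∈ S ++ T → block u ≢ block v → Edge c b u v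
    adj {u} {v} u∈ v∈ ne = bySide (∈-++⁻ S u∈) (∈-++⁻ S v∈)
      where
      sameSide : ¬ Crossing u → ¬ Crossing v → inS? u ≢ inS? v
      sameSide ¬cu ¬cv e = ne (trans (block-no ¬cu) (trans (cong inj₂ e) (sym (block-no ¬cv))))
      bySide : u ∈ S ⊎ u ∈ T → v ∈ S ⊎ v ∈ T → Edge c b u v
      bySide (inj₁ p) (inj₂ q) = blue p q (adjLabels p q ne)
      bySide (inj₂ p) (inj₁ q) = sym′ (blue q p (adjLabels q p (ne ∘ sym)))
      bySide (inj₁ p) (inj₁ q) = go (crossing? u) (crossing? v)
        where
        go : Dec (Crossing u) → Dec (Crossing v) → Edge c b u v
        go (yes cu) _ = viaT p q cu ne
        go (no _) (yes cv) = sym′ (viaT q p cv (ne ∘ sym))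
        go (no ¬cu) (no ¬cv) = contradiction (trans (inS?-∈ p) (sym (inS?-∈ q))) (sameSide ¬cu ¬cv)
      bySide (inj₂ p) (inj₂ q) = go (crossing? u) (crossing? v)
        where
        go : Dec (Crossing u) → Dec (Crossing v) → Edge c b u v
        go (yes cu) _ = viaS p q cu ne
        go (no _) (yes cv) = sym′ (viaS q p cv (ne ∘ sym))
        go (no ¬cu) (no ¬cv) = contradiction (trans (inS?-∉ λ p′ → disj p′ p) (sym (inS?-∉ λ q′ → disj q′ q))) (sameSide ¬cu ¬cv)

  -- By `crossingClass` no class meets both sets, so each can be enlarged to the union of the
  -- classes it meets. Twins carry the blue edges along, and the two unions form the closed blue
  -- pair that `noBiclique` excludes.
  noHole : ∀ {r b} → Blocks c r b W ℓ → n + n + n + n + n < length W → ∀ {S T} → Unique S → Unique T → S ⊆ W → T ⊆ W →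
    (∀ {u} → u ∈ S → u ∉ T) → n ≤ length S → n < length T → ¬ (∀ {s t} → s ∈ S → t ∈ T → ¬ Edge c r t s)
  noHole {r} {b} bl big {S₁} {T₁} uS₁ uT₁ S⊆₁ T⊆₁ disj₁ lS₁ lT₁ noRed₁ =
    noBiclique c 3≤n none uW small bl big (proj₁ sepE) (proj₁ sepO) (sub E-parts) (sub O-parts) (closed E-parts) (closed O-parts)
      (λ p q → distinct p q)
      (≤-trans (≤-reflexive (sym lS)) (⊆-length uS λ p → keep E-parts S⊆ p))
      (≤-trans (≤-reflexive (sym lT)) (⊆-length uT λ p → keep O-parts T⊆ p)) com
    where
    open Blocks bl
    S T : List (Fin N)
    S = take n S₁
    T = take (suc n) T₁
    uS : Unique S
    uS = Unique.take⁺ n uS₁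
    uT : Unique T
    uT = Unique.take⁺ (suc n) uT₁
    lS : length S ≡ n
    lS = length-take n S₁ lS₁
    lT : length T ≡ suc n
    lT = length-take (suc n) T₁ lT₁
    S⊆ : S ⊆ W
    S⊆ = S⊆₁ ∘ ∈-take n
    T⊆ : T ⊆ W
    T⊆ = T⊆₁ ∘ ∈-take (suc n)
    noRed : ∀ {s t} → s ∈ S → t ∈ T → ¬ Edge c r t s
    noRed p q = noRed₁ (∈-take n p) (∈-take (suc n) q)
    ST≢ : ∀ {s t} → s ∈ S → t ∈ T → ℓ s ≢ ℓ t
    ST≢ = crossingClass bl uS uT S⊆ T⊆ (λ p q → disj₁ (∈-take n p) (∈-take (suc n) q)) lS lT noRed
    Closure : List (Fin N) → Set
    Closure xs = ∃₂ λ E E′ → E ++ E′ ↭ W × (∀ {x} → x ∈ E → ℓ x ∈ map ℓ xs) × (∀ {x} → x ∈ E′ → ℓ x ∉ map ℓ xs)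
    closure : ∀ xs → Closure xs
    closure xs = separate W λ {x} _ → toSum (ℓ x ∈? map ℓ xs)
    E-parts : Closure S
    E-parts = closure S
    O-parts : Closure T
    O-parts = closure T
    sepE = separate-unique uW (proj₁ (proj₂ (proj₂ E-parts)))
    sepO = separate-unique uW (proj₁ (proj₂ (proj₂ O-parts)))
    sub : ∀ {xs} (C : Closure xs) → proj₁ C ⊆ W
    sub (E , E′ , cov , _) = Perm.∈-resp-↭ cov ∘ ∈-++⁺ˡ
    member : ∀ {xs w} (C : Closure xs) → w ∈ W → ℓ w ∈ map ℓ xs → w ∈ proj₁ C
    member (E , E′ , cov , _ , out) w∈ e with ∈-++⁻ E (Perm.∈-resp-↭ (↭-sym cov) w∈)
    ... | inj₁ p = p
    ... | inj₂ q = contradiction e (out q)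
    closed : ∀ {xs w e} (C : Closure xs) → w ∈ W → e ∈ proj₁ C → ℓ w ≡ ℓ e → w ∈ proj₁ C
    closed {xs} C@(_ , _ , _ , inn , _) w∈ e∈ eq = member C w∈ (subst (_∈ map ℓ xs) (sym eq) (inn e∈))
    keep : ∀ {x xs} (C : Closure xs) → xs ⊆ W → x ∈ xs → x ∈ proj₁ C
    keep C xs⊆ p = member C (xs⊆ p) (∈-map⁺ ℓ p)
    represent : ∀ {xs e} (C : Closure xs) → e ∈ proj₁ C → ∃ λ s → s ∈ xs × ℓ e ≡ ℓ s
    represent (_ , _ , _ , inn , _) e∈ = ∈-map⁻ ℓ (inn e∈)
    labels : ∀ {e o} → e ∈ proj₁ E-parts → o ∈ proj₁ O-parts → ℓ e ≢ ℓ o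
    labels e∈ o∈ eq with represent E-parts e∈ | represent O-parts o∈
    ... | s , s∈ , es | t , t∈ , ot = ST≢ s∈ t∈ (trans (sym es) (trans eq ot))
    distinct : ∀ {u} → u ∈ proj₁ E-parts → u ∉ proj₁ O-parts
    distinct p q = labels p q refl
    com : ∀ {e o} → e ∈ proj₁ E-parts → o ∈ proj₁ O-parts → Edge c b e o
    com {e} {o} e∈ o∈ with represent E-parts e∈ | represent O-parts o∈
    ... | s , s∈ , es | t , t∈ , ot with cross (S⊆ s∈) (T⊆ t∈) (ST≢ s∈ t∈)
    ... | inj₁ red = contradiction (sym′ red) (noRed s∈ t∈)
    ... | inj₂ blue = trans (twins (sub E-parts e∈) (S⊆ s∈) (sub O-parts o∈) es (labels e∈ o∈))
      (sym′ (trans (twins (sub O-parts o∈) (T⊆ t∈) (S⊆ s∈) ot (λ eq → labels e∈ o∈ (trans es (sym eq)))) (sym′ blue)))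

module _ {k N n : ℕ} (c : EdgeColouring N k) (3≤n : 3 ≤ n) (none : ∀ a → ¬ Cyc (Edge c a) (suc (n + n)))
  {W : List (Fin N)} (uW : Unique W) {ℓ : Fin N → Fin N} (small : SmallClasses n W ℓ) where
  open import Data.List.Membership.DecPropositional (Fin._≟_ {N}) using (_∈?_)

  private
    1≤n : 1 ≤ n
    1≤n = ≤-trans (s≤s z≤n) 3≤n

    sym′ : ∀ {a u v} → Edge c a u v → Edge c a v u
    sym′ = Edge-sym c

    edge? : ∀ r u v → Dec (Edge c r u v)
    edge? r u v = colour c u v Fin.≟ r

  -- Two disjoint sets R₁, R₂ of n + 1 red neighbours of v, and a red path u avoiding them. Some
  -- segment uᵢ … uᵢ₊₂ₙ₋₃ has ends with red neighbours in different Rⱼ, for otherwise n vertices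
  -- of u have no red neighbour in R₁, or none in R₂.
  module Detour {r b} (bl : Blocks c r b W ℓ) (big : n + n + n + n + n + n + n + 2 ≤ length W)
    {v D} (v∈ : v ∈ W) (uD : Unique D) (D⊆ : D ⊆ W) (v∉ : v ∉ D) (red : ∀ {x} → x ∈ D → Edge c r v x)
    (lD : suc n + suc n ≤ length D) where

    big₅ : n + n + n + n + n < length W
    big₅ = linear 2 (λ n w → n ⊕ n ⊕ n ⊕ n ⊕ n ⊕ n ⊕ n ⊕ # 2 ⊑ w ∷ [] ⊢ 1+ (n ⊕ n ⊕ n ⊕ n ⊕ n) ⊑ w) (n ∷ length W ∷ []) (big ∷ [])

    R₁ R₂ D′ : List (Fin N)
    R₁ = take (suc n) D
    D′ = drop (suc n) D
    R₂ = take (suc n) D′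

    splitD : Unique R₁ × Unique D′ × (∀ {x} → x ∈ R₁ → x ∉ D′)
    splitD = unique-++⁻ R₁ (subst Unique (sym (List.take++drop≡id (suc n) D)) uD)

    R₁⊆ : R₁ ⊆ D
    R₁⊆ = ∈-take (suc n)

    R₂⊆ : R₂ ⊆ D
    R₂⊆ p = subst (_ ∈_) (List.take++drop≡id (suc n) D) (∈-++⁺ʳ R₁ (∈-take (suc n) p))

    R≢ : ∀ {x y} → x ∈ R₁ → y ∈ R₂ → x ≢ y
    R≢ p q refl = proj₂ (proj₂ splitD) p (∈-take (suc n) q)

    lR₁ : length R₁ ≡ suc n
    lR₁ = length-take (suc n) D (≤-trans (m≤m+n (suc n) (suc n)) lD)

    lD′ : length R₁ + length D′ ≡ length D
    lD′ = trans (sym (List.length-++ R₁)) (cong length (List.take++drop≡id (suc n) D))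

    lR₂ : length R₂ ≡ suc n
    lR₂ = length-take (suc n) D′ (+-cancelˡ-≤ (suc n) _ _ (≤-trans lD (≤-reflexive (trans (sym lD′) (cong (_+ length D′) lR₁)))))

    used Z : List (Fin N)
    used = v ∷ R₁ ++ R₂

    splitW = separate W λ {x} _ → toSum (x ∈? used)
    Z = proj₁ (proj₂ splitW)
    partsW = separate-unique {ps = proj₁ splitW} {qs = Z} uW (proj₁ (proj₂ (proj₂ splitW)))

    uZ : Unique Z
    uZ = proj₁ (proj₂ partsW)

    Z⊆ : Z ⊆ W
    Z⊆ = proj₁ (proj₂ (proj₂ (proj₂ (proj₂ partsW))))

    Z∉ : ∀ {x} → x ∈ Z → x ∉ used
    Z∉ = proj₂ (proj₂ (proj₂ (proj₂ splitW)))

    -- The path is to have 3n - 3 = n + (2n - 3) vertices: n starting positions, each with a partner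
    -- at distance 2n - 3.
    lZ : n + suc n + (n + n + n ∸ 3) ≤ suc (length Z)
    lZ = linear 5 (λ n w a z m → n ⊕ n ⊕ n ⊕ n ⊕ n ⊕ n ⊕ n ⊕ # 2 ⊑ w ∷ a ⊑ 1+ (1+ n ⊕ 1+ n) ∷ w ⊑ a ⊕ z ∷ m ⊕ # 3 ⊑ n ⊕ n ⊕ n ∷ [] ⊢ n ⊕ 1+ n ⊕ m ⊑ 1+ z)
      (n ∷ length W ∷ length (proj₁ splitW) ∷ length Z ∷ n + n + n ∸ 3 ∷ [])
      (big ∷ ≤-trans (⊆-length (proj₁ partsW) (proj₁ (proj₂ (proj₂ (proj₂ splitW))))) (≤-reflexive (cong suc (trans (List.length-++ R₁) (cong₂ _+_ lR₁ lR₂))))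
        ∷ ≤-reflexive (sym (proj₂ (proj₂ (proj₂ (proj₂ (proj₂ partsW))))))
        ∷ ≤-reflexive (m∸n+n≡m (≤-trans 3≤n (m≤n+m n (n + n)))) ∷ [])

    module Along {us} (linked : Linked (Edge c r) us) (uus : Unique us) (us⊆ : us ⊆ Z) (q : ℕ) (n≡ : 3 + q ≡ n)
      (lus : length us ≡ q + q + q + 6) where

      -- d = 2n - 3: the d + 1 path vertices from i to d + i, together with v, x and y, make 2n + 1.
      d : ℕ
      d = suc (suc (suc (q + q)))

      f : ℕ → Fin N
      f = at v us

      inj : InjectiveBelow f (length us)
      inj = at-injective v uus

      d≥n : n ≤ d
      d≥n = linear 2 (λ n q → n ⊑ # 3 ⊕ q ∷ [] ⊢ n ⊑ 1+ (1+ (1+ (q ⊕ q)))) (n ∷ q ∷ []) (≤-reflexive (sym n≡) ∷ [])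

      inside : ∀ {i} → i < n → d + i < length us
      inside {i} i<n = linear 4 (λ i q n l → 1+ i ⊑ n ∷ n ⊑ # 3 ⊕ q ∷ q ⊕ q ⊕ q ⊕ # 6 ⊑ l ∷ [] ⊢ 1+ (1+ (1+ (1+ (q ⊕ q))) ⊕ i) ⊑ l)
        (i ∷ q ∷ n ∷ length us ∷ []) (i<n ∷ ≤-reflexive (sym n≡) ∷ ≤-reflexive (sym lus) ∷ [])

      closeUp : ∀ {i x y} → i < n → x ∈ D → y ∈ D → x ∉ us → y ∉ us → x ≢ y → Edge c r x (f i) → Edge c r y (f (d + i)) → ⊥
      closeUp {i} {x} {y} i<n x∈ y∈ x∉ y∉ x≢y xe ye = none r (cyc
        (trans (sym (Perm.↭-length order)) (trans (cong (λ z → suc (suc (suc z))) (trans (List.length-map f (iota i (suc d))) (length-iota i (suc d))))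
          (trans (count q) (cong (λ z → suc (z + z)) n≡))))
        (unique-↭ order uniq)
        (red x∈ ◅ xe ◅ (along f (segmentPath {Q = λ i j → Edge c r (f i) (f j)} i (suc (suc (q + q)))
            (λ j i≤ j≤ → at-linked v linked (≤-trans (s≤s (s≤s j≤)) (≤-trans (≤-reflexive (arith i q)) (inside i<n))))) ▷
          subst (λ z → Edge c r (f z) y) (arith′ i q) (sym′ ye) ◅ edge (sym′ (red y∈)))))
        where
        arith : ∀ i q → suc (suc (suc (suc (q + q)) + i)) ≡ suc (suc (suc (suc (q + q))) + i)
        arith = solve-∀
        arith′ : ∀ i q → suc (suc (suc (q + q))) + i ≡ suc (suc (q + q)) + suc i
        arith′ = solve-∀
        count : ∀ q → suc (suc (suc (suc (suc (suc (suc (q + q))))))) ≡ suc (3 + q + (3 + q))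
        count = solve-∀
        seg : List (Fin N)
        seg = map f (iota i (suc d))
        order : v ∷ x ∷ y ∷ seg ↭ v ∷ x ∷ f i ∷ map f (iota (suc i) (suc (suc (q + q)))) ++ f (suc (suc (q + q)) + suc i) ∷ y ∷ []
        order = prep v (prep x (↭-trans (Perm.++-comm (y ∷ []) seg) (Perm.↭-reflexive (trans
          (cong (_++ y ∷ []) (cong (f i ∷_) (trans (cong (map f) (iota-∷ʳ (suc i) (suc (suc (q + q))))) (List.map-++ f (iota (suc i) (suc (suc (q + q)))) _))))
          (cong (f i ∷_) (List.++-assoc (map f (iota (suc i) (suc (suc (q + q))))) _ (y ∷ [])))))))
        below : ∀ {j} → j ∈ iota i (suc d) → j < length us
        below p = ≤-trans (proj₂ (∈-iota⁻ i (suc d) p)) (≤-trans (≤-reflexive (trans (+-suc i d) (cong suc (+-comm i d)))) (inside i<n))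
        seg⊆ : seg ⊆ us
        seg⊆ p with ∈-map⁻ f {xs = iota i (suc d)} p
        ... | j , j∈ , refl = at-∈ v us (below j∈)
        uniq : Unique (v ∷ x ∷ y ∷ seg)
        uniq = unique-∷ (λ { (here e) → v∉ (subst (_∈ D) (sym e) x∈) ; (there (here e)) → v∉ (subst (_∈ D) (sym e) y∈)
                           ; (there (there p)) → Z∉ (us⊆ (seg⊆ p)) (here refl) })
          (unique-∷ (λ { (here e) → x≢y e ; (there p) → x∉ (seg⊆ p) })
            (unique-∷ (y∉ ∘ seg⊆) (unique-map inj (unique-iota i (suc d)) below)))

      none₁ none₂ : ℕ → Set
      none₁ i = ∀ {x} → x ∈ R₁ → ¬ Edge c r x (f i)
      none₂ i = ∀ {x} → x ∈ R₂ → ¬ Edge c r x (f i)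

      Position : ℕ → ℕ → Set
      Position m e = e < m ⊎ (d ≤ e × e < d + m)

      weaken : ∀ {m e} → Position m e → Position (suc m) e
      weaken (inj₁ l) = inj₁ (m≤n⇒m≤1+n l)
      weaken {m} (inj₂ (g , l)) = inj₂ (g , ≤-trans l (+-monoʳ-≤ d (n≤1+n m)))

      record Collected (m : ℕ) : Set where
        field
          A₁ A₂   : List ℕ
          unique₁ : Unique A₁
          unique₂ : Unique A₂
          place₁  : ∀ {e} → e ∈ A₁ → Position m e
          place₂  : ∀ {e} → e ∈ A₂ → Position m e
          bad₁    : ∀ {e} → e ∈ A₁ → none₁ e
          bad₂    : ∀ {e} → e ∈ A₂ → none₂ e
          count   : m + m ≤ length A₁ + length A₂

      usedR : ∀ {x} → x ∈ R₁ ++ R₂ → x ∉ us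
      usedR x∈ p = Z∉ (us⊆ p) (there x∈)

      collect : ∀ m → m ≤ n → Collected m
      collect zero _ = record { A₁ = [] ; A₂ = [] ; unique₁ = [] ; unique₂ = [] ; place₁ = λ () ; place₂ = λ () ; bad₁ = λ () ; bad₂ = λ () ; count = z≤n }
      collect (suc m) m<n = extend (find R₁ m) (find R₂ m) (find R₁ (d + m)) (find R₂ (d + m))
        where
        open Collected (collect m (<⇒≤ m<n))
        find : ∀ R i → (∃ λ x → x ∈ R × Edge c r x (f i)) ⊎ (∀ {x} → x ∈ R → ¬ Edge c r x (f i))
        find R i = search (λ x → edge? r x (f i)) R
        fresh : ∀ {e} → Position m e → e ≢ m × e ≢ d + m
        fresh (inj₁ l) = <⇒≢ l , <⇒≢ (≤-trans l (m≤n+m m d))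
        fresh (inj₂ (g , l)) = (λ { refl → <⇒≱ m<n (≤-trans d≥n g) }) , <⇒≢ l
        m≢ : m ≢ d + m
        m≢ = <⇒≢ (m<n+m m (s≤s z≤n))
        here₁ : Position (suc m) m
        here₁ = inj₁ ≤-refl
        here₂ : Position (suc m) (d + m)
        here₂ = inj₂ (m≤m+n d m , ≤-reflexive (sym (+-suc d m)))
        one : ∀ {A} → Unique A → (∀ {e} → e ∈ A → Position m e) → ∀ {i} → i ≡ m ⊎ i ≡ d + m → Unique (i ∷ A)
        one u pl (inj₁ refl) = unique-∷ (λ p → proj₁ (fresh (pl p)) refl) u
        one u pl (inj₂ refl) = unique-∷ (λ p → proj₂ (fresh (pl p)) refl) u
        two : ∀ {A} → Unique A → (∀ {e} → e ∈ A → Position m e) → Unique (m ∷ d + m ∷ A)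
        two u pl = unique-∷ (λ { (here e) → m≢ e ; (there p) → proj₁ (fresh (pl p)) refl }) (one u pl (inj₂ refl))
        add : ∀ {A i} {P : ℕ → Set} → P i → (∀ {e} → e ∈ A → P e) → ∀ {e} → e ∈ i ∷ A → P e
        add pi f (here refl) = pi
        add pi f (there p) = f p
        twice : suc m + suc m ≤ suc (length A₁) + suc (length A₂)
        twice = linear 3 (λ m a b → m ⊕ m ⊑ a ⊕ b ∷ [] ⊢ 1+ m ⊕ 1+ m ⊑ 1+ a ⊕ 1+ b) (m ∷ length A₁ ∷ length A₂ ∷ []) (count ∷ [])
        twice₁ : suc m + suc m ≤ suc (suc (length A₁)) + length A₂
        twice₁ = linear 3 (λ m a b → m ⊕ m ⊑ a ⊕ b ∷ [] ⊢ 1+ m ⊕ 1+ m ⊑ 1+ (1+ a) ⊕ b) (m ∷ length A₁ ∷ length A₂ ∷ []) (count ∷ [])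
        twice₂ : suc m + suc m ≤ length A₁ + suc (suc (length A₂))
        twice₂ = linear 3 (λ m a b → m ⊕ m ⊑ a ⊕ b ∷ [] ⊢ 1+ m ⊕ 1+ m ⊑ a ⊕ 1+ (1+ b)) (m ∷ length A₁ ∷ length A₂ ∷ []) (count ∷ [])
        both₁ : none₁ m → none₁ (d + m) → Collected (suc m)
        both₁ p q = record { A₁ = m ∷ d + m ∷ A₁ ; A₂ = A₂ ; unique₁ = two unique₁ place₁ ; unique₂ = unique₂
          ; place₁ = add {P = Position (suc m)} here₁ (add {P = Position (suc m)} here₂ (weaken ∘ place₁)) ; place₂ = weaken ∘ place₂
          ; bad₁ = add {P = none₁} p (add {P = none₁} q bad₁) ; bad₂ = bad₂ ; count = twice₁ }
        both₂ : none₂ m → none₂ (d + m) → Collected (suc m)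
        both₂ p q = record { A₁ = A₁ ; A₂ = m ∷ d + m ∷ A₂ ; unique₁ = unique₁ ; unique₂ = two unique₂ place₂
          ; place₁ = weaken ∘ place₁ ; place₂ = add {P = Position (suc m)} here₁ (add {P = Position (suc m)} here₂ (weaken ∘ place₂))
          ; bad₁ = bad₁ ; bad₂ = add {P = none₂} p (add {P = none₂} q bad₂) ; count = twice₂ }
        each : ∀ {i} → i ≡ m ⊎ i ≡ d + m → Position (suc m) i → none₁ i → none₂ i → Collected (suc m)
        each {i} w pos p q = record { A₁ = i ∷ A₁ ; A₂ = i ∷ A₂ ; unique₁ = one unique₁ place₁ w ; unique₂ = one unique₂ place₂ w
          ; place₁ = add {P = Position (suc m)} pos (weaken ∘ place₁) ; place₂ = add {P = Position (suc m)} pos (weaken ∘ place₂)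
          ; bad₁ = add {P = none₁} p bad₁ ; bad₂ = add {P = none₂} q bad₂ ; count = twice }
        extend : (∃ λ x → x ∈ R₁ × Edge c r x (f m)) ⊎ none₁ m → (∃ λ x → x ∈ R₂ × Edge c r x (f m)) ⊎ none₂ m →
          (∃ λ x → x ∈ R₁ × Edge c r x (f (d + m))) ⊎ none₁ (d + m) → (∃ λ x → x ∈ R₂ × Edge c r x (f (d + m))) ⊎ none₂ (d + m) → Collected (suc m)
        extend (inj₁ (x , x∈ , xe)) _ _ (inj₁ (y , y∈ , ye)) = ⊥-elim (closeUp m<n (R₁⊆ x∈) (R₂⊆ y∈) (usedR (∈-++⁺ˡ x∈)) (usedR (∈-++⁺ʳ R₁ y∈)) (R≢ x∈ y∈) xe ye)
        extend _ (inj₁ (x , x∈ , xe)) (inj₁ (y , y∈ , ye)) _ = ⊥-elim (closeUp m<n (R₂⊆ x∈) (R₁⊆ y∈) (usedR (∈-++⁺ʳ R₁ x∈)) (usedR (∈-++⁺ˡ y∈)) (R≢ y∈ x∈ ∘ sym) xe ye)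
        extend (inj₂ p) (inj₂ q) _ _ = each (inj₁ refl) here₁ p q
        extend (inj₂ p) _ (inj₂ q) _ = both₁ p q
        extend _ (inj₂ p) _ (inj₂ q) = both₂ p q
        extend _ _ (inj₂ p) (inj₂ q) = each (inj₂ refl) here₂ p q

      contradict : ⊥
      contradict = byLength (n ≤? length A₁)
        where
        open Collected (collect n ≤-refl)
        range : ∀ {e} → Position n e → e < length us
        range (inj₁ l) = ≤-trans l (≤-trans (≤-trans d≥n (m≤m+n d 0)) (<⇒≤ (inside 1≤n)))
        range {e} (inj₂ (g , l)) = linear 5 (λ e q n l d → 1+ e ⊑ 1+ (1+ (1+ (q ⊕ q))) ⊕ n ∷ n ⊑ # 3 ⊕ q ∷ q ⊕ q ⊕ q ⊕ # 6 ⊑ l ∷ [] ⊢ 1+ e ⊑ l)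
          (e ∷ q ∷ n ∷ length us ∷ d ∷ []) (l ∷ ≤-reflexive (sym n≡) ∷ ≤-reflexive (sym lus) ∷ [])
        hole : ∀ A R → Unique A → (∀ {e} → e ∈ A → Position n e) → n ≤ length A → Unique R → R ⊆ W → R ⊆ (R₁ ++ R₂) → n < length R →
          (∀ {e} → e ∈ A → ∀ {x} → x ∈ R → ¬ Edge c r x (f e)) → ⊥
        hole A R uA place lA uR R⊆ R⊆′ lR bad = noHole c 3≤n none uW small bl big₅
          (unique-map inj uA (range ∘ place)) uR (Z⊆ ∘ us⊆ ∘ sub) R⊆ (λ p q → usedR (R⊆′ q) (sub p))
          (≤-trans lA (≤-reflexive (sym (List.length-map f A)))) lR
          λ p q e → case ∈-map⁻ f {xs = A} p of λ { (i , i∈ , refl) → bad i∈ q e }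
          where
          sub : map f A ⊆ us
          sub p with ∈-map⁻ f {xs = A} p
          ... | i , i∈ , refl = at-∈ v us (range (place i∈))
        byLength : Dec (n ≤ length A₁) → ⊥
        byLength (yes l) = hole A₁ R₁ unique₁ place₁ l (proj₁ splitD) (D⊆ ∘ R₁⊆) ∈-++⁺ˡ (≤-reflexive (sym lR₁)) (λ p q → bad₁ p q)
        byLength (no l) = hole A₂ R₂ unique₂ place₂
          (linear 3 (λ n a b → 1+ a ⊑ n ∷ n ⊕ n ⊑ a ⊕ b ∷ [] ⊢ n ⊑ b) (n ∷ length A₁ ∷ length A₂ ∷ []) (≰⇒> l ∷ count ∷ []))
          (Unique.take⁺ (suc n) (proj₁ (proj₂ splitD))) (D⊆ ∘ R₂⊆) (∈-++⁺ʳ R₁) (≤-reflexive (sym lR₂)) (λ p q → bad₂ p q)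

    detour : ⊥
    detour = use (depthFirst (edge? r) n (suc n) (n + n + n ∸ 3) uZ (s≤s z≤n) 1≤p lZ) (m≤n⇒∃[o]m+o≡n 3≤n)
      where
      1≤p : 1 ≤ n + n + n ∸ 3
      1≤p = linear 2 (λ n m → n ⊕ n ⊕ n ⊑ m ⊕ # 3 ∷ # 3 ⊑ n ∷ [] ⊢ # 1 ⊑ m) (n ∷ n + n + n ∸ 3 ∷ [])
        (≤-reflexive (sym (m∸n+n≡m (≤-trans 3≤n (m≤n+m n (n + n))))) ∷ 3≤n ∷ [])
      use : LongPath (edge? r) Z (n + n + n ∸ 3) ⊎ Hole (edge? r) Z n (suc n) → (∃ λ q → 3 + q ≡ n) → ⊥
      use (inj₂ (S , T , uS , uT , disj , S⊆ , T⊆ , lS , lT , noRed)) _ =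
        noHole c 3≤n none uW small bl big₅ uS uT (Z⊆ ∘ S⊆) (Z⊆ ∘ T⊆) disj (≤-reflexive (sym lS)) lT noRed
      use (inj₁ (us , l , uus , us⊆ , lus)) (q , n≡) = Along.contradict l uus us⊆ q n≡ (trans lus (trans (cong (λ z → z + z + z ∸ 3) (sym n≡)) (trans (cong (_∸ 3) (arith q)) (m+n∸n≡m _ 3))))
        where
        arith : ∀ q → 3 + q + (3 + q) + (3 + q) ≡ q + q + q + 6 + 3
        arith = solve-∀

-- Gives n 2^(3+j) ≥ 8n + nj. The j + 1 joined sets of the remaining colours take at most (n - 1)(j
-- + 1) of this, leaving W at least 7n + 2 vertices less those joined in red or blue.
2^-lower : ∀ j → suc (suc (suc (suc (suc (suc (suc (suc j))))))) ≤ 2 ^ (3 + j)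
2^-lower zero = ≤-refl
2^-lower (suc j) = linear 2 (λ j m → # 8 ⊕ j ⊑ m ∷ [] ⊢ # 9 ⊕ j ⊑ m ⊕ (m ⊕ # 0)) (j ∷ 2 ^ (3 + j) ∷ []) (2^-lower j ∷ [])

module _ {k N n : ℕ} (c : EdgeColouring N k) (3≤n : 3 ≤ n) (none : ∀ a → ¬ Cyc (Edge c a) (suc (n + n))) where

  weight-bound : ∀ X K → (∀ i → length (X i) < n) → weight c X K + length K ≤ n * length K
  weight-bound X [] small = z≤n
  weight-bound X (i ∷ K) small = ≤-trans
    (linear 5 (λ x s l n m → 1+ x ⊑ n ∷ s ⊕ l ⊑ m ∷ [] ⊢ x ⊕ s ⊕ 1+ l ⊑ n ⊕ m)
      (length (X i) ∷ weight c X K ∷ length K ∷ n ∷ n * length K ∷ []) (small i ∷ weight-bound X K small ∷ []))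
    (≤-reflexive (sym (*-suc n (length K))))

  -- If a vertex is joined to W in red, weaving `X r` into a red path of 2n vertices closes the
  -- cycle at once, and likewise in blue. Only when neither occurs is a vertex v of W itself used,
  -- and then |W| ≥ 7n + 2 makes room for `Detour`.
  bound-small : ∀ {r b K W X ℓ} j → length K ≡ suc j → Config c n (r ∷ b ∷ K) W X → Blocks c r b W ℓ → SmallClasses n W ℓ →
    length W + weight c X (r ∷ b ∷ K) ≤ n * 2 ^ (3 + j)
  bound-small {r} {b} {K} {W} {X} {ℓ} j lK C bl small = ≮⇒≥ λ big → byJoined big (length (X r) ≤? 0) (length (X b) ≤? 0)
    where
    open Config C
    w x y Σ′ M P : ℕ
    w = length W
    x = length (X r)
    y = length (X b)
    Σ′ = weight c X K
    M = n * 2 ^ (3 + j)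
    P = n * j
    sum≤ : Σ′ + suc j ≤ n + P
    sum≤ = ≤-trans (≤-reflexive (cong (Σ′ +_) (sym lK))) (≤-trans (weight-bound X K smallX) (≤-reflexive (trans (cong (n *_) lK) (*-suc n j))))
    M≥ : 8 * n + P ≤ M
    M≥ = ≤-trans (≤-reflexive (trans (cong (_+ P) (*-comm 8 n)) (sym (*-distribˡ-+ n 8 j)))) (*-monoʳ-≤ n (2^-lower j))
    Big : Set
    Big = M < w + (x + (y + Σ′))
    big₅ : Big → n + n + n + n + n < w
    big₅ big = linear 8 (λ n w x y s j m p → s ⊕ 1+ j ⊑ n ⊕ p ∷ 8 ⊛ n ⊕ p ⊑ m ∷ 1+ m ⊑ w ⊕ (x ⊕ (y ⊕ s)) ∷ 1+ x ⊑ n ∷ 1+ y ⊑ n ∷ [] ⊢ 1+ (n ⊕ n ⊕ n ⊕ n ⊕ n) ⊑ w)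
      (n ∷ w ∷ x ∷ y ∷ Σ′ ∷ j ∷ M ∷ P ∷ []) (sum≤ ∷ M≥ ∷ big ∷ smallX r ∷ smallX b ∷ [])
    big₇ : Big → x ≤ 0 → y ≤ 0 → n + n + n + n + n + n + n + 2 ≤ w
    big₇ big x≤ y≤ = linear 8 (λ n w x y s j m p → s ⊕ 1+ j ⊑ n ⊕ p ∷ 8 ⊛ n ⊕ p ⊑ m ∷ 1+ m ⊑ w ⊕ (x ⊕ (y ⊕ s)) ∷ x ⊑ # 0 ∷ y ⊑ # 0 ∷ [] ⊢ n ⊕ n ⊕ n ⊕ n ⊕ n ⊕ n ⊕ n ⊕ # 2 ⊑ w)
      (n ∷ w ∷ x ∷ y ∷ Σ′ ∷ j ∷ M ∷ P ∷ []) (sum≤ ∷ M≥ ∷ big ∷ x≤ ∷ y≤ ∷ [])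
    viaJoined : ∀ {r b} → Blocks c r b W ℓ → Big → 1 ≤ length (X r) → ⊥
    viaJoined {r} {b} bl big 1≤x = use (depthFirst (λ u v → colour c u v Fin.≟ r) n (suc n) (n + n) uniqueW (s≤s z≤n) 1≤2n
      (linear 2 (λ n w → 1+ (n ⊕ n ⊕ n ⊕ n ⊕ n) ⊑ w ∷ [] ⊢ n ⊕ 1+ n ⊕ (n ⊕ n) ⊑ 1+ w) (n ∷ w ∷ []) (big₅ big ∷ [])))
      where
      1≤2n : 1 ≤ n + n
      1≤2n = ≤-trans (s≤s z≤n) (≤-trans 3≤n (m≤m+n n n))
      use : LongPath (λ u v → colour c u v Fin.≟ r) W (n + n) ⊎ Hole (λ u v → colour c u v Fin.≟ r) W n (suc n) → ⊥
      use (inj₁ (us , l , u , us⊆ , lus)) = none r (weaveCycle (Edge-sym c) (uniqueX r) u (λ p q → awayX p (us⊆ q)) 1≤x (smallX r)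
        (+-mono-≤ 1≤x (≤-reflexive (sym lus))) l (λ p q → joined p (us⊆ q)))
      use (inj₂ (S , T , uS , uT , disj , S⊆ , T⊆ , lS , lT , noRed)) =
        noHole c 3≤n none uniqueW small bl (big₅ big) uS uT S⊆ T⊆ disj (≤-reflexive (sym lS)) lT noRed
    byJoined : Big → Dec (x ≤ 0) → Dec (y ≤ 0) → ⊥
    byJoined big (no x≰) _ = viaJoined bl big (≰⇒> x≰)
    byJoined big (yes _) (no y≰) = viaJoined (swapBlocks bl) big (≰⇒> y≰)
    byJoined big (yes x≤) (yes y≤) = start (nonempty {xs = W} (≤-trans (s≤s z≤n) (big₅ big)))
      where
      start : (∃ λ v → v ∈ W) → ⊥
      start (v , v∈) = neighbours (separate W λ {u} _ → toSum (ℓ v Fin.≟ ℓ u))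
        where
        neighbours : (∃₂ λ P Q → P ++ Q ↭ W × (∀ {u} → u ∈ P → ℓ v ≡ ℓ u) × (∀ {u} → u ∈ Q → ℓ v ≢ ℓ u)) → ⊥
        neighbours (P , Q , PQ , same , differ) = byColour (separate-unique uniqueW PQ)
          where
          byColour : Unique P × Unique Q × (∀ {u} → u ∈ P → u ∉ Q) × P ⊆ W × Q ⊆ W × length P + length Q ≡ w → ⊥
          byColour (uP , uQ , _ , P⊆ , Q⊆ , lPQ) = split (separate Q λ u∈ → Blocks.cross bl v∈ (Q⊆ u∈) (differ u∈))
            where
            lP : length P ≤ n
            lP = small P uP P⊆ λ p q → trans (sym (same p)) (same q)
            split : (∃₂ λ D E → D ++ E ↭ Q × (∀ {u} → u ∈ D → Edge c r v u) × (∀ {u} → u ∈ E → Edge c b v u)) → ⊥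
            split (D , E , DE , redD , blueE) = longer (separate-unique uQ DE)
              where
              longer : Unique D × Unique E × (∀ {u} → u ∈ D → u ∉ E) × D ⊆ Q × E ⊆ Q × length D + length E ≡ length Q → ⊥
              longer (uD , uE , _ , D⊆ , E⊆ , lDE) = byLength (suc n + suc n ≤? length D)
                where
                byLength : Dec (suc n + suc n ≤ length D) → ⊥
                byLength (yes l) = Detour.detour c 3≤n none uniqueW small bl (big₇ big x≤ y≤) v∈ uD (Q⊆ ∘ D⊆) (λ p → differ (D⊆ p) refl) redD l
                -- At least 6n + 2 vertices lie outside the part of v; if at most 2n + 1 of them are
                -- red neighbours, at least 4n + 1 are blue.
                byLength (no l) = Detour.detour c 3≤n none uniqueW small (swapBlocks bl) (big₇ big x≤ y≤) v∈ uE (Q⊆ ∘ E⊆) (λ p → differ (E⊆ p) refl) blueE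
                  (linear 6 (λ n w p q d e → n ⊕ n ⊕ n ⊕ n ⊕ n ⊕ n ⊕ n ⊕ # 2 ⊑ w ∷ w ⊑ p ⊕ q ∷ q ⊑ d ⊕ e ∷ p ⊑ n ∷ 1+ d ⊑ 1+ n ⊕ 1+ n ∷ # 3 ⊑ n ∷ [] ⊢ 1+ n ⊕ 1+ n ⊑ e)
                    (n ∷ w ∷ length P ∷ length Q ∷ length D ∷ length E ∷ [])
                    (big₇ big x≤ y≤ ∷ ≤-reflexive (sym lPQ) ∷ ≤-reflexive (sym lDE) ∷ lP ∷ ≰⇒> l ∷ 3≤n ∷ []))

-- Existence of Gallai partitions

module _ {k N : ℕ} (c : EdgeColouring N k) (gallai : Gallai c) where

  private
    V : Set
    V = Fin N

    sym′ : ∀ {a u v} → Edge c a u v → Edge c a v u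
    sym′ = Edge-sym c

  noRainbow : ∀ {x y z} → x ≢ y → y ≢ z → x ≢ z → colour c x y ≢ colour c y z → colour c x y ≢ colour c x z →
    colour c y z ≡ colour c x z
  noRainbow {x} {y} {z} xy yz xz p q = decidable-stable (colour c y z Fin.≟ colour c x z) λ r → gallai x y z (xy , yz , xz , p , r , q)

  Other : Fin k → Fin k → V → V → Set
  Other r b u v = colour c u v ≢ r × colour c u v ≢ b

  other? : ∀ r b u v → Other r b u v ⊎ (Edge c r u v ⊎ Edge c b u v)
  other? r b u v with colour c u v Fin.≟ r | colour c u v Fin.≟ b
  ... | yes p | _ = inj₂ (inj₁ p)
  ... | no _ | yes q = inj₂ (inj₂ q)
  ... | no p | no q = inj₁ (p , q)

  not-other : ∀ {r b u v} → Other r b u v → ¬ (Edge c r u v ⊎ Edge c b u v)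
  not-other (p , q) = [ p , q ]′

  other-sym : ∀ {r b u v} → Other r b u v → Other r b v u
  other-sym (p , q) = p ∘ sym′ , q ∘ sym′

  -- Components of the graph whose edges have neither colour r nor b, labelled by a vertex.
  -- Connectedness is an induction principle instead of a supply of paths: a property passed on
  -- along these edges spreads over the component.
  record Components (r b : Fin k) (W : List V) : Set₁ where
    field
      ℓ         : V → V
      root      : ∀ {u} → u ∈ W → ℓ u ∈ W
      adjacent  : ∀ {u v} → u ∈ W → v ∈ W → u ≢ v → Other r b u v → ℓ u ≡ ℓ v
      connected : (Q : V → Set) → (∀ {u v} → u ∈ W → v ∈ W → Other r b u v → Q u → Q v) →
        ∀ {u v} → u ∈ W → v ∈ W → ℓ u ≡ ℓ v → Q u → Q v

  components : ∀ r b W → Unique W → Components r b W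
  components r b [] _ = record { ℓ = id ; root = λ () ; adjacent = λ () ; connected = λ _ _ () }
  components r b (v ∷ W) u@(_ ∷ uW) = record { ℓ = ℓ′ ; root = root′ ; adjacent = adjacent′ ; connected = connected′ }
    where
    open Components (components r b W uW)
    Merged : V → Set
    Merged u = ∃ λ w → w ∈ W × (Other r b v w × ℓ w ≡ ℓ u)
    decide : ∀ u → Merged u ⊎ ¬ Merged u
    decide u with search (λ w → (¬? (colour c v w Fin.≟ r) ×-dec ¬? (colour c v w Fin.≟ b)) ×-dec (ℓ w Fin.≟ ℓ u)) W
    ... | inj₁ m = inj₁ m
    ... | inj₂ f = inj₂ λ (w , w∈ , p) → f w∈ p
    -- The components adjacent to v merge with v under the label v; it is new, because by `root` the
    -- labels of vertices of W lie in W.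
    ℓ′ : V → V
    ℓ′ u with u Fin.≟ v | decide u
    ... | yes _ | _ = v
    ... | no _ | inj₁ _ = v
    ... | no _ | inj₂ _ = ℓ u
    NewClass OldClass : V → Set
    NewClass u = u ≡ v ⊎ Merged u
    OldClass u = u ≢ v × ¬ Merged u × ℓ′ u ≡ ℓ u
    which : ∀ u → (NewClass u × ℓ′ u ≡ v) ⊎ OldClass u
    which u with u Fin.≟ v | decide u
    ... | yes e | _ = inj₁ (inj₁ e , refl)
    ... | no _ | inj₁ m = inj₁ (inj₂ m , refl)
    ... | no ne | inj₂ m = inj₂ (ne , m , refl)
    old : ∀ {u} → u ∈ v ∷ W → u ≢ v → u ∈ W
    old (here e) ne = contradiction e ne
    old (there p) _ = p
    ℓ≢v : ∀ {u} → u ∈ W → ℓ u ≢ v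
    ℓ≢v u∈ e = ∉-unique u (subst (_∈ W) e (root u∈))
    root′ : ∀ {u} → u ∈ v ∷ W → ℓ′ u ∈ v ∷ W
    root′ {u} u∈ with which u
    ... | inj₁ (_ , e) = here e
    ... | inj₂ (ne , _ , e) = there (subst (_∈ W) (sym e) (root (old u∈ ne)))
    spread : ∀ {x y} → x ∈ W → y ∈ W → x ≢ y → Other r b x y → Merged x → Merged y
    spread x∈ y∈ ne o (w , w∈ , o′ , e) = w , w∈ , o′ , trans e (adjacent x∈ y∈ ne o)
    adjacent′ : ∀ {x y} → x ∈ v ∷ W → y ∈ v ∷ W → x ≢ y → Other r b x y → ℓ′ x ≡ ℓ′ y
    adjacent′ {x} {y} x∈ y∈ ne o with which x | which y
    ... | inj₁ (_ , e) | inj₁ (_ , e′) = trans e (sym e′)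
    ... | inj₂ (nx , _ , e) | inj₂ (ny , _ , e′) = trans e (trans (adjacent (old x∈ nx) (old y∈ ny) ne o) (sym e′))
    ... | inj₁ (inj₁ refl , _) | inj₂ (ny , m , _) = contradiction (y , old y∈ ny , o , refl) m
    ... | inj₂ (nx , m , _) | inj₁ (inj₁ refl , _) = contradiction (x , old x∈ nx , other-sym o , refl) m
    ... | inj₁ (inj₂ mx , _) | inj₂ (ny , m , _) = contradiction (moved x∈) m
      where
      moved : x ∈ v ∷ W → Merged y
      moved (here refl) = y , old y∈ ny , o , refl
      moved (there x∈W) = spread x∈W (old y∈ ny) ne o mx
    ... | inj₂ (nx , m , _) | inj₁ (inj₂ my , _) = contradiction (moved y∈) m
      where
      moved : y ∈ v ∷ W → Merged x
      moved (here refl) = x , old x∈ nx , other-sym o , refl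
      moved (there y∈W) = spread y∈W (old x∈ nx) (ne ∘ sym) (other-sym o) my
    connected′ : (Q : V → Set) → (∀ {x y} → x ∈ v ∷ W → y ∈ v ∷ W → Other r b x y → Q x → Q y) →
      ∀ {x y} → x ∈ v ∷ W → y ∈ v ∷ W → ℓ′ x ≡ ℓ′ y → Q x → Q y
    connected′ Q closed {x} {y} x∈ y∈ e qx = byClass (which x) (which y)
      where
      within : ∀ {x y} → x ∈ W → y ∈ W → ℓ x ≡ ℓ y → Q x → Q y
      within = connected Q λ p q → closed (there p) (there q)
      toV : ∀ {x} → x ∈ v ∷ W → NewClass x → Q x → Q v
      toV _ (inj₁ refl) q = q
      toV (here refl) (inj₂ _) q = q
      toV (there x∈) (inj₂ (w , w∈ , o , e)) q = closed (there w∈) (here refl) (other-sym o) (within x∈ w∈ (sym e) q)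
      fromV : ∀ {x} → x ∈ v ∷ W → NewClass x → Q v → Q x
      fromV _ (inj₁ refl) q = q
      fromV (here refl) (inj₂ _) q = q
      fromV (there x∈) (inj₂ (w , w∈ , o , e)) q = within w∈ x∈ e (closed (here refl) (there w∈) o q)
      byClass : (NewClass x × ℓ′ x ≡ v) ⊎ OldClass x → (NewClass y × ℓ′ y ≡ v) ⊎ OldClass y → Q y
      byClass (inj₁ (p , _)) (inj₁ (q , _)) = fromV y∈ q (toV x∈ p qx)
      byClass (inj₂ (nx , _ , ex)) (inj₂ (ny , _ , ey)) = within (old x∈ nx) (old y∈ ny) (trans (sym ex) (trans e ey)) qx
      byClass (inj₁ (_ , ex)) (inj₂ (ny , _ , ey)) = contradiction (trans (sym ey) (trans (sym e) ex)) (ℓ≢v (old y∈ ny))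
      byClass (inj₂ (nx , _ , ex)) (inj₁ (_ , ey)) = contradiction (trans (sym ex) (trans e ey)) (ℓ≢v (old x∈ nx))

  -- Along an edge xy coloured neither r nor b, a vertex z of another component sees x and y in r or
  -- b, so the triangle xyz forces both colours to agree. `connected` spreads this over the
  -- component.
  blocks : ∀ {r b W} (C : Components r b W) → Blocks c r b W (Components.ℓ C)
  blocks {r} {b} {W} C = record { cross = cross ; twins = twins }
    where
    open Components C
    cross : ∀ {u v} → u ∈ W → v ∈ W → ℓ u ≢ ℓ v → Edge c r u v ⊎ Edge c b u v
    cross {u} {v} u∈ v∈ ne with other? r b u v
    ... | inj₂ e = e
    ... | inj₁ o = contradiction (adjacent u∈ v∈ (λ { refl → ne refl }) o) ne
    twins : ∀ {u u′ v} → u ∈ W → u′ ∈ W → v ∈ W → ℓ u ≡ ℓ u′ → ℓ u ≢ ℓ v → colour c u v ≡ colour c u′ v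
    twins {u} {u′} {z} u∈ u′∈ z∈ e ne = sym (proj₂ (connected Q closed u∈ u′∈ e (refl , refl)))
      where
      Q : V → Set
      Q x = ℓ x ≡ ℓ u × colour c x z ≡ colour c u z
      closed : ∀ {x y} → x ∈ W → y ∈ W → Other r b x y → Q x → Q y
      closed {x} {y} x∈ y∈ o (lx , cx) with x Fin.≟ y
      ... | yes refl = lx , cx
      ... | no x≢y = ly , trans (noRainbow x≢y (λ { refl → ne (sym ly) }) (λ { refl → ne (sym lx) }) xy≢yz xy≢xz) cx
        where
        ly : ℓ y ≡ ℓ u
        ly = trans (sym (adjacent x∈ y∈ x≢y o)) lx
        xy≢yz : colour c x y ≢ colour c y z
        xy≢yz e = not-other o ([ (λ p → inj₁ (trans e p)) , (λ p → inj₂ (trans e p)) ]′ (cross y∈ z∈ λ e′ → ne (trans (sym ly) e′)))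
        xy≢xz : colour c x y ≢ colour c x z
        xy≢xz e = not-other o ([ (λ p → inj₁ (trans e p)) , (λ p → inj₂ (trans e p)) ]′ (cross x∈ z∈ λ e′ → ne (trans (sym lx) e′)))

  record Cut (K : List (Fin k)) (W : List V) : Set₁ where
    field
      {r b}   : Fin k
      r∈      : r ∈ K
      b∈      : b ∈ K
      Side    : V → Set
      {u₀ w₀} : V
      u₀∈     : u₀ ∈ W
      w₀∈     : w₀ ∈ W
      u₀-in   : Side u₀
      w₀-out  : ¬ Side w₀
      crosses : ∀ {u w} → u ∈ W → w ∈ W → Side u → ¬ Side w → Edge c r u w ⊎ Edge c b u w

  -- No edge outside r and b crosses the cut, so a component cannot meet both sides. `Side` is not
  -- assumed decidable; its double negation is what spreads.
  cut-separates : ∀ {r b W} (C : Components r b W) (Side : V → Set) →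
    (∀ {u w} → u ∈ W → w ∈ W → Side u → ¬ Side w → Edge c r u w ⊎ Edge c b u w) →
    ∀ {u w} → u ∈ W → w ∈ W → Side u → ¬ Side w → Components.ℓ C u ≢ Components.ℓ C w
  cut-separates C Side crosses u∈ w∈ su sw e =
    Components.connected C (λ x → ¬ ¬ Side x) (λ x∈ y∈ o ¬¬x ¬y → ¬¬x λ sx → not-other o (crosses x∈ y∈ sx ¬y)) u∈ w∈ e (λ f → f su) sw

  -- Adding v to a set W with a cut in two colours r, b. Unless the components of the other colours
  -- already give a cut, v is joined to all of them, always in one colour g; a component D with a
  -- vertex joined to v in colour s ∈ {r, b} is joined to the other components in colour s only.
  cut : ∀ {K} W → Unique W → 2 ≤ length W → (∀ {u w} → u ∈ W → w ∈ W → u ≢ w → colour c u w ∈ K) → Cut K W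
  cut (v ∷ []) _ (s≤s ()) _
  cut (u ∷ w ∷ []) uW _ pal = record
    { r∈ = e∈ ; b∈ = e∈ ; Side = _≡ u ; u₀∈ = here refl ; w₀∈ = there (here refl) ; u₀-in = refl ; w₀-out = ne ∘ sym ; crosses = crosses }
    where
    ne : u ≢ w
    ne e = ∉-unique uW (here e)
    e∈ = pal (here refl) (there (here refl)) ne
    crosses : ∀ {x y} → x ∈ u ∷ w ∷ [] → y ∈ u ∷ w ∷ [] → x ≡ u → y ≢ u → colour c x y ≡ colour c u w ⊎ colour c x y ≡ colour c u w
    crosses _ (here e) _ y≢ = contradiction e y≢
    crosses _ (there (here refl)) refl _ = inj₁ refl
  cut {K} (v ∷ W@(_ ∷ _ ∷ _)) uvW@(_ ∷ uW) _ pal = build (every W λ {z} _ → decide z)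
    where
    C₀ : Cut K W
    C₀ = cut W uW (s≤s (s≤s z≤n)) λ p q → pal (there p) (there q)
    open Cut C₀
    comps : Components r b W
    comps = components r b W uW
    open Components comps
    open Blocks (blocks comps)
    u₀≢w₀ : ℓ u₀ ≢ ℓ w₀
    u₀≢w₀ = cut-separates comps Side crosses u₀∈ w₀∈ u₀-in w₀-out
    fresh : ∀ {x} → x ∈ W → v ≢ x
    fresh x∈ = ∉⇒≢ (∉-unique uvW) x∈
    Touched : V → Set
    Touched z = ∃ λ x → x ∈ W × (Other r b v x × ℓ x ≡ ℓ z)
    decide : ∀ z → Touched z ⊎ ¬ Touched z
    decide z with search (λ w → (¬? (colour c v w Fin.≟ r) ×-dec ¬? (colour c v w Fin.≟ b)) ×-dec (ℓ w Fin.≟ ℓ z)) W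
    ... | inj₁ m = inj₁ m
    ... | inj₂ f = inj₂ λ (w , w∈ , p) → f w∈ p
    ClassOf : V → V → Set
    ClassOf z x = x ≢ v × ℓ x ≡ ℓ z
    classCut : ∀ {r b z} → r ∈ K → b ∈ K → z ∈ W → (∀ {x} → x ∈ W → ℓ x ≡ ℓ z → Edge c r x v ⊎ Edge c b x v) →
      (∀ {x y} → x ∈ W → y ∈ W → ℓ x ≡ ℓ z → ℓ y ≢ ℓ z → Edge c r x y ⊎ Edge c b x y) → Cut K (v ∷ W)
    classCut {r} {b} {z} r∈ b∈ z∈ toV toW = record
      { r∈ = r∈ ; b∈ = b∈ ; Side = ClassOf z ; u₀∈ = there z∈ ; w₀∈ = here refl
      ; u₀-in = fresh z∈ ∘ sym , refl ; w₀-out = λ (p , _) → p refl ; crosses = crosses′ }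
      where
      crosses′ : ∀ {x y} → x ∈ v ∷ W → y ∈ v ∷ W → ClassOf z x → ¬ ClassOf z y → Edge c r x y ⊎ Edge c b x y
      crosses′ (here refl) _ (ne , _) _ = contradiction refl ne
      crosses′ (there x∈) (here refl) (_ , e) _ = toV x∈ e
      crosses′ (there x∈) (there y∈) (_ , e) out = toW x∈ y∈ e λ e′ → out (fresh y∈ ∘ sym , e′)
    flip : ∀ {r b x y} → Edge c r x y ⊎ Edge c b x y → Edge c r y x ⊎ Edge c b y x
    flip = [ inj₁ ∘ sym′ , inj₂ ∘ sym′ ]′
    build : (∀ {z} → z ∈ W → Touched z) ⊎ (∃ λ z → z ∈ W × ¬ Touched z) → Cut K (v ∷ W)
    build (inj₂ (z , z∈ , untouched)) = classCut r∈ b∈ z∈ toV (λ x∈ y∈ e ne → cross x∈ y∈ λ e′ → ne (trans (sym e′) e))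
      where
      toV : ∀ {x} → x ∈ W → ℓ x ≡ ℓ z → Edge c r x v ⊎ Edge c b x v
      toV {x} x∈ e with other? r b v x
      ... | inj₂ p = flip p
      ... | inj₁ o = contradiction (x , x∈ , o , e) untouched
    build (inj₁ touched) = allTouched (touched u₀∈) (touched w₀∈)
      where
      allTouched : Touched u₀ → Touched w₀ → Cut K (v ∷ W)
      allTouched (x₀ , x₀∈ , o₀ , e₀) (x₁ , x₁∈ , o₁ , e₁) = byInner (every W λ {y} _ → other? r b v y)
        where
        g : Fin k
        g = colour c v x₀
        differ : ∀ {x x′} → x ∈ W → x′ ∈ W → Other r b v x → Other r b v x′ → ℓ x ≢ ℓ x′ → colour c v x ≡ colour c v x′
        differ {x} {x′} x∈ x′∈ o o′ ne = trans (symm c v x) (trans (sym apex) (symm c x′ v))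
          where
          bad : ∀ {y} → Other r b v y → colour c v y ≢ colour c x x′
          bad o e = not-other o ([ (λ p → inj₁ (trans e p)) , (λ p → inj₂ (trans e p)) ]′ (cross x∈ x′∈ ne))
          apex : colour c x′ v ≡ colour c x v
          apex = noRainbow (λ { refl → ne refl }) (fresh x′∈ ∘ sym) (fresh x∈ ∘ sym)
            (λ e → bad o′ (trans (symm c v x′) (sym e))) (λ e → bad o (trans (symm c v x) (sym e)))
        x₀≢x₁ : ℓ x₀ ≢ ℓ x₁
        x₀≢x₁ e = u₀≢w₀ (trans (sym e₀) (trans e e₁))
        -- Two vertices of one component are compared through a vertex of another.
        others-g : ∀ {x} → x ∈ W → Other r b v x → colour c v x ≡ g
        others-g {x} x∈ o with ℓ x Fin.≟ ℓ x₀
        ... | no ne = differ x∈ x₀∈ o o₀ ne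
        ... | yes e = trans (differ x∈ x₁∈ o o₁ λ e′ → x₀≢x₁ (trans (sym e) e′)) (differ x₁∈ x₀∈ o₁ o₀ (x₀≢x₁ ∘ sym))
        g∈ : g ∈ K
        g∈ = pal (here refl) (there x₀∈) (fresh x₀∈)
        -- The component of z has a vertex x whose edge to v is neither r nor b. In the triangle vxy
        -- the other two edges then agree, and twins carry the colour from x to z.
        forced : ∀ {y z} → y ∈ W → z ∈ W → (Edge c r v y ⊎ Edge c b v y) → ℓ y ≢ ℓ z → colour c y z ≡ colour c v y
        forced {y} {z} y∈ z∈ vy ne = viaTouched (touched z∈)
          where
          viaTouched : Touched z → colour c y z ≡ colour c v y
          viaTouched (x , x∈ , o , e) = trans (trans (symm c y z) (trans (twins z∈ x∈ y∈ (sym e) (ne ∘ sym)) (symm c x y)))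
            (sym (trans (symm c v y) (sym same)))
            where
            y≢x : ℓ y ≢ ℓ x
            y≢x e′ = ne (trans e′ e)
            same : colour c y x ≡ colour c y v
            same = trans (symm c y x) (trans (noRainbow (fresh x∈) (λ { refl → y≢x refl }) (fresh y∈) vx≢xy vx≢vy) (symm c v y))
              where
              vx≢vy : colour c v x ≢ colour c v y
              vx≢vy e′ = not-other o ([ (λ p → inj₁ (trans e′ p)) , (λ p → inj₂ (trans e′ p)) ]′ vy)
              vx≢xy : colour c v x ≢ colour c x y
              vx≢xy e′ = not-other o ([ (λ p → inj₁ (trans e′ p)) , (λ p → inj₂ (trans e′ p)) ]′ (cross x∈ y∈ (y≢x ∘ sym)))
        byInner : (∀ {y} → y ∈ W → Other r b v y) ⊎ (∃ λ y → y ∈ W × (Edge c r v y ⊎ Edge c b v y)) → Cut K (v ∷ W)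
        byInner (inj₁ all) = record { r = g ; b = g ; r∈ = g∈ ; b∈ = g∈ ; Side = _≡ v ; u₀∈ = here refl ; w₀∈ = there x₀∈
          ; u₀-in = refl ; w₀-out = fresh x₀∈ ∘ sym ; crosses = crosses′ }
          where
          crosses′ : ∀ {x y} → x ∈ v ∷ W → y ∈ v ∷ W → x ≡ v → y ≢ v → Edge c g x y ⊎ Edge c g x y
          crosses′ _ (here e) _ ne = contradiction e ne
          crosses′ _ (there y∈) refl _ = inj₁ (others-g y∈ (all y∈))
        byInner (inj₂ (y , y∈ , vy)) = classCut (pal (here refl) (there y∈) (fresh y∈)) g∈ y∈ toV toW
          where
          s : Fin k
          s = colour c v y
          elsewhere : ∃ λ z → z ∈ W × ℓ y ≢ ℓ z
          elsewhere with ℓ y Fin.≟ ℓ u₀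
          ... | no ne = u₀ , u₀∈ , ne
          ... | yes e = w₀ , w₀∈ , λ e′ → u₀≢w₀ (trans (sym e) e′)
          toOthers : ∀ {x z} → x ∈ W → z ∈ W → ℓ x ≡ ℓ y → ℓ z ≢ ℓ y → colour c x z ≡ s
          toOthers x∈ z∈ e ne = trans (twins x∈ y∈ z∈ e λ e′ → ne (trans (sym e′) e)) (forced y∈ z∈ vy (ne ∘ sym))
          toV : ∀ {x} → x ∈ W → ℓ x ≡ ℓ y → Edge c s x v ⊎ Edge c g x v
          toV {x} x∈ e with other? r b v x
          ... | inj₁ o = inj₂ (trans (symm c x v) (others-g x∈ o))
          ... | inj₂ vx = inj₁ (trans (symm c x v) (trans (sym (forced x∈ (proj₁ (proj₂ elsewhere)) vx
              λ e′ → proj₂ (proj₂ elsewhere) (trans (sym e) e′)))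
            (toOthers x∈ (proj₁ (proj₂ elsewhere)) e (proj₂ (proj₂ elsewhere) ∘ sym))))
          toW : ∀ {x z} → x ∈ W → z ∈ W → ℓ x ≡ ℓ y → ℓ z ≢ ℓ y → Edge c s x z ⊎ Edge c g x z
          toW x∈ z∈ e ne = inj₁ (toOthers x∈ z∈ e ne)

  gallaiPartition : ∀ {K W} → Unique K → 2 ≤ length K → Unique W → 2 ≤ length W →
    (∀ {u w} → u ∈ W → w ∈ W → u ≢ w → colour c u w ∈ K) →
    ∃₂ λ r b → r ∈ K × b ∈ K × r ≢ b × ∃ λ ℓ → Blocks c r b W ℓ × ∃₂ λ u w → u ∈ W × w ∈ W × ℓ u ≢ ℓ w
  gallaiPartition {K} {W} uK 2≤K uW 2≤W pal = byEqual (r Fin.≟ b) (another uK 2≤K r∈)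
    where
    open Cut (cut W uW 2≤W pal)
    result : ∀ b′ → b′ ∈ K → r ≢ b′ → (∀ {u w} → u ∈ W → w ∈ W → Side u → ¬ Side w → Edge c r u w ⊎ Edge c b′ u w) → _
    result b′ b′∈ ne crosses′ = r , b′ , r∈ , b′∈ , ne , Components.ℓ comps , blocks comps , u₀ , w₀ , u₀∈ , w₀∈ ,
      cut-separates comps Side crosses′ u₀∈ w₀∈ u₀-in w₀-out
      where comps = components r b′ W uW
    byEqual : Dec (r ≡ b) → (∃ λ b′ → b′ ∈ K × b′ ≢ r) → _
    byEqual (no ne) _ = result b b∈ ne crosses
    -- A cut in a single colour is also a cut in that colour and any second one of the palette.
    byEqual (yes e) (b′ , b′∈ , ne) = result b′ b′∈ (ne ∘ sym) λ p q s t →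
      inj₁ ([ id , (λ x → trans x (sym e)) ]′ (crosses p q s t))

-- A part with more than n vertices

pairOrNone : ∀ {V : Set} {P : V → V → Set} (P? : ∀ u v → Dec (P u v)) xs →
  (∃₂ λ u v → u ∈ xs × v ∈ xs × P u v) ⊎ (∀ {u v} → u ∈ xs → v ∈ xs → ¬ P u v)
pairOrNone {V} P? xs with search (λ u → toDec (search (P? u) xs)) xs
  where
  toDec : ∀ {Q : V → Set} → (∃ λ v → v ∈ xs × Q v) ⊎ (∀ {v} → v ∈ xs → ¬ Q v) → Dec (∃ λ v → v ∈ xs × Q v)
  toDec (inj₁ e) = yes e
  toDec (inj₂ f) = no λ (v , v∈ , q) → f v∈ q
... | inj₁ (u , u∈ , v , v∈ , p) = inj₁ (u , v , u∈ , v∈ , p)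
... | inj₂ f = inj₂ λ u∈ v∈ p → f u∈ (_ , v∈ , p)

module _ {k N : ℕ} (c : EdgeColouring N k) where

  restrict : ∀ {n K K′ W W′ X} → Config c n K W X → Unique W′ → W′ ⊆ W →
    (∀ {u v} → u ∈ W′ → v ∈ W′ → u ≢ v → colour c u v ∈ K′) → Config c n K′ W′ X
  restrict C uW′ sub pal = record { uniqueW = uW′ ; palette = pal ; uniqueX = uniqueX ; smallX = smallX
    ; awayX = λ x∈ w∈ → awayX x∈ (sub w∈) ; joined = λ x∈ w∈ → joined x∈ (sub w∈) }
    where open Config C

  update : (Fin k → List (Fin N)) → Fin k → List (Fin N) → Fin k → List (Fin N)
  update X r R i with i Fin.≟ r
  ... | yes _ = R ++ X i
  ... | no _ = X i

  update-same : ∀ X r R → length (update X r R r) ≡ length R + length (X r)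
  update-same X r R with r Fin.≟ r
  ... | yes _ = List.length-++ R
  ... | no ne = contradiction refl ne

  update-other : ∀ X {r} R {i} → i ≢ r → update X r R i ≡ X i
  update-other X {r} R {i} ne with i Fin.≟ r
  ... | yes e = contradiction e ne
  ... | no _ = refl

  weight-update : ∀ X {r} R K → r ∉ K → weight c (update X r R) K ≡ weight c X K
  weight-update X R [] _ = refl
  weight-update X R (i ∷ K) r∉ = cong₂ _+_ (cong length (update-other X R λ e → r∉ (here (sym e)))) (weight-update X R K (r∉ ∘ there))

  updateConfig : ∀ {n K W W′ X} r {R} → Config c n K W X → Unique R → (∀ {u} → u ∈ R → u ∉ X r) → length R + length (X r) < n →
    Unique W′ → W′ ⊆ W → (∀ {u} → u ∈ R → u ∉ W′) → (∀ {u w} → u ∈ R → w ∈ W′ → Edge c r u w) →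
    Config c n K W′ (update X r R)
  updateConfig {n} {K} {W} {W′} {X} r {R} C uR apart lt uW′ sub disj red = record
    { uniqueW = uW′ ; palette = λ u v → palette (sub u) (sub v) ; uniqueX = uniq ; smallX = small ; awayX = λ {i} → away {i} ; joined = λ {i} → join {i} }
    where
    open Config C
    uniq : ∀ i → Unique (update X r R i)
    uniq i with i Fin.≟ r
    ... | yes refl = unique-++ uR (uniqueX r) apart
    ... | no _ = uniqueX i
    small : ∀ i → length (update X r R i) < n
    small i with i Fin.≟ r
    ... | yes refl = ≤-trans (s≤s (≤-reflexive (List.length-++ R))) lt
    ... | no _ = smallX i
    away : ∀ {i x} → x ∈ update X r R i → x ∉ W′
    away {i} x∈ w∈ with i Fin.≟ r
    ... | yes refl = [ (λ p → disj p w∈) , (λ p → awayX p (sub w∈)) ]′ (∈-++⁻ R x∈)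
    ... | no _ = awayX x∈ (sub w∈)
    join : ∀ {i x w} → x ∈ update X r R i → w ∈ W′ → Edge c i x w
    join {i} x∈ w∈ with i Fin.≟ r
    ... | yes refl = [ (λ p → red p w∈) , (λ p → joined p (sub w∈)) ]′ (∈-++⁻ R x∈)
    ... | no _ = joined x∈ (sub w∈)

  -- `mixed` has its origin in the triangles over a vertex of `A`, which sees the ends of an edge
  -- between `R` and `B` in red and in blue.
  record BigModule (n : ℕ) (r b : Fin k) (K : List (Fin k)) (W : List (Fin N)) (X : Fin k → List (Fin N))
    (A R B : List (Fin N)) : Set where
    field
      config : Config c n (r ∷ b ∷ K) W X
      uniqueK : Unique (r ∷ b ∷ K)
      cover  : A ++ R ++ B ↭ W
      large  : n < length A
      red    : ∀ {u v} → u ∈ A → v ∈ R → Edge c r u v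
      blue   : ∀ {u v} → u ∈ A → v ∈ B → Edge c b u v
      mixed  : ∀ {u v} → u ∈ R → v ∈ B → Edge c r u v ⊎ Edge c b u v

  swapModule : ∀ {n r b K W X A R B} → BigModule n r b K W X A R B → BigModule n b r K W X A B R
  swapModule {r = r} {b} {K} {A = A} {R} {B} M = record
    { config = restrict config uniqueW id (λ u v ne → Perm.∈-resp-↭ (swap r b ↭-refl) (palette u v ne))
    ; uniqueK = unique-↭ (swap r b ↭-refl) uniqueK
    ; cover = ↭-trans (Perm.++⁺ˡ A (Perm.++-comm B R)) cover
    ; large = large ; red = blue ; blue = red
    ; mixed = λ u v → [ inj₂ ∘ Edge-sym c , inj₁ ∘ Edge-sym c ]′ (mixed v u) }
    where
    open BigModule M
    open Config config

  module _ {n : ℕ} (3≤n : 3 ≤ n) (none : ∀ a → ¬ Cyc (Edge c a) (suc (n + n))) where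

    private
      1≤n : 1 ≤ n
      1≤n = ≤-trans (s≤s z≤n) 3≤n

      sym′ : ∀ {a u v} → Edge c a u v → Edge c a v u
      sym′ = Edge-sym c

    -- One end of the forbidden edge is an apex over the rest of `S` and `T`. So `S` needs n + 1
    -- vertices where `T` needs n, which is why parts are large from n + 1 on.
    noInner : ∀ {a S T} → Unique S → Unique T → (∀ {u} → u ∈ S → u ∉ T) → n < length S → n ≤ length T →
      (∀ {u v} → u ∈ S → v ∈ T → Edge c a u v) → ∀ {u v} → u ∈ S → v ∈ S → u ≢ v → ¬ Edge c a u v
    noInner {a} {S} {T} uS uT disj n<S n≤T com {u} {v} u∈ v∈ ne e = apex (remove u∈ uS) (nonempty (≤-trans 1≤n n≤T))
      where
      apex : _ → (∃ λ t → t ∈ T) → ⊥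
      apex (S′ , lS′ , uS′ , u∉ , S′⊆ , keep) (t , t∈) = none a (apexCycle sym′ 1≤n uS′ uT (disj ∘ S′⊆)
        (≤-pred (≤-trans n<S (≤-reflexive (sym lS′)))) n≤T (λ p q → com (S′⊆ p) q) u∉ (disj u∈) (keep v∈ (ne ∘ sym)) t∈ e (com u∈ t∈))

    module BigModuleBounds (j : ℕ) (ih₁ : Bound c n (1 + j)) (ih₂ : Bound c n (2 + j))
      {K : List (Fin k)} (lK : length K ≡ suc j) {W : List (Fin N)} {X : Fin k → List (Fin N)} where

      -- m, 2m and 4m are the bounds for the palettes K, b ∷ K and r ∷ b ∷ K.
      m Σ′ : ℕ
      m = n * 2 ^ (1 + j)
      Σ′ = weight c X K

      2n≤m : n + n ≤ m
      2n≤m = ≤-trans (≤-reflexive (trans (cong (n +_) (sym (+-identityʳ n))) (*-comm 2 n)))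
        (*-monoʳ-≤ n (*-monoʳ-≤ 2 (m^n>0 2 j)))

      double : ∀ e → n * 2 ^ suc e ≡ n * 2 ^ e + n * 2 ^ e
      double e = trans (cong (n *_) (cong (2 ^ e +_) (+-identityʳ (2 ^ e)))) (*-distribˡ-+ n (2 ^ e) (2 ^ e))

      module Sides {r b A R B} (M : BigModule n r b K W X A R B) where
        open BigModule M public
        open Config config public

        a ρ β x y : ℕ
        a = length A
        ρ = length R
        β = length B
        x = length (X r)
        y = length (X b)

        sepA = unique-++⁻ A (unique-↭ (↭-sym cover) uniqueW)
        sepR = unique-++⁻ R (proj₁ (proj₂ sepA))

        uA : Unique A
        uA = proj₁ sepA
        uR : Unique R
        uR = proj₁ sepR
        uB : Unique B
        uB = proj₁ (proj₂ sepR)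
        A∉R : ∀ {u} → u ∈ A → u ∉ R
        A∉R p q = proj₂ (proj₂ sepA) p (∈-++⁺ˡ q)
        A∉B : ∀ {u} → u ∈ A → u ∉ B
        A∉B p q = proj₂ (proj₂ sepA) p (∈-++⁺ʳ R q)
        R∉B : ∀ {u} → u ∈ R → u ∉ B
        R∉B = proj₂ (proj₂ sepR)
        A⊆ : A ⊆ W
        A⊆ p = Perm.∈-resp-↭ cover (∈-++⁺ˡ p)
        R⊆ : R ⊆ W
        R⊆ p = Perm.∈-resp-↭ cover (∈-++⁺ʳ A (∈-++⁺ˡ p))
        B⊆ : B ⊆ W
        B⊆ p = Perm.∈-resp-↭ cover (∈-++⁺ʳ A (∈-++⁺ʳ R p))

        total : length W ≡ a + (ρ + β)
        total = sym (trans (cong (a +_) (sym (List.length-++ R))) (trans (sym (List.length-++ A)) (Perm.↭-length cover)))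

        r∉K : r ∉ K
        r∉K p = ∉-unique uniqueK (there p)
        b∉K : b ∉ K
        b∉K = ∉-unique (proj₂-tail uniqueK)
          where
          proj₂-tail : ∀ {z : Fin k} {zs} → Unique (z ∷ zs) → Unique zs
          proj₂-tail (_ ∷ u) = u
        r≢b : r ≢ b
        r≢b e = ∉-unique uniqueK (here e)
        uK : Unique K
        uK with uniqueK
        ... | _ ∷ _ ∷ u = u
        ubK : Unique (b ∷ K)
        ubK = unique-∷ b∉K uK

        withoutRed : ∀ {S} → S ⊆ W → (∀ {u v} → u ∈ S → v ∈ S → u ≢ v → ¬ Edge c r u v) →
          ∀ {u v} → u ∈ S → v ∈ S → u ≢ v → colour c u v ∈ b ∷ K
        withoutRed S⊆ noR u∈ v∈ ne with palette (S⊆ u∈) (S⊆ v∈) ne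
        ... | here e = contradiction e (noR u∈ v∈ ne)
        ... | there p = p

        boundNeither : ∀ {S} → Unique S → S ⊆ W → (∀ {u v} → u ∈ S → v ∈ S → u ≢ v → ¬ Edge c r u v) →
          (∀ {u v} → u ∈ S → v ∈ S → u ≢ v → ¬ Edge c b u v) → length S + Σ′ ≤ m
        boundNeither {S} uS S⊆ noR noB = ih₁ K uK lK S X (restrict config uS S⊆ pal)
          where
          pal : ∀ {u v} → u ∈ S → v ∈ S → u ≢ v → colour c u v ∈ K
          pal u∈ v∈ ne with withoutRed S⊆ noR u∈ v∈ ne
          ... | here e = contradiction e (noB u∈ v∈ ne)
          ... | there p = p

        -- `T` is moved from W to the vertices joined in blue; `S` has no red edge left, so the
        -- bound for b ∷ K applies.
        boundNoRed : ∀ {S} T → Unique S → S ⊆ W → (∀ {u v} → u ∈ S → v ∈ S → u ≢ v → ¬ Edge c r u v) →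
          Unique T → T ⊆ W → length T + y < n → (∀ {u} → u ∈ T → u ∉ S) → (∀ {u w} → u ∈ T → w ∈ S → Edge c b u w) →
          length S + (length T + y + Σ′) ≤ m + m
        boundNoRed {S} T uS S⊆ noR uT T⊆ lt disj com = ≤-trans (≤-reflexive (cong (length S +_) (sym (cong₂ _+_ (update-same X b T) (weight-update X T K b∉K)))))
          (≤-trans (ih₂ (b ∷ K) ubK (cong suc lK) S (update X b T)
            (restrict (updateConfig b config uT (λ p q → awayX q (T⊆ p)) lt uS S⊆ disj com) uS id (withoutRed S⊆ noR)))
            (≤-reflexive (double (1 + j))))

        noRedA : n ≤ ρ + x → ∀ {u v} → u ∈ A → v ∈ A → u ≢ v → ¬ Edge c r u v
        noRedA l = noInner uA (unique-++ uR (uniqueX r) λ p q → awayX q (R⊆ p))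
          (λ p q → [ A∉R p , (λ q′ → awayX q′ (A⊆ p)) ]′ (∈-++⁻ R q)) large (≤-trans l (≤-reflexive (sym (List.length-++ R))))
          λ p q → [ red p , (λ q′ → sym′ (joined q′ (A⊆ p))) ]′ (∈-++⁻ R q)

        noRedR : n < ρ → ∀ {u v} → u ∈ R → v ∈ R → u ≢ v → ¬ Edge c r u v
        noRedR l = noInner uR uA (λ p q → A∉R q p) l (<⇒≤ large) λ p q → sym′ (red q p)

        -- A vertex joined to W in red would be an apex over the red complete bipartite graph on `A`
        -- and `R`.
        x≤0 : n < ρ → x ≤ 0
        x≤0 l = ≮⇒≥ λ 1≤x → apex (nonempty {xs = X r} 1≤x) (nonempty (≤-trans (s≤s z≤n) large)) (nonempty (≤-trans (s≤s z≤n) l))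
          where
          apex : (∃ λ z → z ∈ X r) → (∃ λ u → u ∈ A) → (∃ λ v → v ∈ R) → ⊥
          apex (z , z∈) (u , u∈) (v , v∈) = none r (apexCycle sym′ 1≤n uA uR A∉R (<⇒≤ large) (<⇒≤ l) red
            (λ p → awayX z∈ (A⊆ p)) (λ p → awayX z∈ (R⊆ p)) u∈ v∈ (joined z∈ (A⊆ u∈)) (joined z∈ (R⊆ v∈)))

        boundR : n < ρ → ρ + (y + Σ′) ≤ m + m
        boundR l = boundNoRed [] uR R⊆ (noRedR l) [] (λ ()) (smallX b) (λ ()) λ ()

        smallR : ρ ≤ n → ρ + x ≤ m
        smallR l = linear 4 (λ p x n m → p ⊑ n ∷ 1+ x ⊑ n ∷ n ⊕ n ⊑ m ∷ [] ⊢ p ⊕ x ⊑ m) (ρ ∷ x ∷ n ∷ m ∷ []) (l ∷ smallX r ∷ 2n≤m ∷ [])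

        anyR : ρ + x ≤ m + m
        anyR with ρ ≤? n
        ... | yes l = ≤-trans (smallR l) (m≤m+n m m)
        ... | no l = linear 5 (λ p x y s m → x ⊑ # 0 ∷ p ⊕ (y ⊕ s) ⊑ m ∷ [] ⊢ p ⊕ x ⊑ m) (ρ ∷ x ∷ y ∷ Σ′ ∷ m + m ∷ []) (x≤0 (≰⇒> l) ∷ boundR (≰⇒> l) ∷ [])

        -- The blue edge `u v` is a bridge over the blue complete bipartite graph on `A` and `B`.
        -- With the colours exchanged, the same excludes a red edge of `B` with two disjoint red
        -- edges to `R`.
        noMatching : n < β → ∀ {u v s t} → u ∈ R → v ∈ R → u ≢ v → Edge c b u v → s ∈ B → t ∈ B → s ≢ t →
          Edge c b u s → Edge c b v t → ⊥
        noMatching l u∈ v∈ ne e s∈ t∈ s≢t us vt = none b (bridgeCycle sym′ (≤-trans (s≤s (s≤s z≤n)) 3≤n) uA uB A∉B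
          (≤-trans (<⇒≤ large) (n≤1+n a)) (<⇒≤ l) blue ne (λ p → A∉R p u∈) (λ p → A∉R p v∈) (R∉B u∈) (R∉B v∈) s≢t s∈ t∈ e us vt)

      Goal : ∀ {r b A R B} → BigModule n r b K W X A R B → Set
      Goal {r} {b} _ = length W + (length (X r) + (length (X b) + Σ′)) ≤ n * 2 ^ (3 + j)

      four : n * 2 ^ (3 + j) ≡ m + m + (m + m)
      four = trans (double (2 + j)) (cong₂ _+_ (double (1 + j)) (double (1 + j)))

      swapGoal : ∀ {r b A R B} (M : BigModule n r b K W X A R B) → Goal (swapModule M) → Goal M
      swapGoal {r} {b} M g = ≤-trans (linear 5 (λ w x y s z → [] ⊢ w ⊕ (x ⊕ (y ⊕ s)) ⊑ w ⊕ (y ⊕ (x ⊕ s)))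
        (length W ∷ length (X r) ∷ length (X b) ∷ Σ′ ∷ 0 ∷ []) []) g

      -- The blue edge p q in R and the red edge s t in B force q to be red to all of B, and all
      -- blue edges in R to contain q.
      hub : ∀ {r b A R B} (M : BigModule n r b K W X A R B) → n < length R → n < length B →
        ∀ {p q s t} → p ∈ R → q ∈ R → p ≢ q → Edge c b p q → s ∈ B → t ∈ B → s ≢ t → Edge c r s t →
        Edge c b p s → Edge c b p t → Edge c r q s → Edge c r q t → Goal M
      hub {r} {b} {A} {R} {B} M n<R n<B {p} {q} {s} {t} p∈ q∈ p≢q pq s∈ t∈ s≢t st ps pt qs qt = combine (remove q∈ uR)
        where
        open Sides M
        module M′ = Sides (swapModule M)
        redToB : ∀ {z} → z ∈ B → Edge c r q z
        redToB {z} z∈ with mixed q∈ z∈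
        ... | inj₁ e = e
        ... | inj₂ e with z Fin.≟ s
        ... | no z≢s = ⊥-elim (noMatching n<B p∈ q∈ p≢q pq s∈ z∈ (z≢s ∘ sym) ps e)
        ... | yes z≡s = ⊥-elim (noMatching n<B p∈ q∈ p≢q pq t∈ z∈ (λ t≡z → s≢t (trans (sym z≡s) (sym t≡z))) pt e)
        blueToS : ∀ {u} → u ∈ R → u ≢ q → Edge c b u s
        blueToS u∈ u≢q with mixed u∈ s∈
        ... | inj₂ e = e
        ... | inj₁ e = ⊥-elim (M′.noMatching n<R s∈ t∈ s≢t st u∈ q∈ u≢q (sym′ e) (sym′ qt))
        blueToT : ∀ {u} → u ∈ R → u ≢ q → Edge c b u t
        blueToT u∈ u≢q with mixed u∈ t∈
        ... | inj₂ e = e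
        ... | inj₁ e = ⊥-elim (M′.noMatching n<R s∈ t∈ s≢t st q∈ u∈ (u≢q ∘ sym) (sym′ qs) (sym′ e))
        combine : _ → Goal M
        -- Without q, `R` loses both colours, and q is charged to `B` as a vertex joined in red. So
        -- `A`, `R` and `B` have at most m, m + 1 and 2m - 1 vertices, which is exactly 4m.
        combine (R′ , lR′ , uR′ , q∉ , R′⊆ , _) = ≤-trans
          (linear 7 (λ w a p b x y s → w ⊑ a ⊕ (p ⊕ b) ∷ [] ⊢ w ⊕ (x ⊕ (y ⊕ s)) ⊑ a ⊕ (p ⊕ b) ⊕ (x ⊕ (y ⊕ s)))
            (length W ∷ a ∷ ρ ∷ β ∷ x ∷ y ∷ Σ′ ∷ []) (≤-reflexive total ∷ []))
          (≤-trans (linear 8 (λ a p b x y s m p′ → x ⊑ # 0 ∷ y ⊑ # 0 ∷ a ⊕ s ⊑ m ∷ p′ ⊕ s ⊑ m ∷ p ⊑ 1+ p′ ∷ b ⊕ (# 1 ⊕ x ⊕ s) ⊑ m ⊕ m ∷ []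
              ⊢ a ⊕ (p ⊕ b) ⊕ (x ⊕ (y ⊕ s)) ⊑ m ⊕ m ⊕ (m ⊕ m))
            (a ∷ ρ ∷ β ∷ x ∷ y ∷ Σ′ ∷ m ∷ length R′ ∷ [])
            (x≤0 n<R ∷ M′.x≤0 n<B ∷ boundA ∷ boundR′ ∷ ≤-reflexive (sym lR′) ∷ boundB ∷ []))
          (≤-reflexive (sym four)))
          where
          boundA : a + Σ′ ≤ m
          boundA = boundNeither uA A⊆ (noRedA (≤-trans (<⇒≤ n<R) (m≤m+n ρ x))) (M′.noRedA (≤-trans (<⇒≤ n<B) (m≤m+n β y)))
          boundR′ : length R′ + Σ′ ≤ m
          boundR′ = boundNeither uR′ (R⊆ ∘ R′⊆) (λ u v → noRedR n<R (R′⊆ u) (R′⊆ v)) λ u∈ v∈ ne e →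
            noMatching n<B (R′⊆ u∈) (R′⊆ v∈) ne e s∈ t∈ s≢t (blueToS (R′⊆ u∈) (∉⇒≢ q∉ u∈ ∘ sym)) (blueToT (R′⊆ v∈) (∉⇒≢ q∉ v∈ ∘ sym))
          boundB : β + (1 + x + Σ′) ≤ m + m
          boundB = M′.boundNoRed (q ∷ []) uB B⊆ (M′.noRedR n<B) ([] ∷ []) (λ { (here refl) → R⊆ q∈ })
            (linear 2 (λ x n → x ⊑ # 0 ∷ # 3 ⊑ n ∷ [] ⊢ 1+ (1+ x) ⊑ n) (x ∷ n ∷ []) (x≤0 n<R ∷ 3≤n ∷ []))
            (λ { (here refl) → R∉B q∈ }) λ { (here refl) z∈ → redToB z∈ }

      -- `A` loses both colours; `R` loses red and `B` loses blue. If one of `R` and `B` loses the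
      -- other colour too, m + m + 2m suffices. Otherwise take a blue edge in `R` and a red edge in
      -- `B`: the four edges between them contain no matching in either colour, so an end of one
      -- edge is blue to both ends of the other and its partner is red to both. This is the
      -- situation of `hub`.
      bothLarge : ∀ {r b A R B} (M : BigModule n r b K W X A R B) → n < length R → n < length B → Goal M
      bothLarge {r} {b} {A} {R} {B} M n<R n<B = byEdges (pairOrNone (inner? b) R) (pairOrNone (inner? r) B)
        where
        open Sides M
        module M′ = Sides (swapModule M)
        Inner : Fin k → Fin N → Fin N → Set
        Inner i u v = u ≢ v × Edge c i u v
        inner? : ∀ i u v → Dec (Inner i u v)
        inner? i u v = ¬? (u Fin.≟ v) ×-dec (colour c u v Fin.≟ i)
        boundA : a + Σ′ ≤ m
        boundA = boundNeither uA A⊆ (noRedA (≤-trans (<⇒≤ n<R) (m≤m+n ρ x))) (M′.noRedA (≤-trans (<⇒≤ n<B) (m≤m+n β y)))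
        add : ∀ {R₀ B₀} → ρ + Σ′ ≤ R₀ → β + Σ′ ≤ B₀ → R₀ + B₀ ≤ m + m + m → Goal M
        add {R₀} {B₀} hR hB h = ≤-trans (linear 10 (λ w a p b x y s m R B → w ⊑ a ⊕ (p ⊕ b) ∷ x ⊑ # 0 ∷ y ⊑ # 0 ∷ a ⊕ s ⊑ m ∷ p ⊕ s ⊑ R ∷ b ⊕ s ⊑ B ∷ R ⊕ B ⊑ m ⊕ m ⊕ m ∷ []
              ⊢ w ⊕ (x ⊕ (y ⊕ s)) ⊑ m ⊕ m ⊕ (m ⊕ m))
            (length W ∷ a ∷ ρ ∷ β ∷ x ∷ y ∷ Σ′ ∷ m ∷ R₀ ∷ B₀ ∷ [])
            (≤-reflexive total ∷ x≤0 n<R ∷ M′.x≤0 n<B ∷ boundA ∷ hR ∷ hB ∷ h ∷ []))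
          (≤-reflexive (sym four))
        weaker : ∀ {p y s l} → p + (y + s) ≤ l → p + s ≤ l
        weaker {p} {y} {s} h = ≤-trans (+-monoʳ-≤ p (m≤n+m s y)) h
        byEdges : (∃₂ λ u v → u ∈ R × v ∈ R × Inner b u v) ⊎ (∀ {u v} → u ∈ R → v ∈ R → ¬ Inner b u v) →
          (∃₂ λ s t → s ∈ B × t ∈ B × Inner r s t) ⊎ (∀ {s t} → s ∈ B → t ∈ B → ¬ Inner r s t) → Goal M
        byEdges (inj₂ noBlue) _ = add (boundNeither uR R⊆ (noRedR n<R) λ u v ne e → noBlue u v (ne , e)) (weaker {β} {x} (M′.boundR n<B))
          (≤-reflexive (sym (+-assoc m m m)))
        byEdges (inj₁ _) (inj₂ noRed) = add (weaker {ρ} {y} (boundR n<R)) (M′.boundNeither uB B⊆ (M′.noRedR n<B) λ u v ne e → noRed u v (ne , e)) ≤-refl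
        byEdges (inj₁ (u , v , u∈ , v∈ , u≢v , uv)) (inj₁ (s , t , s∈ , t∈ , s≢t , st)) = byCross (mixed u∈ s∈) (mixed v∈ t∈) (mixed u∈ t∈) (mixed v∈ s∈)
          where
          byCross : Edge c r u s ⊎ Edge c b u s → Edge c r v t ⊎ Edge c b v t → Edge c r u t ⊎ Edge c b u t → Edge c r v s ⊎ Edge c b v s → Goal M
          byCross (inj₂ us) (inj₂ vt) _ _ = ⊥-elim (noMatching n<B u∈ v∈ u≢v uv s∈ t∈ s≢t us vt)
          byCross (inj₁ us) (inj₁ vt) _ _ = ⊥-elim (M′.noMatching n<R s∈ t∈ s≢t st u∈ v∈ u≢v (sym′ us) (sym′ vt))
          byCross _ _ (inj₂ ut) (inj₂ vs) = ⊥-elim (noMatching n<B u∈ v∈ u≢v uv t∈ s∈ (s≢t ∘ sym) ut vs)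
          byCross _ _ (inj₁ ut) (inj₁ vs) = ⊥-elim (M′.noMatching n<R s∈ t∈ s≢t st v∈ u∈ (u≢v ∘ sym) (sym′ vs) (sym′ ut))
          byCross (inj₂ us) (inj₁ vt) (inj₂ ut) (inj₁ vs) = hub M n<R n<B u∈ v∈ u≢v uv s∈ t∈ s≢t st us ut vs vt
          byCross (inj₁ us) (inj₂ vt) (inj₁ ut) (inj₂ vs) = hub M n<R n<B v∈ u∈ (u≢v ∘ sym) (sym′ uv) s∈ t∈ s≢t st vs vt us ut
          byCross (inj₂ us) (inj₁ vt) (inj₁ ut) (inj₂ vs) = swapGoal M (hub (swapModule M) n<B n<R t∈ s∈ (s≢t ∘ sym) (sym′ st) u∈ v∈ u≢v uv
            (sym′ ut) (sym′ vt) (sym′ us) (sym′ vs))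
          byCross (inj₁ us) (inj₂ vt) (inj₂ ut) (inj₁ vs) = swapGoal M (hub (swapModule M) n<B n<R s∈ t∈ s≢t st u∈ v∈ u≢v uv
            (sym′ us) (sym′ vs) (sym′ ut) (sym′ vt))

      -- 4m = 2m + 2m: `A` has lost red and takes `B` along as vertices joined in blue, and `anyR`
      -- bounds `R` together with `X r`.
      oneLarge : ∀ {r b A R B} (M : BigModule n r b K W X A R B) → n ≤ length R + length (X r) → length B + length (X b) < n → Goal M
      oneLarge {B = B} M hr hb = ≤-trans (linear 8 (λ w a p b x y s m → w ⊑ a ⊕ (p ⊕ b) ∷ a ⊕ (b ⊕ y ⊕ s) ⊑ m ∷ p ⊕ x ⊑ m ∷ [] ⊢ w ⊕ (x ⊕ (y ⊕ s)) ⊑ m ⊕ m)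
          (length W ∷ a ∷ ρ ∷ β ∷ x ∷ y ∷ Σ′ ∷ m + m ∷ [])
          (≤-reflexive total ∷ boundNoRed B uA A⊆ (noRedA hr) uB B⊆ hb (λ p q → A∉B q p) (λ p q → sym′ (blue q p)) ∷ anyR ∷ []))
        (≤-reflexive (sym four))
        where open Sides M

      twoLarge : ∀ {r b A R B} (M : BigModule n r b K W X A R B) → n ≤ length R + length (X r) → n ≤ length B + length (X b) → Goal M
      twoLarge M hr hb = bySize (ρ ≤? n) (β ≤? n)
        where
        open Sides M
        module M′ = Sides (swapModule M)
        add : ∀ {R₀ B₀} → ρ + x ≤ R₀ → β + y ≤ B₀ → R₀ + B₀ ≤ m + m + m → Goal M
        add {R₀} {B₀} hR hB h = ≤-trans (linear 10 (λ w a p b x y s m R B → w ⊑ a ⊕ (p ⊕ b) ∷ a ⊕ s ⊑ m ∷ p ⊕ x ⊑ R ∷ b ⊕ y ⊑ B ∷ R ⊕ B ⊑ m ⊕ m ⊕ m ∷ []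
              ⊢ w ⊕ (x ⊕ (y ⊕ s)) ⊑ m ⊕ m ⊕ (m ⊕ m))
            (length W ∷ a ∷ ρ ∷ β ∷ x ∷ y ∷ Σ′ ∷ m ∷ R₀ ∷ B₀ ∷ [])
            (≤-reflexive total ∷ boundNeither uA A⊆ (noRedA hr) (M′.noRedA hb) ∷ hR ∷ hB ∷ h ∷ []))
          (≤-reflexive (sym four))
        bySize : Dec (ρ ≤ n) → Dec (β ≤ n) → Goal M
        bySize (yes l) _ = add (smallR l) M′.anyR (≤-reflexive (sym (+-assoc m m m)))
        bySize (no _) (yes l) = add anyR (M′.smallR l) ≤-refl
        bySize (no l) (no l′) = bothLarge M (≰⇒> l) (≰⇒> l′)

      -- `R` and `B` pass from W to the joined sets, so the sum to be bounded does not change; only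
      -- W becomes smaller.
      neitherLarge : ∀ {r b A R B} (M : BigModule n r b K W X A R B) → length R + length (X r) < n → length B + length (X b) < n →
        (∀ X′ → Config c n (r ∷ b ∷ K) A X′ → length A + weight c X′ (r ∷ b ∷ K) ≤ n * 2 ^ (3 + j)) → Goal M
      neitherLarge {r} {b} {A} {R} {B} M hr hb ih = ≤-trans
        (linear 7 (λ w a p b x y s → w ⊑ a ⊕ (p ⊕ b) ∷ [] ⊢ w ⊕ (x ⊕ (y ⊕ s)) ⊑ a ⊕ (p ⊕ x ⊕ (b ⊕ y ⊕ s)))
          (length W ∷ a ∷ ρ ∷ β ∷ x ∷ y ∷ Σ′ ∷ []) (≤-reflexive total ∷ []))
        (≤-trans (≤-reflexive (cong (a +_) (sym (cong₂ _+_ redWeight (cong₂ _+_ blueWeight rest))))) (ih X₂ C₂))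
        where
        open Sides M
        X₁ X₂ : Fin k → List (Fin N)
        X₁ = update X r R
        X₂ = update X₁ b B
        sameB : length (X₁ b) ≡ y
        sameB = cong length (update-other X R (r≢b ∘ sym))
        C₁ : Config c n (r ∷ b ∷ K) A X₁
        C₁ = updateConfig r config uR (λ p q → awayX q (R⊆ p)) hr uA A⊆ (λ p q → A∉R q p) (λ p q → sym′ (red q p))
        C₂ : Config c n (r ∷ b ∷ K) A X₂
        C₂ = updateConfig b C₁ uB (λ p q → awayX (subst (_ ∈_) (update-other X R (r≢b ∘ sym)) q) (B⊆ p))
          (≤-trans (≤-reflexive (cong (λ z → suc (β + z)) sameB)) hb) uA id (λ p q → A∉B q p) (λ p q → sym′ (blue q p))
        redWeight : length (X₂ r) ≡ ρ + x
        redWeight = trans (cong length (update-other X₁ B r≢b)) (update-same X r R)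
        blueWeight : length (X₂ b) ≡ β + y
        blueWeight = trans (update-same X₁ b B) (cong (β +_) sameB)
        rest : weight c X₂ K ≡ Σ′
        rest = trans (weight-update X₁ B K b∉K) (weight-update X R K r∉K)

-- Induction on the number of colours

2^-above : ∀ j → suc j ≤ 2 ^ j
2^-above zero = ≤-refl
2^-above (suc j) = linear 2 (λ j m → 1+ j ⊑ m ∷ [] ⊢ 1+ (1+ j) ⊑ m ⊕ (m ⊕ # 0)) (j ∷ 2 ^ j ∷ []) (2^-above j ∷ [])

module _ {k N : ℕ} (c : EdgeColouring N k) (gallai : Gallai c) {n : ℕ} (3≤n : 3 ≤ n)
  (none : ∀ a → ¬ Cyc (Edge c a) (suc (n + n))) where

  -- A Gallai partition takes two vertices. With at most one, the joined sets are nearly everything,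
  -- and their total is at most (n - 1)(3 + j).
  bound-tiny : ∀ {K X} (W : List (Fin N)) j → length K ≡ 3 + j → (∀ i → length (X i) < n) → length W < 2 → length W + weight c X K ≤ n * 2 ^ (3 + j)
  bound-tiny {K} {X} W j lK small l = ≤-trans
    (linear 5 (λ w s n j m → 1+ w ⊑ # 2 ∷ s ⊕ (# 3 ⊕ j) ⊑ m ∷ [] ⊢ w ⊕ s ⊑ m) (length W ∷ weight c X K ∷ n ∷ j ∷ n * (3 + j) ∷ [])
      (l ∷ ≤-trans (≤-reflexive (cong (λ z → weight c X K + z) (sym lK))) (≤-trans (weight-bound c 3≤n none X K small) (≤-reflexive (cong (n *_) lK))) ∷ []))
    (*-monoʳ-≤ n (≤-trans (n≤1+n _) (2^-above (3 + j))))

  -- The recursion on |W| serves `neitherLarge`, the one case in which the palette is kept.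
  bound-step : ∀ j → Bound c n (1 + j) → Bound c n (2 + j) → Bound c n (3 + j)
  bound-step j ih₁ ih₂ K uK lK W X C = recurse (length W) K uK lK W X C ≤-refl
    where
    recurse : ∀ fuel K → Unique K → length K ≡ 3 + j → ∀ W X → Config c n K W X → length W ≤ fuel → length W + weight c X K ≤ n * 2 ^ (3 + j)
    recurse zero K uK lK W X C l = bound-tiny {K} {X} W j lK (Config.smallX C) (≤-trans (s≤s l) (s≤s z≤n))
    recurse (suc fuel) K uK lK W X C l = byLength (2 ≤? length W)
      where
      open Config C
      Goal : Set
      Goal = length W + weight c X K ≤ n * 2 ^ (3 + j)
      2≤K : 2 ≤ length K
      2≤K = ≤-trans (s≤s (s≤s z≤n)) (≤-reflexive (sym lK))
      byLength : Dec (2 ≤ length W) → Goal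
      byLength (no w<2) = bound-tiny {K} {X} W j lK smallX (≰⇒> w<2)
      byLength (yes 2≤W) = partition (gallaiPartition c gallai uK 2≤K uniqueW 2≤W palette)
        where
        partition : (∃₂ λ r b → r ∈ K × b ∈ K × r ≢ b × ∃ λ ℓ → Blocks c r b W ℓ × ∃₂ λ u w → u ∈ W × w ∈ W × ℓ u ≢ ℓ w) → Goal
        partition (r , b , r∈ , b∈ , r≢b , ℓ , bl , u₀ , w₀ , u₀∈ , w₀∈ , u₀≢w₀) = byPalette (extract r∈)
          where
          byPalette : (∃ λ K₁ → K ↭ r ∷ K₁) → Goal
          byPalette (K₁ , p) = byPalette₂ (extract b∈K₁)
            where
            b∈K₁ : b ∈ K₁
            b∈K₁ with Perm.∈-resp-↭ p b∈
            ... | here e = contradiction (sym e) r≢b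
            ... | there q = q
            byPalette₂ : (∃ λ K₂ → K₁ ↭ b ∷ K₂) → Goal
            byPalette₂ (K₂ , q) = ≤-trans (≤-reflexive (cong (length W +_) (sum-↭ (Perm.map⁺ (λ i → length (X i)) order))))
                (byClass (every W λ {v} _ → classSize v))
              where
              order : K ↭ r ∷ b ∷ K₂
              order = ↭-trans p (prep r q)
              lK₂ : length K₂ ≡ suc j
              lK₂ = suc-injective (suc-injective (trans (sym (Perm.↭-length order)) lK))
              C′ : Config c n (r ∷ b ∷ K₂) W X
              C′ = restrict c C uniqueW id λ u v ne → Perm.∈-resp-↭ order (palette u v ne)
              Class : Fin N → Set
              Class v = ∃₂ λ A A′ → A ++ A′ ↭ W × (∀ {u} → u ∈ A → ℓ u ≡ ℓ v) × (∀ {u} → u ∈ A′ → ℓ u ≢ ℓ v)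
              class : ∀ v → Class v
              class v = separate W λ {u} _ → toSum (ℓ u Fin.≟ ℓ v)
              classSize : ∀ v → length (proj₁ (class v)) ≤ n ⊎ n < length (proj₁ (class v))
              classSize v with length (proj₁ (class v)) ≤? n
              ... | yes l = inj₁ l
              ... | no l = inj₂ (≰⇒> l)
              small : (∀ {v} → v ∈ W → length (proj₁ (class v)) ≤ n) → SmallClasses n W ℓ
              small h [] _ _ _ = z≤n
              small h (z ∷ zs) u sub same = ≤-trans (⊆-length u (inClass (class z))) (h (sub (here refl)))
                where
                inClass : (C : Class z) → (z ∷ zs) ⊆ proj₁ C
                inClass (A , A′ , cov , _ , out) x∈ with ∈-++⁻ A (Perm.∈-resp-↭ (↭-sym cov) (sub x∈))
                ... | inj₁ y = y
                ... | inj₂ y = contradiction (same x∈ (here refl)) (out y)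
              Goal′ : Set
              Goal′ = length W + weight c X (r ∷ b ∷ K₂) ≤ n * 2 ^ (3 + j)
              byClass : (∀ {v} → v ∈ W → length (proj₁ (class v)) ≤ n) ⊎ (∃ λ v → v ∈ W × n < length (proj₁ (class v))) → Goal′
              byClass (inj₁ h) = bound-small c 3≤n none j lK₂ C′ bl (small h)
              byClass (inj₂ (v , v∈ , n<A)) = byModule (class v) n<A
                where
                byModule : (C : Class v) → n < length (proj₁ C) → Goal′
                byModule (A , A′ , cov , same , differ) n<A = bySides (separate A′ λ u∈ → Blocks.cross bl v∈ (A′⊆ u∈) (differ u∈ ∘ sym))
                  where
                  A⊆ : A ⊆ W
                  A⊆ = Perm.∈-resp-↭ cov ∘ ∈-++⁺ˡ
                  A′⊆ : A′ ⊆ W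
                  A′⊆ = Perm.∈-resp-↭ cov ∘ ∈-++⁺ʳ A
                  -- The partition has two different labels u₀ and w₀, so `A` is not all of W and
                  -- the recursion descends.
                  outside : ∃ λ u → u ∈ A′
                  outside with ℓ u₀ Fin.≟ ℓ v
                  ... | no ne = u₀ , inA′ u₀∈ ne
                    where
                    inA′ : ∀ {u} → u ∈ W → ℓ u ≢ ℓ v → u ∈ A′
                    inA′ u∈ ne with ∈-++⁻ A (Perm.∈-resp-↭ (↭-sym cov) u∈)
                    ... | inj₁ y = contradiction (same y) ne
                    ... | inj₂ y = y
                  ... | yes e with ∈-++⁻ A (Perm.∈-resp-↭ (↭-sym cov) w₀∈)
                  ... | inj₁ y = contradiction (trans e (sym (same y))) u₀≢w₀
                  ... | inj₂ y = w₀ , y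
                  bySides : (∃₂ λ R B → R ++ B ↭ A′ × (∀ {u} → u ∈ R → Edge c r v u) × (∀ {u} → u ∈ B → Edge c b v u)) → Goal′
                  bySides (R , B , RB , redR , blueB) = bySize (n ≤? length R + length (X r)) (n ≤? length B + length (X b))
                    where
                    R⊆ : R ⊆ A′
                    R⊆ = Perm.∈-resp-↭ RB ∘ ∈-++⁺ˡ
                    B⊆ : B ⊆ A′
                    B⊆ = Perm.∈-resp-↭ RB ∘ ∈-++⁺ʳ R
                    fromA : ∀ {u w} → u ∈ A → w ∈ A′ → colour c u w ≡ colour c v w
                    fromA u∈ w∈ = Blocks.twins bl (A⊆ u∈) v∈ (A′⊆ w∈) (same u∈) λ e → differ w∈ (trans (sym e) (same u∈))
                    mixed : ∀ {u w} → u ∈ R → w ∈ B → Edge c r u w ⊎ Edge c b u w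
                    mixed {u} {w} u∈ w∈ with colour c u w Fin.≟ r
                    ... | yes e = inj₁ e
                    ... | no ¬r = inj₂ (trans (noRainbow c gallai v≢u u≢w v≢w (λ e → ¬r (trans (sym e) (redR u∈)))
                          (λ e → r≢b (trans (sym (redR u∈)) (trans e (blueB w∈))))) (blueB w∈))
                      where
                      v≢u : v ≢ u
                      v≢u refl = differ (R⊆ u∈) refl
                      v≢w : v ≢ w
                      v≢w refl = differ (B⊆ w∈) refl
                      u≢w : u ≢ w
                      u≢w refl = r≢b (trans (sym (redR u∈)) (blueB w∈))
                    M : BigModule c n r b K₂ W X A R B
                    M = record { config = C′ ; uniqueK = unique-↭ order uK ; cover = ↭-trans (Perm.++⁺ˡ A RB) cov ; large = n<A
                      ; red = λ u w → trans (fromA u (R⊆ w)) (redR w) ; blue = λ u w → trans (fromA u (B⊆ w)) (blueB w) ; mixed = mixed }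
                    open BigModuleBounds c 3≤n none j ih₁ ih₂ {K = K₂} lK₂ {W = W} {X = X}
                    A<W : length A < length W
                    A<W = linear 3 (λ a a′ w → a ⊕ a′ ⊑ w ∷ # 1 ⊑ a′ ∷ [] ⊢ 1+ a ⊑ w) (length A ∷ length A′ ∷ length W ∷ [])
                      (≤-reflexive (trans (sym (List.length-++ A)) (Perm.↭-length cov)) ∷ ∈-length (proj₂ outside) ∷ [])
                    bySize : Dec (n ≤ length R + length (X r)) → Dec (n ≤ length B + length (X b)) → Goal′
                    bySize (yes hr) (yes hb) = twoLarge M hr hb
                    bySize (yes hr) (no hb) = oneLarge M hr (≰⇒> hb)
                    bySize (no hr) (yes hb) = swapGoal M (oneLarge (swapModule c M) hb (≰⇒> hr))
                    bySize (no hr) (no hb) = neitherLarge M (≰⇒> hr) (≰⇒> hb) λ X′ CA →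
                      recurse fuel (r ∷ b ∷ K₂) (unique-↭ order uK) (cong (λ z → suc (suc z)) lK₂) A X′ CA (≤-pred (≤-trans A<W l))

  bounds : ∀ j → Bound c n (1 + j) × Bound c n (2 + j)
  bounds zero = bound-one c 3≤n none , bound-two c 3≤n none
  bounds (suc j) with bounds j
  ... | b₁ , b₂ = b₂ , bound-step j b₁ b₂

  upperBound : 1 ≤ k → N ≤ n * 2 ^ k
  upperBound 1≤k = fromColours (m≤n⇒∃[o]m+o≡n 1≤k)
    where
    fromColours : (∃ λ j → suc j ≡ k) → N ≤ n * 2 ^ k
    fromColours (j , eq) = ≤-trans (≤-trans (≤-reflexive (sym (List.length-tabulate id))) (m≤m+n _ _))
      (≤-trans (proj₁ (bounds j) (allFin k) (Unique.allFin⁺ k) (trans (List.length-tabulate id) (sym eq)) (allFin N) (λ _ → [])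
        record { uniqueW = Unique.allFin⁺ N ; palette = λ _ _ _ → ∈-allFin _ ; uniqueX = λ _ → [] ; smallX = λ _ → ≤-trans (s≤s z≤n) 3≤n
               ; awayX = λ () ; joined = λ () }) (≤-reflexive (cong (λ z → n * 2 ^ z) eq)))

-- Cycles as injective functions, and their decidability

loop-monoCycle : ∀ {k N m} {c : EdgeColouring N k} {a} → Loop (Edge c a) (suc m) → MonoCycle c m
loop-monoCycle {m = m} {c} {a} ℓ = (λ i → vertex (toℕ i)) , (λ {i} {j} e → Fin.toℕ-injective (window 0 (Fin.toℕ<n i) (Fin.toℕ<n j) e)) ,
  a , λ i j e → subst (λ v → colour c (vertex (toℕ i)) v ≡ a) (sym (trans (cong vertex e) (wrap (toℕ i) (Fin.toℕ<n i)))) (adjacent (toℕ i))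
  where
  open Loop ℓ
  wrap : ∀ i → i < suc m → vertex (suc i % suc m) ≡ vertex (suc i)
  wrap i i< with m≤n⇒m<n∨m≡n i<
  ... | inj₁ l = cong vertex (m<n⇒m%n≡m l)
  ... | inj₂ refl = trans (cong vertex (n%n≡0 (suc m))) (sym (period 0))

anyVec? : ∀ {N} L {P : Vec (Fin N) L → Set} → (∀ v → Dec (P v)) → Dec (∃ P)
anyVec? zero P? with P? []
... | yes p = yes ([] , p)
... | no ¬p = no λ { ([] , p) → ¬p p }
anyVec? (suc L) P? with Fin.any? (λ x → anyVec? L (λ v → P? (x ∷ v)))
... | yes (x , v , p) = yes (x ∷ v , p)
... | no ¬p = no λ { (x ∷ v , p) → ¬p (x , v , p) }

-- The upper bound only refutes the absence of a cycle; an exhaustive search turns this into a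
-- cycle. It runs over vectors, since functions cannot be enumerated as they stand.
monoCycle? : ∀ {k N} (c : EdgeColouring N k) m → Dec (MonoCycle c m)
monoCycle? {k} {N} c m with anyVec? (suc m) {IsCycle} isCycle?
  where
  IsCycle : Vec (Fin N) (suc m) → Set
  IsCycle v = (∀ i j → lookup v i ≡ lookup v j → i ≡ j) × Σ (Fin k) λ a → ∀ i j → CycAdj m i j → colour c (lookup v i) (lookup v j) ≡ a
  isCycle? : ∀ v → Dec (IsCycle v)
  isCycle? v = (Fin.all? λ i → Fin.all? λ j → (lookup v i Fin.≟ lookup v j) →-dec (i Fin.≟ j)) ×-dec
    Fin.any? λ a → Fin.all? λ i → Fin.all? λ j → (toℕ j ≟ suc (toℕ i) % suc m) →-dec (colour c (lookup v i) (lookup v j) Fin.≟ a)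
... | yes (v , inj , a , adj) = yes (lookup v , (λ {i} {j} → inj i j) , a , adj)
... | no none = no λ (f , inj , a , adj) → none (Vec.tabulate f ,
      (λ i j e → inj (trans (sym (Vec.lookup∘tabulate f i)) (trans e (Vec.lookup∘tabulate f j)))) ,
      a , λ i j e → trans (cong₂ (colour c) (Vec.lookup∘tabulate f i) (Vec.lookup∘tabulate f j)) (adj i j e))

-- Extremal colouring: start from a monochromatic clique on 2n vertices and repeatedly join two
-- copies by a new colour.
module Doubling (n : ℕ) where

  size : ℕ → ℕ
  size j = n * 2 ^ suc j

  size-suc : ∀ j → size (suc j) ≡ size j + size j
  size-suc j = trans (cong (n *_) (cong (2 ^ suc j +_) (+-identityʳ (2 ^ suc j)))) (*-distribˡ-+ n (2 ^ suc j) (2 ^ suc j))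

  half : ℕ → ℕ → Bool × ℕ
  half s x with x <? s
  ... | yes _ = true , x
  ... | no _ = false , x ∸ s

  half-injective : ∀ s {x y} → half s x ≡ half s y → x ≡ y
  half-injective s {x} {y} e with x <? s | y <? s
  half-injective s refl | yes _ | yes _ = refl
  half-injective s {x} {y} e | no l | no l′ = ∸-cancelʳ-≡ (≮⇒≥ l) (≮⇒≥ l′) (cong proj₂ e)
  half-injective s () | yes _ | no _
  half-injective s () | no _ | yes _

  half-bound : ∀ s {x} → x < s + s → proj₂ (half s x) < s
  half-bound s {x} x< with x <? s
  ... | yes l = l
  ... | no l = +-cancelʳ-< s (x ∸ s) s (≤-trans (s≤s (≤-reflexive (m∸n+n≡m (≮⇒≥ l)))) x<)

  join : ∀ {j} → (ℕ → ℕ → Fin (suc j)) → Bool × ℕ → Bool × ℕ → Fin (suc (suc j))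
  join f (true , x) (true , y) = Fin.suc (f x y)
  join f (false , x) (false , y) = Fin.suc (f x y)
  join f (true , _) (false , _) = Fin.zero
  join f (false , _) (true , _) = Fin.zero

  col : ∀ j → ℕ → ℕ → Fin (suc j)
  col zero x y = Fin.zero
  col (suc j) x y = join (col j) (half (size j) x) (half (size j) y)

  col-sym : ∀ j x y → col j x y ≡ col j y x
  col-sym zero x y = refl
  col-sym (suc j) x y with half (size j) x | half (size j) y
  ... | true , x′ | true , y′ = cong Fin.suc (col-sym j x′ y′)
  ... | false , x′ | false , y′ = cong Fin.suc (col-sym j x′ y′)
  ... | true , _ | false , _ = refl
  ... | false , _ | true , _ = refl

  noRainbowCol : ∀ j x y z → col j x y ≢ col j y z → col j y z ≢ col j x z → col j x y ≢ col j x z → ⊥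
  noRainbowCol zero x y z p _ _ = p refl
  noRainbowCol (suc j) x y z p q r with half (size j) x | half (size j) y | half (size j) z
  ... | true , x′ | true , y′ | true , z′ = noRainbowCol j x′ y′ z′ (p ∘ cong Fin.suc) (q ∘ cong Fin.suc) (r ∘ cong Fin.suc)
  ... | false , x′ | false , y′ | false , z′ = noRainbowCol j x′ y′ z′ (p ∘ cong Fin.suc) (q ∘ cong Fin.suc) (r ∘ cong Fin.suc)
  ... | true , _ | true , _ | false , _ = q refl
  ... | false , _ | false , _ | true , _ = q refl
  ... | true , _ | false , _ | true , _ = p refl
  ... | false , _ | true , _ | false , _ = p refl
  ... | true , _ | false , _ | false , _ = r refl
  ... | false , _ | true , _ | true , _ = r refl

  sameHalf : ∀ {j f a} u v → join {j} f u v ≡ Fin.suc a → proj₁ u ≡ proj₁ v × f (proj₂ u) (proj₂ v) ≡ a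
  sameHalf (true , _) (true , _) refl = refl , refl
  sameHalf (false , _) (false , _) refl = refl , refl

  otherHalf : ∀ {j f} u v → join {j} f u v ≡ Fin.zero → proj₁ v ≡ not (proj₁ u)
  otherHalf (true , _) (false , _) _ = refl
  otherHalf (false , _) (true , _) _ = refl

  -- The newest colour is bipartite, so it admits no odd closed walk. A walk in an older colour
  -- stays in one half and is a walk of the preceding stage. At the bottom, 2n + 1 distinct values
  -- would lie below 2n.
  noCycle : ∀ j (g : ℕ → ℕ) a → (∀ i → g i < size j) → InjectiveBelow g (suc (n + n)) → g (suc (n + n)) ≡ g 0 →
    ¬ (∀ i → col j (g i) (g (suc i)) ≡ a)
  noCycle zero g a bound inj _ _ = <⇒≱ ≤-refl (≤-trans
    (≤-trans (≤-reflexive (sym (trans (List.length-map g (iota 0 (suc (n + n)))) (length-iota 0 (suc (n + n))))))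
      (⊆-length (unique-map inj (unique-iota 0 (suc (n + n))) (proj₂ ∘ ∈-iota⁻ 0 (suc (n + n)))) inside))
    (≤-reflexive (length-iota 0 (n + n))))
    where
    inside : map g (iota 0 (suc (n + n))) ⊆ iota 0 (n + n)
    inside p with ∈-map⁻ g {xs = iota 0 (suc (n + n))} p
    ... | i , _ , refl = ∈-iota⁺ 0 (n + n) z≤n (≤-trans (bound i) (≤-reflexive (trans (*-comm n 2) (cong (n +_) (+-identityʳ n)))))
  -- Every step changes the half, so after 2n steps the walk is in its initial half and the last
  -- step leaves it, although it returns to `g 0`.
  noCycle (suc j) g Fin.zero bound inj closed adj = not-fixed (trans (cong (proj₁ ∘ half (size j)) (sym closed))
      (trans (otherHalf (h (n + n)) (h (suc (n + n))) (adj (n + n))) (cong not (even n))))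
    where
    h : ℕ → Bool × ℕ
    h i = half (size j) (g i)
    flip : ∀ i → proj₁ (h (suc i)) ≡ not (proj₁ (h i))
    flip i = otherHalf (h i) (h (suc i)) (adj i)
    even : ∀ i → proj₁ (h (i + i)) ≡ proj₁ (h 0)
    even zero = refl
    even (suc i) = trans (flip (i + suc i)) (trans (cong not (trans (cong (proj₁ ∘ h) (+-suc i i)) (flip (i + i))))
      (trans (Bool.not-involutive (proj₁ (h (i + i)))) (even i)))
    not-fixed : ∀ {b} → b ≢ not b
    not-fixed {true} ()
    not-fixed {false} ()
  noCycle (suc j) g (Fin.suc a) bound inj closed adj = noCycle j (proj₂ ∘ h) a
    (λ i → half-bound (size j) (≤-trans (bound i) (≤-reflexive (size-suc j))))
    (λ {i} {i′} p q e → inj p q (half-injective (size j) (cong₂ _,_ (trans (side i) (sym (side i′))) e)))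
    (cong (proj₂ ∘ half (size j)) closed) (λ i → proj₂ (step i))
    where
    h : ℕ → Bool × ℕ
    h i = half (size j) (g i)
    step : ∀ i → proj₁ (h i) ≡ proj₁ (h (suc i)) × col j (proj₂ (h i)) (proj₂ (h (suc i))) ≡ a
    step i = sameHalf (h i) (h (suc i)) (adj i)
    side : ∀ i → proj₁ (h i) ≡ proj₁ (h 0)
    side zero = refl
    side (suc i) = trans (sym (proj₁ (step i))) (side i)

  -- `col` colours all pairs of natural numbers without rainbow triangles, so a single definition
  -- serves every N up to `size j`.
  colouring : ∀ N j → EdgeColouring N (suc j)
  colouring N j = record { colour = λ x y → col j (toℕ x) (toℕ y) ; symm = λ x y → col-sym j (toℕ x) (toℕ y) }

  colouring-gallai : ∀ N j → Gallai (colouring N j)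
  colouring-gallai N j x y z (_ , _ , _ , p , q , r) = noRainbowCol j (toℕ x) (toℕ y) (toℕ z) p q r

  noMonoCycle : ∀ {N j} → N ≤ size j → ¬ MonoCycle (colouring N j) (n + n)
  noMonoCycle {N} {j} N≤ (f , inj , a , adj) = noCycle j g a (λ i → ≤-trans (Fin.toℕ<n (f (index i))) N≤) g-inj closed
      (λ i → adj (index i) (index (suc i)) (trans (toℕ-index (suc i)) (trans (next i) (cong (λ z → suc z % L) (sym (toℕ-index i))))))
    where
    L : ℕ
    L = suc (n + n)
    index : ℕ → Fin L
    index i = fromℕ< (m%n<n i L)
    toℕ-index : ∀ i → toℕ (index i) ≡ i % L
    toℕ-index i = Fin.toℕ-fromℕ< (m%n<n i L)
    g : ℕ → ℕ
    g i = toℕ (f (index i))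
    next : ∀ i → suc i % L ≡ suc (i % L) % L
    next i = trans (cong (_% L) (+-comm 1 i)) (trans (mod-+ (n + n) i 1) (cong (_% L) (+-comm (i % L) 1)))
    index-% : ∀ i i′ → index i ≡ index i′ → i % L ≡ i′ % L
    index-% i i′ e = trans (sym (toℕ-index i)) (trans (cong toℕ e) (toℕ-index i′))
    g-inj : InjectiveBelow g L
    g-inj {i} {i′} p q e = trans (sym (m<n⇒m%n≡m p)) (trans (index-% i i′ (inj (Fin.toℕ-injective e))) (m<n⇒m%n≡m q))
    closed : g L ≡ g 0
    closed = cong (toℕ ∘ f) (Fin.toℕ-injective (trans (toℕ-index L) (trans (n%n≡0 L) (sym (toℕ-index 0)))))

theorem1p10 : ∀ (k n : ℕ) → 1 ≤ k → 3 ≤ n →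
    IsGRCycle k (n + n) (n * 2 ^ k + 1)
theorem1p10 k n 1≤k 3≤n = m≤n+m 1 (n * 2 ^ k) , arrows , sharp 1≤k
  where
  arrows : GArrowsCycle k (n + n) (n * 2 ^ k + 1)
  arrows c gallai = decidable-stable (monoCycle? c (n + n)) λ no-cycle →
    <⇒≱ (≤-reflexive (+-comm 1 (n * 2 ^ k)))
      (upperBound c gallai 3≤n (λ _ C → no-cycle (loop-monoCycle {c = c} (unroll C))) 1≤k)
  sharp : ∀ {k} → 1 ≤ k → ∀ N → 0 < N → N < n * 2 ^ k + 1 → ¬ GArrowsCycle k (n + n) N
  sharp {suc j} _ N _ N< arrow = Doubling.noMonoCycle n (≤-pred (≤-trans N< (≤-reflexive (+-comm _ 1))))
    (arrow (Doubling.colouring n N j) (Doubling.colouring-gallai n N j))
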